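{- Let $n$ and $t$ be integers with $n \ge 4$ and $0 \le t \le n-4$. (1) If $t \equiv \frac12 n(n-5) \pmod 4$, then there is a quadrangular embedding in an orientable surface of a simple graph with $n$ vertices and $\binom{n}{2}-t$ edges. In addition, there is a quadrangulation of the sphere $S_0$ by a simple graph with $n=4$ vertices and $\binom{4}{2}-2=4$ edges (the case $(n,t)=(4,2)$). (2) If $t \equiv \frac12 n(n-5) \pmod 2$ and $(n,t) \neq (5,0)$, then there is a quadrangular embedding in a nonorientable surface of a simple graph with $n$ vertices and $\binom{n}{2}-t$ edges. If $(n,t)=(5,0)$, no such nonorientable quadrangular embedding exists. In addition, there is a quadrangulation of the Klein bottle $N_2$ by a simple graph with $6$ vertices and $\binom{6}{2}-3=12$ edges (the case $(n,t)=(6,3)$).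
   Context: All graphs are simple. A surface is a connected compact 2-manifold without boundary; $S_g$ denotes the orientable surface of genus $g$ and $N_q$ the nonorientable surface of genus $q$ (so $S_0$ is the sphere and $N_2$ the Klein bottle). An embedding of a graph in a surface is cellular if every face is homeomorphic to an open disc; all embeddings are cellular. An embedding is quadrangular (a quadrangulation of the surface) if every face is bounded by a $4$-cycle. -}

module Defs where

open import Data.Nat using (ℕ; zero; suc; _+_; _<ᵇ_)
open import Data.Fin using (Fin; toℕ)
open import Data.Bool using (Bool; true; false; if_then_else_; _xor_; _∧_)
open import Data.List using (List; map; allFin)
open import Data.Nat.ListAction using (sum)
open import Data.Product using (Σ; ∃; _×_; _,_; proj₁; proj₂)
open import Relation.Binary.PropositionalEquality using (_≡_; _≢_)
open import Relation.Nullary using (¬_)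
open import Data.Integer as ℤ using (ℤ; +_)
open import Data.Integer.Divisibility as ℤD using ()

record SimpleGraph (n : ℕ) : Set where
  field
    adj    : Fin n → Fin n → Bool
    sym    : ∀ u v → adj u v ≡ adj v u
    irrefl : ∀ v → adj v v ≡ false

open SimpleGraph public

edgeCount : ∀ {n} → SimpleGraph n → ℕ
edgeCount {n} G =
  sum (map (λ i → sum (map (λ j → if (toℕ i <ᵇ toℕ j) ∧ adj G i j then 1 else 0)
                           (allFin n)))
           (allFin n))

-- connectivity (the surface is connected, so the embedded graph is)
data Reach {n} (G : SimpleGraph n) : Fin n → Fin n → Set where
  here : ∀ {v} → Reach G v v
  step : ∀ {u v w} → adj G u v ≡ true → Reach G v w → Reach G u w

Connected : ∀ {n} → SimpleGraph n → Set
Connected {n} G = ∀ (u v : Fin n) → Reach G u v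

iter : ∀ {A : Set} → (A → A) → ℕ → A → A
iter f zero    x = x
iter f (suc k) x = f (iter f k x)

-- Cellular embeddings, combinatorially: general rotation systems
-- (a cyclic rotation ρ v of the neighbours of each vertex v, with inverse
-- σ v, and an edge signature λ; λ u v = true means "twisted" edge).

record Embedding {n} (G : SimpleGraph n) : Set where
  field
    ρ      : Fin n → Fin n → Fin n
    σ      : Fin n → Fin n → Fin n
    sig    : Fin n → Fin n → Bool
    ρ-nbr  : ∀ v u → adj G v u ≡ true → adj G v (ρ v u) ≡ true
    σ-nbr  : ∀ v u → adj G v u ≡ true → adj G v (σ v u) ≡ true
    σρ     : ∀ v u → adj G v u ≡ true → σ v (ρ v u) ≡ u
    ρσ     : ∀ v u → adj G v u ≡ true → ρ v (σ v u) ≡ u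
    cyclic : ∀ v u w → adj G v u ≡ true → adj G v w ≡ true →
             ∃ λ k → iter (ρ v) k u ≡ w
    sig-sym : ∀ u v → sig u v ≡ sig v u

open Embedding public

-- face-tracing states: (u , v , ε) = about to traverse the dart u → v
-- with current local orientation ε
State : ℕ → Set
State n = Fin n × Fin n × Bool

-- one step of the standard face-tracing procedure for general rotation
-- systems: crossing a twisted edge flips the orientation; at the new
-- vertex continue with the rotation (ε = true) or its inverse (ε = false).
faceStep : ∀ {n} {G : SimpleGraph n} → Embedding G → State n → State n
faceStep E (u , v , ε) =
  let ε′ = ε xor sig E u v in
  (v , (if ε′ then ρ E v u else σ E v u) , ε′)

vtx : ∀ {n} → State n → Fin n
vtx s = proj₁ s

Quadrangular : ∀ {n} {G : SimpleGraph n} → Embedding G → Set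
Quadrangular {n} {G} E =
  ∀ (u v : Fin n) (ε : Bool) → adj G u v ≡ true →
    let s0 = (u , v , ε)
        s1 = faceStep E s0
        s2 = faceStep E s1
        s3 = faceStep E s2
        s4 = faceStep E s3 in
    (s4 ≡ s0) ×
    (vtx s0 ≢ vtx s1) × (vtx s0 ≢ vtx s2) × (vtx s0 ≢ vtx s3) ×
    (vtx s1 ≢ vtx s2) × (vtx s1 ≢ vtx s3) × (vtx s2 ≢ vtx s3)

-- the surface is orientable iff the signature is balanced (every cycle
-- has an even number of twisted edges), i.e. switching-equivalent to
-- the all-untwisted signature
Orientable : ∀ {n} {G : SimpleGraph n} → Embedding G → Set
Orientable {n} {G} E =
  ∃ λ (s : Fin n → Bool) → ∀ u v → adj G u v ≡ true → sig E u v ≡ (s u xor s v)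

OrientableQuad : ℕ → ℕ → Set
OrientableQuad n m =
  Σ (SimpleGraph n) λ G → Connected G × (edgeCount G ≡ m) ×
    Σ (Embedding G) λ E → Quadrangular E × Orientable E

NonorientableQuad : ℕ → ℕ → Set
NonorientableQuad n m =
  Σ (SimpleGraph n) λ G → Connected G × (edgeCount G ≡ m) ×
    Σ (Embedding G) λ E → Quadrangular E × ¬ Orientable E

_≡[mod_]_ : ℤ → ℕ → ℤ → Set
a ≡[mod k ] b = (+ k) ℤD.∣ (a ℤ.- b)

-- ½ n (n − 5) as an integer (n(n−5) is always even)
halfNN5 : ℕ → ℤ
halfNN5 n = ((+ n) ℤ.* ((+ n) ℤ.- (+ 5))) ℤ./ (+ 2)

{-# OPTIONS --safe #-}
module Submission where

-- Hartsfield's diagonal technique.  Let x p y q and e f g h be two faces such that x and y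
-- are not adjacent to e and g.  A tube between these faces carries the edges xe, xg, ye, yg,
-- which cut it into four quadrilaterals; two of them again have the diagonals xy and eg.
-- So if n₁ and n₂ are even and the vertices of two quadrangulations with parameters
-- (n₁ , t₁) and (n₂ , t₂) are paired in such a way that the pairs are diagonals of distinct
-- faces, then tubes between all pairs of the one and all pairs of the other yield a
-- quadrangulation with parameters (n₁ + n₂ , t₁ + t₂), with its vertices paired again.
-- Omitting one tube adds four to t.  If n₂ is odd, then one vertex w is left over; it has an
-- additional face with diagonal we, where e is paired with g.  After tubes joining we to
-- x₁y₁ and eg to x₂y₂, a third tube, between a face at x₁, w, y₁ and a face at x₂, g, y₂,
-- carries the missing edges gx₁, gy₁, wx₂, wy₂.
-- Hence adding the 4-cycle, with parameters (4 , 2), and K₈, with parameters (8 , 0), reduces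
-- everything to finitely many embeddings.  Nonorientability is inherited from the parts.
-- For K₅, switching makes all edges at one vertex untwisted, and a search through the
-- remaining rotations and signatures finds only untwisted quadrangulations.

open import Defs
open import Data.Nat using (ℕ; zero; suc; _+_; _*_; _∸_; _≤_; _<_; _<ᵇ_; z≤n; s≤s)
open import Data.Nat.Combinatorics using (_C_; nCk+nC[k+1]≡[n+1]C[k+1]; nC1≡n)
open import Data.Nat.Divisibility using (_∣_; _∣?_)
open import Data.Nat.DivMod using (m*n/n≡m)
open import Data.Nat.ListAction using (sum)
open import Data.Nat.Properties
  using ( +-assoc; +-comm; +-identityʳ; +-cancelˡ-≤; +-mono-≤; *-suc; *-identityʳ; *-mono-≤; m+n∸n≡m; m∸n+n≡m
        ; ≤-refl; ≤-reflexive; ≤-trans; m≤n+m; 1+n≰n; <-cmp; <⇒<ᵇ; <ᵇ⇒<; <-asym; <-irrefl; <⇒≤ )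
open import Data.Nat.Solver using (module +-*-Solver)
open import Data.Integer as ℤ using (ℤ; +_)
import Data.Integer.Divisibility.Signed as Signed
import Data.Integer.Properties as ℤ
import Data.Integer.Solver as ℤSolver
open import Data.Bool using (Bool; true; false; T; if_then_else_; _xor_; _∧_; _∨_; not)
open import Data.Bool.Properties using (∨-comm; ∧-comm; ∧-zeroʳ; ∧-identityʳ; ∨-identityʳ) renaming (_≟_ to _≟ᵇ_)
open import Data.Empty using (⊥-elim)
open import Data.Unit using (tt)
open import Data.Fin using (Fin; zero; suc; toℕ; _↑ˡ_; _↑ʳ_; splitAt)
open import Data.Fin.Patterns
open import Data.Fin.Properties
  using (_≟_; toℕ-injective; toℕ-↑ˡ; toℕ-↑ʳ; splitAt-↑ˡ; splitAt-↑ʳ; join-splitAt; ↑ˡ-injective; ↑ʳ-injective)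
open import Data.List using (List; []; _∷_; [_]; _++_; map; concat; length; tabulate; allFin; cartesianProduct; drop)
open import Data.List.Properties
  using (++-assoc; concat-++; concat-map; map-++; map-∘; map-cong; map-tabulate; tabulate-cong; length-++; length-map; length-drop)
open import Data.List.Membership.Propositional using (_∈_; _∉_)
open import Data.List.Membership.Propositional.Properties
  using (∈-∃++; ∈-++⁺ˡ; ∈-++⁺ʳ; ∈-++⁻; ∈-concat⁺′; ∈-concat⁻′; ∈-map⁺; ∈-map⁻; ∈-cartesianProduct⁻)
import Data.List.Membership.DecPropositional as DecMembership
open import Data.List.Relation.Unary.Any using (here; there)
open import Data.List.Relation.Unary.All as All using (All; []; _∷_)
import Data.List.Relation.Unary.All.Properties as All
open import Data.List.Relation.Unary.AllPairs using (AllPairs; []; _∷_)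
open import Data.List.Relation.Unary.Unique.Propositional using (Unique)
import Data.List.Relation.Unary.Unique.Propositional.Properties as Unique
open import Data.List.Relation.Binary.Permutation.Propositional
  using (_↭_; prep; swap; ↭⇒↭ₛ; ↭-refl; ↭-sym; ↭-trans; ↭-reflexive; module PermutationReasoning)
import Data.List.Relation.Binary.Permutation.Propositional as Perm
open import Data.List.Relation.Binary.Permutation.Propositional.Properties
  using (∈-resp-↭; All-resp-↭; ++⁺ˡ; ++⁺ʳ; ++-comm; shift; ↭-map-inv; ↭-length) renaming (map⁺ to ↭-map⁺)
import Data.List.Relation.Binary.Permutation.Setoid.Properties as PermS
open import Data.Product using (Σ; ∃; _×_; _,_; proj₁; proj₂)
open import Data.Product.Properties using (≡-dec)
open import Data.Sum using (_⊎_; inj₁; inj₂)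
open import Data.Vec using (Vec; []; _∷_; lookup)
open import Function using (case_of_; _∘_; id)
open import Relation.Binary using (tri<; tri≈; tri>)
open import Relation.Binary.PropositionalEquality
  using (_≡_; _≢_; refl; trans; cong; cong₂; subst; subst₂; ≢-sym; setoid; module ≡-Reasoning)
  renaming (sym to ≡-sym)
open import Relation.Nullary using (¬_; yes; no; does; Dec)
open import Relation.Nullary.Decidable using (False; toWitnessFalse)

-- While a tube is being filled the embedding is not quadrangular, and before the first tube it is
-- not even connected. The proof therefore works with rotation systems only: `Embedding` admits
-- disconnected graphs, a tube is the insertion of one edge between two face walks, which merges
-- them, and the remaining edges are chords of the merged walk. Quadrangularity is relaxed by a list
-- of exempt face walks that is empty at the end. The same list reserves quadrilaterals for later
-- tubes, so that no tube destroys a face meant for another. The bound on t shapes the recursion.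
-- Removing a 4-cycle lowers n - 4 by four but t by only two, so t ≤ n - 4 may be lost; with one
-- tube omitted t drops by six and the bound survives. This needs t ≥ 6. For 2 ≤ t ≤ 5 the plain
-- step leads to t ≤ 3, which is why the recursion admits all such t; for t ≤ 1 only K₈ can be
-- removed.

private variable
  n : ℕ
  A : Set

-- Boolean tests on vertices.

infix 5 _==_

_==_ : Fin n → Fin n → Bool
u == v = does (u ≟ v)

==-refl : (u : Fin n) → (u == u) ≡ true
==-refl u with u ≟ u
... | yes _  = refl
... | no u≢u = ⊥-elim (u≢u refl)

==-neq : {u v : Fin n} → u ≢ v → (u == v) ≡ false
==-neq {u = u} {v} u≢v with u ≟ v
... | yes u≡v = ⊥-elim (u≢v u≡v)
... | no _    = refl

==-sound : {u v : Fin n} → (u == v) ≡ true → u ≡ v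
==-sound {u = u} {v} p with u ≟ v
... | yes u≡v = u≡v

==-sym : (u v : Fin n) → (u == v) ≡ (v == u)
==-sym u v with u ≟ v | v ≟ u
... | yes _ | yes _ = refl
... | no _  | no _  = refl
... | yes p | no ¬q = ⊥-elim (¬q (≡-sym p))
... | no ¬p | yes q = ⊥-elim (¬p (≡-sym q))

true≢false : true ≢ false
true≢false ()

∨-elim : ∀ x y → x ∨ y ≡ true → x ≡ true ⊎ y ≡ true
∨-elim true  y _ = inj₁ refl
∨-elim false y p = inj₂ p

∧-elim : ∀ x y → x ∧ y ≡ true → x ≡ true × y ≡ true
∧-elim true true _ = refl , refl

∨-introˡ : ∀ {x} y → x ≡ true → x ∨ y ≡ true
∨-introˡ y refl = refl

∨-introʳ : ∀ x {y} → y ≡ true → x ∨ y ≡ true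
∨-introʳ true  refl = refl
∨-introʳ false refl = refl

≢true⇒false : ∀ {x} → x ≢ true → x ≡ false
≢true⇒false {true}  p = ⊥-elim (p refl)
≢true⇒false {false} p = refl

-- Cyclic rotations at a single vertex

record IsRotation (N : Fin n → Bool) (f g : Fin n → Fin n) : Set where
  field
    f-nbr  : ∀ u → N u ≡ true → N (f u) ≡ true
    g-nbr  : ∀ u → N u ≡ true → N (g u) ≡ true
    gf     : ∀ u → N u ≡ true → g (f u) ≡ u
    fg     : ∀ u → N u ≡ true → f (g u) ≡ u
    orbit  : ∀ u w → N u ≡ true → N w ≡ true → ∃ λ k → iter f k u ≡ w

rotation-cong : {N N′ : Fin n → Bool} {f g : Fin n → Fin n} →
  (∀ u → N u ≡ N′ u) → IsRotation N f g → IsRotation N′ f g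
rotation-cong {N = N} {N′} eq R = record
  { f-nbr = λ u p → to (f-nbr u (from p))
  ; g-nbr = λ u p → to (g-nbr u (from p))
  ; gf    = λ u p → gf u (from p)
  ; fg    = λ u p → fg u (from p)
  ; orbit = λ u w p q → orbit u w (from p) (from q)
  }
  where
  open IsRotation R
  to : ∀ {u} → N u ≡ true → N′ u ≡ true
  to {u} = trans (≡-sym (eq u))
  from : ∀ {u} → N′ u ≡ true → N u ≡ true
  from {u} = trans (eq u)

iter-+ : {A : Set} (f : A → A) (j k : ℕ) (x : A) →
  iter f j (iter f k x) ≡ iter f (j + k) x
iter-+ f zero    k x = refl
iter-+ f (suc j) k x = cong f (iter-+ f j k x)

-- The new neighbour b is placed between p and q = f p.
insert-f insert-g : (p b q : Fin n) → (Fin n → Fin n) → Fin n → Fin n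
insert-f p b q f u = if u == b then q else if u == p then b else f u
insert-g p b q g u = if u == b then p else if u == q then b else g u

module _ (p b q : Fin n) (f : Fin n → Fin n) where

  insert-f-b : insert-f p b q f b ≡ q
  insert-f-b rewrite ==-refl b = refl

  insert-f-p : p ≢ b → insert-f p b q f p ≡ b
  insert-f-p p≢b rewrite ==-neq p≢b | ==-refl p = refl

  insert-f-other : ∀ {u} → u ≢ b → u ≢ p → insert-f p b q f u ≡ f u
  insert-f-other u≢b u≢p rewrite ==-neq u≢b | ==-neq u≢p = refl

module InsertRotation {N : Fin n → Bool} {f g : Fin n → Fin n} (R : IsRotation N f g)
  (b q : Fin n) (Nb : N b ≡ false) (Nq : N q ≡ true) where
  open IsRotation R

  p : Fin n
  p = g q

  f′ g′ : Fin n → Fin n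
  f′ = insert-f p b q f
  g′ = insert-g p b q g

  N′ : Fin n → Bool
  N′ u = N u ∨ (u == b)

  Np : N p ≡ true
  Np = g-nbr q Nq

  ≢b : ∀ {u} → N u ≡ true → u ≢ b
  ≢b Nu refl = true≢false (trans (≡-sym Nu) Nb)

  old : ∀ {u} → N u ≡ true → N′ u ≡ true
  old = ∨-introˡ _

  N′b : N′ b ≡ true
  N′b = ∨-introʳ (N b) (==-refl b)

  split : ∀ {u} → N′ u ≡ true → N u ≡ true ⊎ u ≡ b
  split {u} h with ∨-elim (N u) (u == b) h
  ... | inj₁ x = inj₁ x
  ... | inj₂ y = inj₂ (==-sound y)

  f′b : f′ b ≡ q
  f′b = insert-f-b p b q f
  f′p : f′ p ≡ b
  f′p = insert-f-p p b q f (≢b Np)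
  g′b : g′ b ≡ p
  g′b = insert-f-b q b p g
  g′q : g′ q ≡ b
  g′q = insert-f-p q b p g (≢b Nq)

  fu≢q : ∀ {u} → N u ≡ true → u ≢ p → f u ≢ q
  fu≢q {u} Nu u≢p e = u≢p (trans (≡-sym (gf u Nu)) (cong g e))
  gu≢p : ∀ {u} → N u ≡ true → u ≢ q → g u ≢ p
  gu≢p {u} Nu u≢q e = u≢q (trans (≡-sym (fg u Nu)) (trans (cong f e) (fg q Nq)))

  f′old : ∀ {u} → N u ≡ true → u ≢ p → f′ u ≡ f u
  f′old Nu u≢p = insert-f-other p b q f (≢b Nu) u≢p
  g′old : ∀ {u} → N u ≡ true → u ≢ q → g′ u ≡ g u
  g′old Nu u≢q = insert-f-other q b p g (≢b Nu) u≢q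

  Orb : Fin n → Fin n → Set
  Orb u w = ∃ λ k → iter f′ k u ≡ w

  orb-trans : ∀ {u v w} → Orb u v → Orb v w → Orb u w
  orb-trans {u} (j , refl) (k , refl) = k + j , ≡-sym (iter-+ f′ k j u)

  orb-old : ∀ {u} k → N u ≡ true → N (iter f k u) ≡ true × Orb u (iter f k u)
  orb-old zero Nu = Nu , 0 , refl
  orb-old {u} (suc k) Nu with orb-old k Nu
  ... | Nx , o = f-nbr _ Nx , orb-trans o (case iter f k u ≟ p of λ where
    (no x≢p)  → 1 , f′old Nx x≢p
    -- Leaving p by `f′` visits b before q = f p, so this one step of f takes two steps of `f′`.
    (yes x≡p) → 2 , trans (cong f′ (trans (cong f′ x≡p) f′p))
                      (trans f′b (≡-sym (trans (cong f x≡p) (fg q Nq)))))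

  orb-oo : ∀ {u w} → N u ≡ true → N w ≡ true → Orb u w
  orb-oo Nu Nw with orbit _ _ Nu Nw
  ... | k , refl = proj₂ (orb-old k Nu)

  b⇒q : Orb b q
  b⇒q = 1 , f′b
  p⇒b : Orb p b
  p⇒b = 1 , f′p

  rotation′ : IsRotation N′ f′ g′
  rotation′ = record { f-nbr = fn ; g-nbr = gn ; gf = gf′ ; fg = fg′ ; orbit = orb }
    where
    fn : ∀ u → N′ u ≡ true → N′ (f′ u) ≡ true
    fn u h with split h
    ... | inj₂ refl = subst (λ x → N′ x ≡ true) (≡-sym f′b) (old Nq)
    ... | inj₁ Nu = case u ≟ p of λ where
      (yes refl) → subst (λ x → N′ x ≡ true) (≡-sym f′p) N′b
      (no u≢p) → subst (λ x → N′ x ≡ true) (≡-sym (f′old Nu u≢p)) (old (f-nbr u Nu))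
    gn : ∀ u → N′ u ≡ true → N′ (g′ u) ≡ true
    gn u h with split h
    ... | inj₂ refl = subst (λ x → N′ x ≡ true) (≡-sym g′b) (old Np)
    ... | inj₁ Nu = case u ≟ q of λ where
      (yes refl) → subst (λ x → N′ x ≡ true) (≡-sym g′q) N′b
      (no u≢q) → subst (λ x → N′ x ≡ true) (≡-sym (g′old Nu u≢q)) (old (g-nbr u Nu))
    gf′ : ∀ u → N′ u ≡ true → g′ (f′ u) ≡ u
    gf′ u h with split h
    ... | inj₂ refl = trans (cong g′ f′b) g′q
    ... | inj₁ Nu = case u ≟ p of λ where
      (yes refl) → trans (cong g′ f′p) g′b
      (no u≢p) → trans (cong g′ (f′old Nu u≢p))
                       (trans (g′old (f-nbr u Nu) (fu≢q Nu u≢p)) (gf u Nu))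
    fg′ : ∀ u → N′ u ≡ true → f′ (g′ u) ≡ u
    fg′ u h with split h
    ... | inj₂ refl = trans (cong f′ g′b) f′p
    ... | inj₁ Nu = case u ≟ q of λ where
      (yes refl) → trans (cong f′ g′q) f′b
      (no u≢q) → trans (cong f′ (g′old Nu u≢q))
                       (trans (f′old (g-nbr u Nu) (gu≢p Nu u≢q)) (fg u Nu))
    orb : ∀ u w → N′ u ≡ true → N′ w ≡ true → Orb u w
    orb u w hu hw with split hu | split hw
    ... | inj₁ Nu   | inj₁ Nw   = orb-oo Nu Nw
    ... | inj₁ Nu   | inj₂ refl = orb-trans (orb-oo Nu Np) p⇒b
    ... | inj₂ refl | inj₁ Nw   = orb-trans b⇒q (orb-oo Nq Nw)
    ... | inj₂ refl | inj₂ refl = orb-trans (orb-trans b⇒q (orb-oo Nq Np)) p⇒b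

-- Adding an edge to a graph.

link : (a b u v : Fin n) → Bool
link a b u v = (((u == a) ∧ (v == b)) ∨ ((u == b) ∧ (v == a))) ∧ not (u == v)

link-sym : (a b u v : Fin n) → link a b u v ≡ link a b v u
link-sym a b u v = cong₂ _∧_
  (trans (∨-comm ((u == a) ∧ (v == b)) _)
         (cong₂ _∨_ (∧-comm (u == b) (v == a)) (∧-comm (u == a) (v == b))))
  (cong not (==-sym u v))

-- The factor `not (u == v)` of `link` excludes a loop even for a = b, so that the result is a
-- simple graph for every a and b.
addEdge : SimpleGraph n → Fin n → Fin n → SimpleGraph n
adj    (addEdge G a b) u v = adj G u v ∨ link a b u v
sym    (addEdge G a b) u v = cong₂ _∨_ (sym G u v) (link-sym a b u v)
irrefl (addEdge G a b) v rewrite irrefl G v | ==-refl v = ∧-zeroʳ _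

module _ (G : SimpleGraph n) {a b : Fin n} where

  addEdge-old : ∀ {u v} → adj G u v ≡ true → adj (addEdge G a b) u v ≡ true
  addEdge-old = ∨-introˡ _

  addEdge-new : a ≢ b → adj (addEdge G a b) a b ≡ true
  addEdge-new a≢b rewrite ==-refl a | ==-refl b | ==-neq a≢b = ∨-introʳ (adj G a b) refl

  addEdge-elim : ∀ {u v} → adj (addEdge G a b) u v ≡ true →
    adj G u v ≡ true ⊎ (u ≡ a × v ≡ b) ⊎ (u ≡ b × v ≡ a)
  addEdge-elim {u} {v} h with ∨-elim (adj G u v) _ h
  ... | inj₁ x = inj₁ x
  ... | inj₂ y with ∨-elim ((u == a) ∧ (v == b)) _ (proj₁ (∧-elim _ (not (u == v)) y))
  ...   | inj₁ z = let p , q = ∧-elim (u == a) _ z in inj₂ (inj₁ (==-sound p , ==-sound q))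
  ...   | inj₂ z = let p , q = ∧-elim (u == b) _ z in inj₂ (inj₂ (==-sound p , ==-sound q))

  addEdge-false : ∀ {u v} → adj G u v ≡ false → ¬ (u ≡ a × v ≡ b) → ¬ (u ≡ b × v ≡ a) →
    adj (addEdge G a b) u v ≡ false
  addEdge-false {u} {v} h ¬1 ¬2 = ≢true⇒false λ t → case addEdge-elim t of λ where
    (inj₁ x)        → true≢false (trans (≡-sym x) h)
    (inj₂ (inj₁ x)) → ¬1 x
    (inj₂ (inj₂ x)) → ¬2 x

-- Face tracing and reversal.

module _ {G : SimpleGraph n} (E : Embedding G) where

  rotation : ∀ v → IsRotation (adj G v) (ρ E v) (σ E v)
  rotation v = record
    { f-nbr = ρ-nbr E v ; g-nbr = σ-nbr E v ; gf = σρ E v ; fg = ρσ E v ; orbit = cyclic E v }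

module _ {G : SimpleGraph n} where

  mkEmbedding : (r s : Fin n → Fin n → Fin n) (sg : Fin n → Fin n → Bool) →
    (∀ v → IsRotation (adj G v) (r v) (s v)) → (∀ u v → sg u v ≡ sg v u) → Embedding G
  mkEmbedding r s sg R ss = record
    { ρ = r ; σ = s ; sig = sg
    ; ρ-nbr = λ v → f-nbr (R v) ; σ-nbr = λ v → g-nbr (R v)
    ; σρ = λ v → gf (R v) ; ρσ = λ v → fg (R v) ; cyclic = λ v → orbit (R v)
    ; sig-sym = ss }
    where open IsRotation

valid : SimpleGraph n → State n → Set
valid G s = adj G (proj₁ s) (proj₁ (proj₂ s)) ≡ true

module _ {G : SimpleGraph n} (E : Embedding G) where

  private F = faceStep E

  turn : Fin n → Fin n → Bool → Fin n
  turn v u ε = if ε then ρ E v u else σ E v u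

  -- The same edge side walked in the opposite direction.
  rev : State n → State n
  rev (u , v , ε) = v , u , not (ε xor sig E u v)

  not-xor : ∀ x y → not (not (x xor y) xor y) ≡ x
  not-xor true  true  = refl
  not-xor true  false = refl
  not-xor false true  = refl
  not-xor false false = refl

  rev-rev : ∀ s → rev (rev s) ≡ s
  rev-rev (u , v , ε) rewrite sig-sym E v u = cong (λ x → u , v , x) (not-xor ε (sig E u v))

  rev-valid : ∀ s → valid G s → valid G (rev s)
  rev-valid (u , v , ε) h = trans (sym G v u) h

  turn-nbr : ∀ v u ε → adj G v u ≡ true → adj G v (turn v u ε) ≡ true
  turn-nbr v u true  = ρ-nbr E v u
  turn-nbr v u false = σ-nbr E v u

  turn-turn : ∀ v u ε → adj G v u ≡ true → turn v (turn v u ε) (not ε) ≡ u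
  turn-turn v u true  = σρ E v u
  turn-turn v u false = ρσ E v u

  step-valid : ∀ s → valid G s → valid G (F s)
  step-valid (u , v , ε) h = turn-nbr v u _ (trans (sym G v u) h)

  -- Reversal conjugates face tracing into its inverse, because `turn` is undone by the turn of
  -- opposite orientation. Injectivity of `faceStep` and the tracing of reversed faces rest on this.
  step-rev-step : ∀ s → valid G s → F (rev (F s)) ≡ rev s
  step-rev-step (u , v , ε) h =
    cong₂ (λ x y → v , x , y) (trans (cong (turn v (turn v u ε′)) e) (turn-turn v u ε′ (trans (sym G v u) h))) e
    where
    ε′ = ε xor sig E u v
    w = turn v u ε′
    e : not (ε′ xor sig E v w) xor sig E w v ≡ not ε′
    e rewrite sig-sym E w v = lem ε′ (sig E v w)
      where
      lem : ∀ x y → not (x xor y) xor y ≡ not x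
      lem true  true  = refl
      lem true  false = refl
      lem false true  = refl
      lem false false = refl

  step-injective : ∀ {s t} → valid G s → valid G t → F s ≡ F t → s ≡ t
  step-injective {s} {t} hs ht e = begin
    s                          ≡⟨ rev-rev s ⟨
    rev (rev s)                ≡⟨ cong rev (step-rev-step s hs) ⟨
    rev (F (rev (F s)))        ≡⟨ cong (λ x → rev (F (rev x))) e ⟩
    rev (F (rev (F t)))        ≡⟨ cong rev (step-rev-step t ht) ⟩
    rev (rev t)                ≡⟨ rev-rev t ⟩
    t                          ∎
    where open ≡-Reasoning

module _ {G : SimpleGraph n} (E : Embedding G) where

  -- The state before a positively oriented corner at x arrives from `σ E x w`. Its own orientation
  -- depends on the twist of the edge; only the orientation after crossing is determined.
  step-inverse : ∀ u v ε {x w} → valid G (u , v , ε) → faceStep E (u , v , ε) ≡ (x , w , true) →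
    v ≡ x × ε xor sig E u v ≡ true × u ≡ σ E x w
  step-inverse u v ε {x} {w} h e = v≡x , ε′≡true , (begin
    u                              ≡⟨ turn-turn E v u ε′ (trans (sym G v u) h) ⟨
    turn E v (turn E v u ε′) (not ε′) ≡⟨ cong₂ (λ y z → turn E v y (not z)) w≡ ε′≡true ⟩
    σ E v w                        ≡⟨ cong (λ y → σ E y w) v≡x ⟩
    σ E x w                        ∎)
    where
    open ≡-Reasoning
    ε′ = ε xor sig E u v
    v≡x : v ≡ x
    v≡x = cong proj₁ e
    w≡ : turn E v u ε′ ≡ w
    w≡ = cong (λ t → proj₁ (proj₂ t)) e
    ε′≡true : ε′ ≡ true
    ε′≡true = cong (λ t → proj₂ (proj₂ t)) e

-- Inserting an untwisted edge ab so that, at positive orientation, it comes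
-- just before the edge aq at a and just before the edge bs at b.
module InsertEdge {G : SimpleGraph n} (E : Embedding G) (a b q s : Fin n)
  (ab : adj G a b ≡ false) (a≢b : a ≢ b) (aq : adj G a q ≡ true) (bs : adj G b s ≡ true) where

  G′ : SimpleGraph n
  G′ = addEdge G a b

  ba : adj G b a ≡ false
  ba = trans (sym G b a) ab

  module Ia = InsertRotation (rotation E a) b q ab aq
  module Ib = InsertRotation (rotation E b) a s ba bs

  ρ′ σ′ : Fin n → Fin n → Fin n
  ρ′ v = if v == a then Ia.f′ else if v == b then Ib.f′ else ρ E v
  σ′ v = if v == a then Ia.g′ else if v == b then Ib.g′ else σ E v

  -- The conjunct `adj G u v` clears whatever value `sig E` has at the non-edge ab, which makes the
  -- new edge untwisted.
  sig′ : Fin n → Fin n → Bool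
  sig′ u v = sig E u v ∧ adj G u v

  b≢a : b ≢ a
  b≢a e = a≢b (≡-sym e)

  N′a : ∀ u → Ia.N′ u ≡ adj G′ a u
  N′a u rewrite ==-refl a | ==-neq a≢b = cong (adj G a u ∨_) (lem u)
    where
    lem : ∀ u → (u == b) ≡ ((u == b) ∨ false) ∧ not (a == u)
    lem u with u ≟ b
    ... | yes refl rewrite ==-neq a≢b = refl
    ... | no _ = refl

  N′b : ∀ u → Ib.N′ u ≡ adj G′ b u
  N′b u rewrite ==-refl b | ==-neq b≢a = cong (adj G b u ∨_) (lem u)
    where
    lem : ∀ u → (u == a) ≡ (u == a) ∧ not (b == u)
    lem u with u ≟ a
    ... | yes refl rewrite ==-neq b≢a = refl
    ... | no _ = refl

  N′o : ∀ {v} → v ≢ a → v ≢ b → ∀ u → adj G v u ≡ adj G′ v u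
  N′o {v} v≢a v≢b u rewrite ==-neq v≢a | ==-neq v≢b = ≡-sym (∨-identityʳ _)

  ρ′a : ρ′ a ≡ Ia.f′
  ρ′a rewrite ==-refl a = refl
  σ′a : σ′ a ≡ Ia.g′
  σ′a rewrite ==-refl a = refl
  ρ′b : ρ′ b ≡ Ib.f′
  ρ′b rewrite ==-neq b≢a | ==-refl b = refl
  σ′b : σ′ b ≡ Ib.g′
  σ′b rewrite ==-neq b≢a | ==-refl b = refl
  ρ′o : ∀ {v} → v ≢ a → v ≢ b → ρ′ v ≡ ρ E v
  ρ′o v≢a v≢b rewrite ==-neq v≢a | ==-neq v≢b = refl
  σ′o : ∀ {v} → v ≢ a → v ≢ b → σ′ v ≡ σ E v
  σ′o v≢a v≢b rewrite ==-neq v≢a | ==-neq v≢b = refl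

  rotation′-a : IsRotation (adj G′ a) (ρ′ a) (σ′ a)
  rotation′-a rewrite ρ′a | σ′a = rotation-cong N′a Ia.rotation′

  rotation′-b : IsRotation (adj G′ b) (ρ′ b) (σ′ b)
  rotation′-b rewrite ρ′b | σ′b = rotation-cong N′b Ib.rotation′

  rotation′-o : ∀ {v} → v ≢ a → v ≢ b → IsRotation (adj G′ v) (ρ′ v) (σ′ v)
  rotation′-o {v} v≢a v≢b rewrite ρ′o v≢a v≢b | σ′o v≢a v≢b =
    rotation-cong (N′o v≢a v≢b) (rotation E v)

  rotation′ : ∀ v → IsRotation (adj G′ v) (ρ′ v) (σ′ v)
  rotation′ v = case v ≟ a of λ where
    (yes refl) → rotation′-a
    (no v≢a) → case v ≟ b of λ where
      (yes refl) → rotation′-b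
      (no v≢b) → rotation′-o v≢a v≢b

  E′ : Embedding G′
  E′ = mkEmbedding ρ′ σ′ sig′ rotation′ (λ u v → cong₂ _∧_ (sig-sym E u v) (sym G u v))

  F F′ : State n → State n
  F  = faceStep E
  F′ = faceStep E′

  sig′-old : ∀ {u v} → adj G u v ≡ true → sig′ u v ≡ sig E u v
  sig′-old {u} {v} h rewrite h = ∧-identityʳ _

  sig′-ab : sig′ a b ≡ false
  sig′-ab rewrite ab = ∧-zeroʳ _

  sig′-ba : sig′ b a ≡ false
  sig′-ba rewrite ba = ∧-zeroʳ _

  -- c and d leave the two corners; n₁ and n₂ walk along the new edge.
  c c̄ d d̄ n₁ n₂ : State n
  c  = a , q , true
  c̄  = a , σ E a q , false
  d  = b , s , true
  d̄  = b , σ E b s , false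
  n₁ = a , b , true
  n₂ = b , a , true

  -- States that leave one of the two corners where the new edge ends; `c̄` and `d̄` belong to
  -- crossings of the corners in the negative direction. All other turns are unaffected by the
  -- insertion.
  Special : State n → Set
  Special t = t ≡ c ⊎ t ≡ c̄ ⊎ t ≡ d ⊎ t ≡ d̄

  turn′-a : ∀ u ε → adj G a u ≡ true → ¬ Special (a , turn E a u ε , ε) →
    turn E′ a u ε ≡ turn E a u ε
  turn′-a u true h ¬s = trans (cong (λ f → f u) ρ′a) (Ia.f′old h λ where
    refl → ¬s (inj₁ (cong (λ x → a , x , true) (ρσ E a q aq))))
  turn′-a u false h ¬s = trans (cong (λ f → f u) σ′a) (Ia.g′old h λ where
    refl → ¬s (inj₂ (inj₁ refl)))

  turn′-b : ∀ u ε → adj G b u ≡ true → ¬ Special (b , turn E b u ε , ε) →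
    turn E′ b u ε ≡ turn E b u ε
  turn′-b u true h ¬s = trans (cong (λ f → f u) ρ′b) (Ib.f′old h λ where
    refl → ¬s (inj₂ (inj₂ (inj₁ (cong (λ x → b , x , true) (ρσ E b s bs))))))
  turn′-b u false h ¬s = trans (cong (λ f → f u) σ′b) (Ib.g′old h λ where
    refl → ¬s (inj₂ (inj₂ (inj₂ refl))))

  turn′-o : ∀ v u ε → v ≢ a → v ≢ b → turn E′ v u ε ≡ turn E v u ε
  turn′-o v u true  v≢a v≢b = cong (λ f → f u) (ρ′o v≢a v≢b)
  turn′-o v u false v≢a v≢b = cong (λ f → f u) (σ′o v≢a v≢b)

  turn′-old : ∀ v u ε → adj G v u ≡ true → ¬ Special (v , turn E v u ε , ε) →
    turn E′ v u ε ≡ turn E v u ε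
  turn′-old v u ε h ¬s = case v ≟ a of λ where
    (yes refl) → turn′-a u ε h ¬s
    (no v≢a) → case v ≟ b of λ where
      (yes refl) → turn′-b u ε h ¬s
      (no v≢b) → turn′-o v u ε v≢a v≢b

  step-old : ∀ t → valid G t → ¬ Special (F t) → F′ t ≡ F t
  step-old (u , v , ε) h ¬s rewrite sig′-old h =
    cong (λ x → v , x , ε xor sig E u v) (turn′-old v u _ (trans (sym G v u) h) ¬s)

  -- Together with `step-d`, `step-n₁` and `step-n₂` this redirects the walks: what led to `c` now
  -- passes along `n₁` to `d`, and what led to `d` passes along `n₂` to `c`. Whether a face is split
  -- or two are merged depends only on whether `c` and `d` lie on the same walk.
  step-c : ∀ t → valid G t → F t ≡ c → F′ t ≡ n₁
  step-c (u , v , ε) h e = let v≡ , ε≡ , u≡ = step-inverse E u v ε h e in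
    trans (cong (λ x → v , turn E′ v u x , x) (trans (cong (ε xor_) (sig′-old h)) ε≡))
      (trans (cong₂ (λ v u → v , ρ′ v u , true) v≡ u≡)
        (cong (λ x → a , x , true) (trans (cong (λ f → f (σ E a q)) ρ′a) Ia.f′p)))

  step-d : ∀ t → valid G t → F t ≡ d → F′ t ≡ n₂
  step-d (u , v , ε) h e = let v≡ , ε≡ , u≡ = step-inverse E u v ε h e in
    trans (cong (λ x → v , turn E′ v u x , x) (trans (cong (ε xor_) (sig′-old h)) ε≡))
      (trans (cong₂ (λ v u → v , ρ′ v u , true) v≡ u≡)
        (cong (λ x → b , x , true) (trans (cong (λ f → f (σ E b s)) ρ′b) Ib.f′p)))

  step-n₁ : F′ n₁ ≡ d
  step-n₁ rewrite sig′-ab = cong (λ x → b , x , true) (trans (cong (λ f → f a) ρ′b) Ib.f′b)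

  step-n₂ : F′ n₂ ≡ c
  step-n₂ rewrite sig′-ba = cong (λ x → a , x , true) (trans (cong (λ f → f b) ρ′a) Ia.f′b)

  rev-old : ∀ t → valid G t → rev E′ t ≡ rev E t
  rev-old (u , v , ε) h = cong (λ x → v , u , not (ε xor x)) (sig′-old h)

  rev-to-c : ∀ t → valid G t → F t ≡ c → rev E t ≡ c̄
  rev-to-c (u , v , ε) h e = let v≡ , ε≡ , u≡ = step-inverse E u v ε h e in
    trans (cong (λ x → v , u , not x) ε≡) (cong₂ (λ v u → v , u , false) v≡ u≡)

  rev-to-d : ∀ t → valid G t → F t ≡ d → rev E t ≡ d̄
  rev-to-d (u , v , ε) h e = let v≡ , ε≡ , u≡ = step-inverse E u v ε h e in
    trans (cong (λ x → v , u , not x) ε≡) (cong₂ (λ v u → v , u , false) v≡ u≡)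

  valid-old : ∀ t → valid G t → valid G′ t
  valid-old (u , v , ε) = addEdge-old G

  valid-n₁ : valid G′ n₁
  valid-n₁ = addEdge-new G a≢b

  valid-n₂ : valid G′ n₂
  valid-n₂ = trans (sym G′ b a) valid-n₁

  n₁-not-old : ¬ valid G n₁
  n₁-not-old h = true≢false (trans (≡-sym h) ab)

  n₂-not-old : ¬ valid G n₂
  n₂-not-old h = true≢false (trans (≡-sym h) ba)

  rev-n₁ : rev E′ n₁ ≡ (b , a , false)
  rev-n₁ rewrite sig′-ab = refl

  rev-n₂ : rev E′ n₂ ≡ (a , b , false)
  rev-n₂ rewrite sig′-ba = refl

  valid-elim : ∀ t → valid G′ t →
    valid G t ⊎ (t ≡ n₁ ⊎ t ≡ n₂) ⊎ (rev E′ t ≡ n₁ ⊎ rev E′ t ≡ n₂)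
  valid-elim (u , v , ε) h = case addEdge-elim G h of λ where
      (inj₁ x)                     → inj₁ x
      (inj₂ (inj₁ (refl , refl))) → inj₂ (go-ab ε)
      (inj₂ (inj₂ (refl , refl))) → inj₂ (go-ba ε)
    where
    go-ab : ∀ ε → ((a , b , ε) ≡ n₁ ⊎ (a , b , ε) ≡ n₂) ⊎ (rev E′ (a , b , ε) ≡ n₁ ⊎ rev E′ (a , b , ε) ≡ n₂)
    go-ab true  = inj₁ (inj₁ refl)
    go-ab false = inj₂ (inj₂ (cong (λ x → b , a , not x) sig′-ab))
    go-ba : ∀ ε → ((b , a , ε) ≡ n₁ ⊎ (b , a , ε) ≡ n₂) ⊎ (rev E′ (b , a , ε) ≡ n₁ ⊎ rev E′ (b , a , ε) ≡ n₂)
    go-ba true  = inj₁ (inj₂ refl)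
    go-ba false = inj₂ (inj₁ (cong (λ x → a , b , not x) sig′-ba))

-- Paths, closed walks and lists of walks.

infixr 5 _◂_

-- The list contains the start but not the end of the path, so that a closed walk lists each of its
-- steps exactly once and concatenation of paths is `++`.
data Path (f : A → A) : A → List A → A → Set where
  []  : ∀ {x} → Path f x [] x
  _◂_ : ∀ {x y z xs} → f x ≡ y → Path f y xs z → Path f x (x ∷ xs) z

path-++ : {f : A → A} {x y z : A} {xs ys : List A} →
  Path f x xs y → Path f y ys z → Path f x (xs ++ ys) z
path-++ []      q = q
path-++ (e ◂ p) q = e ◂ path-++ p q

path-split : {f : A → A} {x z : A} (xs : List A) {ys : List A} →
  Path f x (xs ++ ys) z → ∃ λ y → Path f x xs y × Path f y ys z
path-split []       p       = _ , [] , p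
path-split (x ∷ xs) (e ◂ p) = let y , q , r = path-split xs p in y , e ◂ q , r

path-head : {f : A → A} {x y z : A} {xs : List A} → Path f x (y ∷ xs) z → x ≡ y
path-head (_ ◂ _) = refl

Closed : (A → A) → List A → Set
Closed f xs = ∃ λ x → Path f x xs x

closed-rotate : {f : A → A} (xs ys : List A) → Closed f (xs ++ ys) → Closed f (ys ++ xs)
closed-rotate xs ys (x , p) = let y , q , r = path-split xs p in y , path-++ r q

path-next : {f : A → A} {x y z : A} {xs : List A} → Path f x xs z → y ∈ xs → f y ∈ xs ⊎ f y ≡ z
path-next (e ◂ [])      (here refl) = inj₂ e
path-next (refl ◂ _ ◂ _) (here refl) = inj₁ (there (here refl))
path-next (_ ◂ p)       (there y∈)  = case path-next p y∈ of λ where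
  (inj₁ h) → inj₁ (there h)
  (inj₂ h) → inj₂ h

path-last : {f : A → A} {x y z : A} {xs : List A} → Path f x (y ∷ xs) z → ∃ λ w → w ∈ y ∷ xs × f w ≡ z
path-last (e ◂ [])          = _ , here refl , e
path-last (_ ◂ p@(_ ◂ _))   = let w , h , e = path-last p in w , there h , e

path-prev : {f : A → A} {x y z : A} {xs : List A} → Path f x xs z → y ∈ xs →
  y ≡ x ⊎ ∃ λ w → w ∈ xs × f w ≡ y
path-prev (_ ◂ _) (here refl) = inj₁ refl
path-prev (e ◂ p) (there y∈)  = case path-prev p y∈ of λ where
  (inj₁ refl)        → inj₂ (_ , here refl , e)
  (inj₂ (w , h , e)) → inj₂ (w , there h , e)

closed-next : {f : A → A} {y : A} {xs : List A} → Closed f xs → y ∈ xs → f y ∈ xs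
closed-next {xs = _ ∷ _} (x , p) y∈ = case path-next p y∈ of λ where
  (inj₁ h)    → h
  (inj₂ refl) → here (path-head p)

closed-prev : {f : A → A} {y : A} {xs : List A} → Closed f xs → y ∈ xs → ∃ λ w → w ∈ xs × f w ≡ y
closed-prev {xs = _ ∷ _} (x , p) y∈ = case path-prev p y∈ of λ where
  (inj₁ refl) → path-last p
  (inj₂ h)    → h

concat-↭ : {xss yss : List (List A)} → xss ↭ yss → concat xss ↭ concat yss
concat-↭ Perm.refl            = ↭-refl
concat-↭ (prep xs p)          = ++⁺ˡ xs (concat-↭ p)
concat-↭ {A = A} (swap {xs = xss} {ys = yss} xs ys p) = begin
  xs ++ ys ++ concat xss      ≡⟨ ++-assoc xs ys _ ⟨
  (xs ++ ys) ++ concat xss    ↭⟨ ++⁺ʳ _ (++-comm xs ys) ⟩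
  (ys ++ xs) ++ concat xss    ≡⟨ ++-assoc ys xs _ ⟩
  ys ++ xs ++ concat xss      ↭⟨ ++⁺ˡ ys (++⁺ˡ xs (concat-↭ p)) ⟩
  ys ++ xs ++ concat yss      ∎
  where open Perm.PermutationReasoning
concat-↭ (Perm.trans p q)     = ↭-trans (concat-↭ p) (concat-↭ q)

unique-resp-↭ : {xs ys : List A} → xs ↭ ys → Unique xs → Unique ys
unique-resp-↭ p = PermS.Unique-resp-↭ (setoid _) (↭⇒↭ₛ p)

unique-disjoint : {xs ys : List A} {x : A} → Unique (xs ++ ys) → x ∈ xs → x ∉ ys
unique-disjoint (h ∷ _) (here refl) x∈ys = All.lookup h (∈-++⁺ʳ _ x∈ys) refl
unique-disjoint (_ ∷ u) (there x∈) x∈ys  = unique-disjoint u x∈ x∈ys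

unique-++ˡ : (xs : List A) {ys : List A} → Unique (xs ++ ys) → Unique xs
unique-++ˡ []       _       = []
unique-++ˡ (x ∷ xs) (h ∷ u) = All.++⁻ˡ xs h ∷ unique-++ˡ xs u

unique-++ʳ : (xs : List A) {ys : List A} → Unique (xs ++ ys) → Unique ys
unique-++ʳ []       u       = u
unique-++ʳ (x ∷ xs) (_ ∷ u) = unique-++ʳ xs u

-- Face walks exempt from being quadrilaterals.

Good : (State n → State n) → State n → Set
Good f s₀ =
  let s₁ = f s₀ ; s₂ = f s₁ ; s₃ = f s₂ ; s₄ = f s₃ in
  (s₄ ≡ s₀) ×
  (vtx s₀ ≢ vtx s₁) × (vtx s₀ ≢ vtx s₂) × (vtx s₀ ≢ vtx s₃) ×
  (vtx s₁ ≢ vtx s₂) × (vtx s₁ ≢ vtx s₃) × (vtx s₂ ≢ vtx s₃)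

good-cong : (f g : State n → State n) (s : State n) → g s ≡ f s → g (f s) ≡ f (f s) →
  g (f (f s)) ≡ f (f (f s)) → g (f (f (f s))) ≡ f (f (f (f s))) → Good f s → Good g s
good-cong f g s e₀ e₁ e₂ e₃ h rewrite e₀ | e₁ | e₂ | e₃ = h

infix 4 _≟ₛ_
_≟ₛ_ : (s t : State n) → Dec (s ≡ t)
_≟ₛ_ = ≡-dec _≟_ (≡-dec _≟_ _≟ᵇ_)

-- The face walks in L, each in one direction only, are exempt from being quadrilaterals.
record Exempt {G : SimpleGraph n} (E : Embedding G) (L : List (State n)) : Set where
  field
    valid-L : ∀ {s} → s ∈ L → valid G s
    unique  : Unique L
    one-way : ∀ {s t} → s ∈ L → t ∈ L → s ≢ rev E t
    good    : ∀ s → valid G s → s ∈ L ⊎ rev E s ∈ L ⊎ Good (faceStep E) s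

exempt-resp-↭ : {G : SimpleGraph n} {E : Embedding G} {L L′ : List (State n)} →
  L ↭ L′ → Exempt E L → Exempt E L′
exempt-resp-↭ p X = record
  { valid-L = λ h → Exempt.valid-L X (back h)
  ; unique  = unique-resp-↭ p (Exempt.unique X)
  ; one-way = λ h k → Exempt.one-way X (back h) (back k)
  ; good    = λ s v → case Exempt.good X s v of λ where
      (inj₁ h)        → inj₁ (∈-resp-↭ p h)
      (inj₂ (inj₁ h)) → inj₂ (inj₁ (∈-resp-↭ p h))
      (inj₂ (inj₂ h)) → inj₂ (inj₂ h)
  }
  where
  back : ∀ {s} → s ∈ _ → s ∈ _
  back = ∈-resp-↭ (↭-sym p)

-- Since all walks are closed, their states form a set stable under `faceStep` and under taking
-- predecessors. Faces that avoid these states and their reversals at one place avoid them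
-- throughout, and edges inserted at corners of listed walks do not affect them.
record Sys {G : SimpleGraph n} (E : Embedding G) (Ws : List (List (State n))) : Set where
  constructor mkSys
  field
    exempt : Exempt E (concat Ws)
    closed : All (Closed (faceStep E)) Ws

module _ {G : SimpleGraph n} {E : Embedding G} where

  private F = faceStep E

  next-closed : ∀ {Ws s} → Sys E Ws → s ∈ concat Ws → F s ∈ concat Ws
  next-closed {Ws} (mkSys X cl) h = let W , s∈W , W∈ = ∈-concat⁻′ Ws h in
    ∈-concat⁺′ (closed-next (All.lookup cl W∈) s∈W) W∈

  prev-closed : ∀ {Ws s} → Sys E Ws → s ∈ concat Ws → ∃ λ w → w ∈ concat Ws × F w ≡ s
  prev-closed {Ws} (mkSys X cl) h = let W , s∈W , W∈ = ∈-concat⁻′ Ws h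
                                        w , w∈W , e = closed-prev (All.lookup cl W∈) s∈W in
    w , ∈-concat⁺′ w∈W W∈ , e

  sys-resp-↭ : ∀ {Ws Ws′} → Ws ↭ Ws′ → Sys E Ws → Sys E Ws′
  sys-resp-↭ p (mkSys X cl) = mkSys (exempt-resp-↭ (concat-↭ p) X) (All-resp-↭ p cl)

  sys-rotate : ∀ U V {Ws} → Sys E ((U ++ V) ∷ Ws) → Sys E ((V ++ U) ∷ Ws)
  sys-rotate U V (mkSys X (c ∷ cl)) = mkSys (exempt-resp-↭ (++⁺ʳ _ (++-comm U V)) X) (closed-rotate U V c ∷ cl)

-- Faces after the insertion of an edge.

module InsertEdgeSys {G : SimpleGraph n} (E : Embedding G) (a b q s : Fin n)
  (ab : adj G a b ≡ false) (a≢b : a ≢ b) {Ws : List (List (State n))} (S : Sys E Ws)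
  (c∈ : (a , q , true) ∈ concat Ws) (d∈ : (b , s , true) ∈ concat Ws) where

  private
    X = Sys.exempt S
    L = concat Ws
  open InsertEdge E a b q s ab a≢b (Exempt.valid-L X c∈) (Exempt.valid-L X d∈) public
  open DecMembership (_≟ₛ_ {n}) using (_∈?_)

  -- `c̄` is the reversal of the state before `c`, which is listed, and listed walks never run
  -- against each other.
  not-c̄ : ∀ {t} → t ∈ L → t ≢ c̄
  not-c̄ h e = let w , w∈ , Fw = prev-closed S c∈ in
    Exempt.one-way X h w∈ (trans e (≡-sym (rev-to-c w (Exempt.valid-L X w∈) Fw)))

  not-d̄ : ∀ {t} → t ∈ L → t ≢ d̄
  not-d̄ h e = let w , w∈ , Fw = prev-closed S d∈ in
    Exempt.one-way X h w∈ (trans e (≡-sym (rev-to-d w (Exempt.valid-L X w∈) Fw)))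

  not-special : ∀ {t} → t ∈ L → t ≢ c → t ≢ d → ¬ Special t
  not-special h ≢c ≢d (inj₁ e)               = ≢c e
  not-special h ≢c ≢d (inj₂ (inj₁ e))        = not-c̄ h e
  not-special h ≢c ≢d (inj₂ (inj₂ (inj₁ e))) = ≢d e
  not-special h ≢c ≢d (inj₂ (inj₂ (inj₂ e))) = not-d̄ h e

  Off : State n → Set
  Off t = valid G t × t ∉ L × rev E t ∉ L

  off-∉ : ∀ {t} → Off t → F t ∉ L
  off-∉ {t} (v , t∉ , _) h = let w , w∈ , e = prev-closed S h in
    t∉ (subst (_∈ L) (step-injective E (Exempt.valid-L X w∈) v e) w∈)

  off-step : ∀ {t} → Off t → Off (F t)
  off-step {t} o@(v , t∉ , rt∉) = step-valid E t v , off-∉ o , λ h →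
    rt∉ (subst (_∈ L) (step-rev-step E t v) (next-closed S h))

  off-rev : ∀ {t w} → Off t → w ∈ L → F t ≢ rev E w
  off-rev {t} {w} (v , t∉ , rt∉) w∈ e = rt∉ (subst (_∈ L)
    (trans (cong F (trans (≡-sym (rev-rev E w)) (cong (rev E) (≡-sym e)))) (step-rev-step E t v)) (next-closed S w∈))

  -- A step into `c` or `d` would start at a listed state by injectivity; a step into `c̄` or `d̄`
  -- would lead to the reversal of a listed state, and its start would be such a reversal too.
  off-old : ∀ {t} → Off t → F′ t ≡ F t
  off-old {t} o = step-old t (proj₁ o) λ where
    (inj₁ e)               → off-∉ o (subst (_∈ L) (≡-sym e) c∈)
    (inj₂ (inj₁ e))        → let w , w∈ , Fw = prev-closed S c∈ in
      off-rev o w∈ (trans e (≡-sym (rev-to-c w (Exempt.valid-L X w∈) Fw)))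
    (inj₂ (inj₂ (inj₁ e))) → off-∉ o (subst (_∈ L) (≡-sym e) d∈)
    (inj₂ (inj₂ (inj₂ e))) → let w , w∈ , Fw = prev-closed S d∈ in
      off-rev o w∈ (trans e (≡-sym (rev-to-d w (Exempt.valid-L X w∈) Fw)))

  good-old : ∀ t → Off t → Good F t → Good F′ t
  good-old t o = good-cong F F′ t (off-old o) (off-old o₁) (off-old o₂) (off-old (off-step o₂))
    where
    o₁ = off-step o
    o₂ = off-step o₁

  exempt′ : Exempt E′ (n₁ ∷ n₂ ∷ L)
  exempt′ = record { valid-L = vl ; unique = un ; one-way = ow ; good = gd }
    where
    vl : ∀ {t} → t ∈ n₁ ∷ n₂ ∷ L → valid G′ t
    vl (here refl)         = valid-n₁
    vl (there (here refl)) = valid-n₂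
    vl {t} (there (there h)) = valid-old t (Exempt.valid-L X h)
    un : Unique (n₁ ∷ n₂ ∷ L)
    un = ((λ e → a≢b (cong proj₁ e)) ∷ All.tabulate (λ h e → n₁-not-old (subst (valid G) (≡-sym e) (Exempt.valid-L X h))))
       ∷ All.tabulate (λ h e → n₂-not-old (subst (valid G) (≡-sym e) (Exempt.valid-L X h)))
       ∷ Exempt.unique X
    rev-n-new : ∀ {t} → t ∈ n₁ ∷ n₂ ∷ L → t ≢ (b , a , false) × t ≢ (a , b , false)
    rev-n-new (here refl)         = (λ ()) , (λ ())
    rev-n-new (there (here refl)) = (λ ()) , (λ ())
    rev-n-new (there (there h))   = (λ { refl → n₂-not-old (Exempt.valid-L X h) }) , (λ { refl → n₁-not-old (Exempt.valid-L X h) })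
    ow : ∀ {t w} → t ∈ n₁ ∷ n₂ ∷ L → w ∈ n₁ ∷ n₂ ∷ L → t ≢ rev E′ w
    ow h (here refl) e         = proj₁ (rev-n-new h) (trans e rev-n₁)
    ow h (there (here refl)) e = proj₂ (rev-n-new h) (trans e rev-n₂)
    ow {t} {w} h (there (there k)) e = old h (trans e (rev-old w (Exempt.valid-L X k)))
      where
      rv : valid G (rev E w)
      rv = rev-valid E w (Exempt.valid-L X k)
      old : t ∈ n₁ ∷ n₂ ∷ L → t ≢ rev E w
      old (here refl) e         = n₁-not-old (subst (valid G) (≡-sym e) rv)
      old (there (here refl)) e = n₂-not-old (subst (valid G) (≡-sym e) rv)
      old (there (there h)) e   = Exempt.one-way X h k e
    gd : ∀ t → valid G′ t → t ∈ n₁ ∷ n₂ ∷ L ⊎ rev E′ t ∈ n₁ ∷ n₂ ∷ L ⊎ Good F′ t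
    gd t v = case valid-elim t v of λ where
        (inj₂ (inj₁ (inj₁ e))) → inj₁ (here e)
        (inj₂ (inj₁ (inj₂ e))) → inj₁ (there (here e))
        (inj₂ (inj₂ (inj₁ e))) → inj₂ (inj₁ (here e))
        (inj₂ (inj₂ (inj₂ e))) → inj₂ (inj₁ (there (here e)))
        (inj₁ vo) → old vo
      where
      old : valid G t → t ∈ n₁ ∷ n₂ ∷ L ⊎ rev E′ t ∈ n₁ ∷ n₂ ∷ L ⊎ Good F′ t
      old vo = case t ∈? L of λ where
        (yes h) → inj₁ (there (there h))
        (no t∉) → case rev E t ∈? L of λ where
          (yes h)  → inj₂ (inj₁ (there (there (subst (_∈ L) (≡-sym (rev-old t vo)) h))))
          (no rt∉) → case Exempt.good X t vo of λ where
            (inj₁ h)        → ⊥-elim (t∉ h)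
            (inj₂ (inj₁ h)) → ⊥-elim (rt∉ h)
            (inj₂ (inj₂ h)) → inj₂ (inj₂ (good-old t (vo , t∉ , rt∉) h))

  keep-path : ∀ {x M z} → (∀ {t} → t ∈ M → t ∈ L) → (∀ {t} → t ∈ M → ¬ Special (F t)) →
    Path F x M z → Path F′ x M z
  keep-path sub ns []      = []
  keep-path {x} sub ns (e ◂ p) =
    trans (step-old x (Exempt.valid-L X (sub (here refl))) (ns (here refl))) e
    ◂ keep-path (sub ∘ there) (ns ∘ there) p

  -- A walk up to one of the two corners now turns into the new edge.
  turn-path : ∀ {x y M z z′} → (∀ {t} → t ∈ y ∷ M → t ∈ L) → (∀ {t} → t ∈ M → t ≢ c × t ≢ d) →
    (∀ t → valid G t → F t ≡ z → F′ t ≡ z′) → Path F x (y ∷ M) z → Path F′ x (y ∷ M) z′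
  turn-path {x} sub ns end (e ◂ []) = end x (Exempt.valid-L X (sub (here refl))) e ◂ []
  turn-path {x} {M = _ ∷ _} sub ns end (refl ◂ p@(_ ◂ _)) =
    step-old x (Exempt.valid-L X (sub (here refl)))
      (not-special (sub (there (here refl))) (proj₁ (ns (here refl))) (proj₂ (ns (here refl))))
    ◂ turn-path (sub ∘ there) (ns ∘ there) end p

  keep-closed : ∀ {W} → W ∈ Ws → c ∉ W → d ∉ W → Closed F W → Closed F′ W
  keep-closed {W} W∈ c∉ d∉ cl@(x , p) = x , keep-path sub
      (λ {t} h → not-special (sub (closed-next cl h))
        (λ e → c∉ (subst (_∈ W) e (closed-next cl h))) (λ e → d∉ (subst (_∈ W) e (closed-next cl h)))) p
    where
    sub : ∀ {t} → t ∈ W → t ∈ L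
    sub h = ∈-concat⁺′ h W∈

-- Maps: splitting and merging faces.

data Kind : Set where
  ori non : Kind

-- For `ori` the signature itself must vanish, not merely be balanced: a switching that balances it
-- might fail at a new untwisted edge between vertices of different sign. For `non` the negation is
-- inherited, as a balancing of a larger graph restricts to each part.
HasKind : Kind → {G : SimpleGraph n} → Embedding G → Set
HasKind ori E = ∀ u v → sig E u v ≡ false
HasKind non E = ¬ Orientable E

record Map (G : SimpleGraph n) (κ : Kind) (Ws : List (List (State n))) : Set where
  field
    emb  : Embedding G
    kind : HasKind κ emb
    sys  : Sys emb Ws

private variable
  G     : SimpleGraph n
  κ     : Kind
  Ws Ws′ : List (List (State n))

map-resp-↭ : Ws ↭ Ws′ → Map G κ Ws → Map G κ Ws′
map-resp-↭ p M = record { emb = Map.emb M ; kind = Map.kind M ; sys = sys-resp-↭ p (Map.sys M) }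

map-rotate : ∀ U V → Map G κ ((U ++ V) ∷ Ws) → Map G κ ((V ++ U) ∷ Ws)
map-rotate U V M = record { emb = Map.emb M ; kind = Map.kind M ; sys = sys-rotate U V (Map.sys M) }

snoc-front : {A : Set} (xs : List A) {x : A} {ys : List A} → (xs ++ [ x ]) ++ ys ↭ x ∷ xs ++ ys
snoc-front xs {x} {ys} = ↭-trans (↭-reflexive (++-assoc xs [ x ] ys)) (shift x xs ys)

split-↭ : {A : Set} (U V : List A) {x y : A} {R : List A} →
  y ∷ x ∷ (U ++ V) ++ R ↭ (U ++ [ x ]) ++ (V ++ [ y ]) ++ R
split-↭ U V {x} {y} {R} = ↭-sym (begin
  (U ++ [ x ]) ++ (V ++ [ y ]) ++ R ↭⟨ snoc-front U ⟩
  x ∷ U ++ (V ++ [ y ]) ++ R        ↭⟨ prep x (++⁺ˡ U (snoc-front V)) ⟩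
  x ∷ U ++ y ∷ V ++ R               ↭⟨ prep x (shift y U (V ++ R)) ⟩
  x ∷ y ∷ U ++ V ++ R               ↭⟨ swap x y ↭-refl ⟩
  y ∷ x ∷ U ++ V ++ R               ≡⟨ cong (λ z → y ∷ x ∷ z) (++-assoc U V R) ⟨
  y ∷ x ∷ (U ++ V) ++ R             ∎)
  where open PermutationReasoning

merge-↭ : {A : Set} (U V : List A) {x y : A} {R : List A} →
  x ∷ y ∷ U ++ V ++ R ↭ (U ++ x ∷ V ++ [ y ]) ++ R
merge-↭ U V {x} {y} {R} = ↭-sym (begin
  (U ++ x ∷ V ++ [ y ]) ++ R    ≡⟨ ++-assoc U (x ∷ V ++ [ y ]) R ⟩
  U ++ x ∷ (V ++ [ y ]) ++ R    ↭⟨ shift x U _ ⟩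
  x ∷ U ++ (V ++ [ y ]) ++ R    ↭⟨ prep x (++⁺ˡ U (snoc-front V)) ⟩
  x ∷ U ++ y ∷ V ++ R           ↭⟨ prep x (shift y U (V ++ R)) ⟩
  x ∷ y ∷ U ++ V ++ R           ∎)
  where open PermutationReasoning

module _ {G : SimpleGraph n} {κ : Kind} {a b q s : Fin n} where
  private
    c d n₁ n₂ : State n
    c  = a , q , true
    d  = b , s , true
    n₁ = a , b , true
    n₂ = b , a , true

  insert-kind : ∀ κ (E : Embedding G) ab a≢b aq bs → HasKind κ E →
    HasKind κ (InsertEdge.E′ E a b q s ab a≢b aq bs)
  insert-kind ori E ab a≢b aq bs h u v rewrite h u v = refl
  insert-kind non E ab a≢b aq bs h (f , k) = h (f , λ u v uv →
    trans (≡-sym (InsertEdge.sig′-old E a b q s ab a≢b aq bs uv)) (k u v (addEdge-old G uv)))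

  -- Both corners lie on one face, in which ab is a chord. Each half of the walk is closed by one of
  -- the two sides of the new edge.
  map-split : ∀ U V {Ws} → adj G a b ≡ false → a ≢ b → Map G κ ((c ∷ U ++ d ∷ V) ∷ Ws) →
    Map (addEdge G a b) κ ((c ∷ U ++ [ n₂ ]) ∷ (d ∷ V ++ [ n₁ ]) ∷ Ws)
  map-split U V {Ws} ab a≢b M = record
      { emb  = E′
      ; kind = insert-kind κ (Map.emb M) ab a≢b _ _ (Map.kind M)
      ; sys  = mkSys (exempt-resp-↭ (split-↭ (c ∷ U) (d ∷ V)) exempt′) (proj₁ closed-UV ∷ proj₂ closed-UV ∷ rest)
      }
    where
    W = c ∷ U ++ d ∷ V
    c∈ : c ∈ W
    c∈ = here refl
    d∈ : d ∈ W
    d∈ = there (∈-++⁺ʳ U (here refl))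
    open InsertEdgeSys (Map.emb M) a b q s ab a≢b (Map.sys M) (∈-++⁺ˡ c∈) (∈-++⁺ˡ d∈)
      using (E′; F; F′; exempt′; turn-path; step-c; step-d; step-n₁; step-n₂; keep-closed)
    uniq : Unique (W ++ concat Ws)
    uniq = Exempt.unique (Sys.exempt (Map.sys M))
    uW : Unique W
    uW = unique-++ˡ W uniq
    uUV : Unique (U ++ d ∷ V)
    uUV = unique-++ʳ [ c ] uW
    ≢c : ∀ {t} → t ∈ U ++ d ∷ V → t ≢ c
    ≢c h e = unique-disjoint {xs = [ c ]} uW (here refl) (subst (_∈ U ++ d ∷ V) e h)
    ≢d-U : ∀ {t} → t ∈ U → t ≢ d
    ≢d-U h e = unique-disjoint uUV h (here e)
    ≢d-V : ∀ {t} → t ∈ V → t ≢ d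
    ≢d-V h e = unique-disjoint {xs = [ d ]} (unique-++ʳ U uUV) (here refl) (subst (_∈ V) e h)
    closed-UV : Closed F′ (c ∷ U ++ [ n₂ ]) × Closed F′ (d ∷ V ++ [ n₁ ])
    closed-UV with (x , p) ∷ _ ← Sys.closed (Map.sys M)
      with refl ← path-head p with path-split (c ∷ U) p
    ... | y , p₁ , p₂ with refl ← path-head p₂ =
      (c , path-++ (turn-path (λ h → ∈-++⁺ˡ (∈-++⁺ˡ h)) (λ h → ≢c (∈-++⁺ˡ h) , ≢d-U h) step-d p₁)
             (step-n₂ ◂ [])) ,
      (d , path-++ (turn-path (λ h → ∈-++⁺ˡ (∈-++⁺ʳ (c ∷ U) h))
                              (λ h → ≢c (∈-++⁺ʳ U (there h)) , ≢d-V h) step-c p₂)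
             (step-n₁ ◂ []))
    rest : All (Closed F′) Ws
    rest with _ ∷ cl ← Sys.closed (Map.sys M) = All.tabulate λ h →
      keep-closed (there h) (λ k → unique-disjoint uniq c∈ (∈-concat⁺′ k h))
        (λ k → unique-disjoint uniq d∈ (∈-concat⁺′ k h)) (All.lookup cl h)

  -- The corners lie on different faces, so the edge runs along a tube between them. The two walks
  -- become one, which contains both sides of the new edge.
  map-merge : ∀ U V {Ws} → adj G a b ≡ false → a ≢ b → Map G κ ((c ∷ U) ∷ (d ∷ V) ∷ Ws) →
    Map (addEdge G a b) κ ((c ∷ U ++ n₁ ∷ d ∷ V ++ [ n₂ ]) ∷ Ws)
  map-merge U V {Ws} ab a≢b M = record
      { emb  = E′
      ; kind = insert-kind κ (Map.emb M) ab a≢b _ _ (Map.kind M)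
      ; sys  = mkSys (exempt-resp-↭ (merge-↭ (c ∷ U) (d ∷ V)) exempt′) (closed′ ∷ rest)
      }
    where
    R = (d ∷ V) ++ concat Ws
    open InsertEdgeSys (Map.emb M) a b q s ab a≢b (Map.sys M) (here refl) (∈-++⁺ʳ (c ∷ U) (here refl))
      using (E′; F; F′; exempt′; turn-path; step-c; step-d; step-n₁; step-n₂; keep-closed)
    uniq : Unique ((c ∷ U) ++ R)
    uniq = Exempt.unique (Sys.exempt (Map.sys M))
    uR : Unique R
    uR = unique-++ʳ (c ∷ U) uniq
    c∉R : c ∉ R
    c∉R = unique-disjoint uniq (here refl)
    d∉U : d ∉ c ∷ U
    d∉U h = unique-disjoint uniq h (here refl)
    c∉U : c ∉ U
    c∉U h = unique-disjoint {xs = [ c ]} (unique-++ˡ (c ∷ U) uniq) (here refl) h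
    d∉V : d ∉ V
    d∉V h = unique-disjoint {xs = [ d ]} uR (here refl) (∈-++⁺ˡ h)
    closed′ : Closed F′ (c ∷ U ++ n₁ ∷ d ∷ V ++ [ n₂ ])
    closed′ with (x , p) ∷ (y , r) ∷ _ ← Sys.closed (Map.sys M)
      with refl ← path-head p with refl ← path-head r =
      c , path-++ (turn-path (λ h → ∈-++⁺ˡ h)
              (λ h → (λ e → c∉U (subst (_∈ U) e h)) , (λ e → d∉U (there (subst (_∈ U) e h)))) step-c p)
          (step-n₁ ◂ path-++ (turn-path (λ h → ∈-++⁺ʳ (c ∷ U) (∈-++⁺ˡ h))
              (λ h → (λ e → c∉R (there (∈-++⁺ˡ (subst (_∈ V) e h)))) , (λ e → d∉V (subst (_∈ V) e h))) step-d r)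
          (step-n₂ ◂ []))
    rest : All (Closed F′) Ws
    rest with _ ∷ _ ∷ cl ← Sys.closed (Map.sys M) = All.tabulate λ h →
      keep-closed (there (there h)) (λ k → c∉R (∈-++⁺ʳ (d ∷ V) (∈-concat⁺′ k h)))
        (λ k → unique-disjoint uR (here refl) (∈-concat⁺′ k h)) (All.lookup cl h)

-- The orientation has to be positive on leaving e and g, since these are the corners where edges
-- will be inserted; at f and h it is arbitrary, which allows twisted edges on the boundary.
quad : (e f g h : Fin n) → Bool → Bool → List (State n)
quad e f g h γ δ = (e , f , true) ∷ (f , g , γ) ∷ (g , h , true) ∷ (h , e , δ) ∷ []

good-cycle : (f : State n → State n) {s₀ s₁ s₂ s₃ : State n} →
  f s₀ ≡ s₁ → f s₁ ≡ s₂ → f s₂ ≡ s₃ → f s₃ ≡ s₀ →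
  vtx s₀ ≢ vtx s₁ → vtx s₀ ≢ vtx s₂ → vtx s₀ ≢ vtx s₃ →
  vtx s₁ ≢ vtx s₂ → vtx s₁ ≢ vtx s₃ → vtx s₂ ≢ vtx s₃ → Good f s₀
good-cycle f refl refl refl e₃ a b c d e g = e₃ , a , b , c , d , e , g

adj-≢ : (G : SimpleGraph n) {u v : Fin n} → adj G u v ≡ true → u ≢ v
adj-≢ G h refl = true≢false (trans (≡-sym h) (irrefl G _))

map-valid : Map G κ Ws → ∀ {s} → s ∈ concat Ws → valid G s
map-valid M = Exempt.valid-L (Sys.exempt (Map.sys M))

-- A listed quadrilateral may leave the list once it is seen to be a 4-cycle. Consecutive vertices
-- differ because they are adjacent; the hypotheses treat the two diagonals. Both directions are
-- checked, as a listed walk exempts its reversal as well.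
map-drop : ∀ {e f g h γ δ} → e ≢ g → f ≢ h → Map G κ (quad e f g h γ δ ∷ Ws) → Map G κ Ws
map-drop {G = G} {Ws = Ws} {e} {f} {g} {h} {γ} {δ} e≢g f≢h M = record
  { emb = emb ; kind = kind ; sys = mkSys ex (All.tail (Sys.closed sys)) }
  where
  open Map M
  X = Sys.exempt sys
  F = faceStep emb
  Q = quad e f g h γ δ
  module X = Exempt X
  ef = adj-≢ G (X.valid-L (here refl))
  fg = adj-≢ G (X.valid-L (there (here refl)))
  gh = adj-≢ G (X.valid-L (there (there (here refl))))
  he = adj-≢ G (X.valid-L (there (there (there (here refl)))))
  ~ : ∀ {u v : Fin _} → u ≢ v → v ≢ u
  ~ = ≢-sym
  rv : ∀ {s t} → s ∈ Q → F s ≡ t → F (rev emb t) ≡ rev emb s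
  rv {s} h e = trans (cong (λ t → F (rev emb t)) (≡-sym e)) (step-rev-step emb s (X.valid-L (∈-++⁺ˡ h)))
  i₀ : (e , f , true) ∈ Q
  i₀ = here refl
  i₁ : (f , g , γ) ∈ Q
  i₁ = there (here refl)
  i₂ : (g , h , true) ∈ Q
  i₂ = there (there (here refl))
  i₃ : (h , e , δ) ∈ Q
  i₃ = there (there (there (here refl)))
  good-Q : ∀ {s} → s ∈ Q → Good F s × Good F (rev emb s)
  good-Q s∈ with (_ , p) ∷ _ ← Sys.closed sys with refl ← path-head p with p | s∈
  ... | e₀ ◂ e₁ ◂ e₂ ◂ e₃ ◂ [] | here refl =
    good-cycle F e₀ e₁ e₂ e₃ ef e≢g (~ he) fg f≢h gh ,
    good-cycle F (rv i₃ e₃) (rv i₂ e₂) (rv i₁ e₁) (rv i₀ e₀) (~ ef) f≢h fg (~ he) e≢g (~ gh)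
  ... | e₀ ◂ e₁ ◂ e₂ ◂ e₃ ◂ [] | there (here refl) =
    good-cycle F e₁ e₂ e₃ e₀ fg f≢h (~ ef) gh (~ e≢g) he ,
    good-cycle F (rv i₀ e₀) (rv i₃ e₃) (rv i₂ e₂) (rv i₁ e₁) (~ fg) (~ e≢g) gh (~ ef) f≢h (~ he)
  ... | e₀ ◂ e₁ ◂ e₂ ◂ e₃ ◂ [] | there (there (here refl)) =
    good-cycle F e₂ e₃ e₀ e₁ gh (~ e≢g) (~ fg) he (~ f≢h) ef ,
    good-cycle F (rv i₁ e₁) (rv i₀ e₀) (rv i₃ e₃) (rv i₂ e₂) (~ gh) (~ f≢h) he (~ fg) (~ e≢g) (~ ef)
  ... | e₀ ◂ e₁ ◂ e₂ ◂ e₃ ◂ [] | there (there (there (here refl))) =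
    good-cycle F e₃ e₀ e₁ e₂ he (~ f≢h) (~ gh) ef e≢g fg ,
    good-cycle F (rv i₂ e₂) (rv i₁ e₁) (rv i₀ e₀) (rv i₃ e₃) (~ he) e≢g ef (~ gh) (~ f≢h) (~ fg)
  ex : Exempt emb (concat Ws)
  ex = record
    { valid-L = λ h → X.valid-L (∈-++⁺ʳ Q h)
    ; unique  = unique-++ʳ Q X.unique
    ; one-way = λ h k → X.one-way (∈-++⁺ʳ Q h) (∈-++⁺ʳ Q k)
    ; good    = λ s v → case X.good s v of λ where
        (inj₁ h) → case ∈-++⁻ Q h of λ where
          (inj₁ k) → inj₂ (inj₂ (proj₁ (good-Q k)))
          (inj₂ k) → inj₁ k
        (inj₂ (inj₁ h)) → case ∈-++⁻ Q h of λ where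
          (inj₁ k) → inj₂ (inj₂ (subst (Good F) (rev-rev emb s) (proj₂ (good-Q k))))
          (inj₂ k) → inj₂ (inj₁ k)
        (inj₂ (inj₂ h)) → inj₂ (inj₂ h)
    }

map-swap : ∀ {U V} → Map G κ (U ∷ V ∷ Ws) → Map G κ (V ∷ U ∷ Ws)
map-swap = map-resp-↭ (swap _ _ ↭-refl)

-- Tubes between two quadrilaterals.

Pair : ℕ → Set
Pair n = Fin n × Fin n

private variable
  ps ps′ : List (Pair n)

infix 4 _∈ₚ_
_∈ₚ_ : Fin n → Pair n → Set
u ∈ₚ (x , y) = u ≡ x ⊎ u ≡ y

addK22 : SimpleGraph n → Pair n → Pair n → SimpleGraph n
addK22 G (x , y) (e , g) = addEdge (addEdge (addEdge (addEdge G x e) x g) y e) y g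

NonAdj : SimpleGraph n → Pair n → Pair n → Set
NonAdj G P Q = ∀ {u v} → u ∈ₚ P → v ∈ₚ Q → adj G u v ≡ false

Apart : Pair n → Pair n → Set
Apart P Q = ∀ {u} → u ∈ₚ P → ¬ u ∈ₚ Q

-- The first edge connects the two faces (a merge); each of the others cuts off a quadrilateral.
map-attach : ∀ {x p y q e f g h α β γ δ} → x ≢ y → e ≢ g → Apart (x , y) (e , g) →
  NonAdj G (x , y) (e , g) → Map G κ (quad x p y q α β ∷ quad e f g h γ δ ∷ Ws) →
  Map (addK22 G (x , y) (e , g)) κ
    (quad e f g x γ true ∷ quad g h e y δ true ∷ quad x p y e α true ∷ quad y q x g β true ∷ Ws)
map-attach {G = G} {κ} {Ws} {x} {p} {y} {q} {e} {f} {g} {h} {α} {β} {γ} {δ} x≢y e≢g ap na M =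
    finish (step₄ (step₃ (step₂ (step₁ M))))
  where
  G₁ = addEdge G x e
  G₂ = addEdge G₁ x g
  G₃ = addEdge G₂ y e
  y≢x : y ≢ x
  y≢x = ≢-sym x≢y
  x≢e : x ≢ e
  x≢e k = ap (inj₁ refl) (inj₁ k)
  x≢g : x ≢ g
  x≢g k = ap (inj₁ refl) (inj₂ k)
  y≢e : y ≢ e
  y≢e k = ap (inj₂ refl) (inj₁ k)
  y≢g : y ≢ g
  y≢g k = ap (inj₂ refl) (inj₂ k)
  xe : adj G x e ≡ false
  xe = na (inj₁ refl) (inj₁ refl)
  xg : adj G₁ x g ≡ false
  xg = addEdge-false G (na (inj₁ refl) (inj₂ refl)) (λ k → e≢g (≡-sym (proj₂ k))) (λ k → x≢e (proj₁ k))
  ye : adj G₂ y e ≡ false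
  ye = addEdge-false G₁ (addEdge-false G (na (inj₂ refl) (inj₁ refl)) (λ k → y≢x (proj₁ k)) (λ k → y≢e (proj₁ k)))
         (λ k → y≢x (proj₁ k)) (λ k → y≢g (proj₁ k))
  yg : adj G₃ y g ≡ false
  yg = addEdge-false G₂ (addEdge-false G₁ (addEdge-false G (na (inj₂ refl) (inj₂ refl))
         (λ k → y≢x (proj₁ k)) (λ k → y≢e (proj₁ k)))
         (λ k → y≢x (proj₁ k)) (λ k → y≢g (proj₁ k)))
         (λ k → e≢g (≡-sym (proj₂ k))) (λ k → y≢e (proj₁ k))
  xp yq ef gh : State _
  xp = x , p , true
  yq = y , q , true
  ef = e , f , true
  gh = g , h , true
  py qx fg he xe⁺ ex⁺ xg⁺ : State _
  py = p , y , α
  qx = q , x , β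
  fg = f , g , γ
  he = h , e , δ
  xe⁺ = x , e , true
  ex⁺ = e , x , true
  xg⁺ = x , g , true
  -- `map-split` expects one of its two corners at the head of the walk, and the rotations bring the
  -- corner for the next edge there. In the order xe, xg, ye, yg every chord cuts off a
  -- quadrilateral at once.
  step₁ : Map G κ (quad x p y q α β ∷ quad e f g h γ δ ∷ Ws) →
    Map G₁ κ ((xe⁺ ∷ ef ∷ fg ∷ gh ∷ he ∷ ex⁺ ∷ xp ∷ py ∷ yq ∷ qx ∷ []) ∷ Ws)
  step₁ M = map-rotate (xp ∷ py ∷ yq ∷ qx ∷ []) (xe⁺ ∷ ef ∷ fg ∷ gh ∷ he ∷ ex⁺ ∷ [])
    (map-merge (py ∷ yq ∷ qx ∷ []) (fg ∷ gh ∷ he ∷ []) xe x≢e M)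
  step₂ : Map G₁ κ ((xe⁺ ∷ ef ∷ fg ∷ gh ∷ he ∷ ex⁺ ∷ xp ∷ py ∷ yq ∷ qx ∷ []) ∷ Ws) →
    Map G₂ κ ((yq ∷ qx ∷ xg⁺ ∷ gh ∷ he ∷ ex⁺ ∷ xp ∷ py ∷ []) ∷ quad e f g x γ true ∷ Ws)
  step₂ M = map-rotate (gh ∷ he ∷ ex⁺ ∷ xp ∷ py ∷ []) (yq ∷ qx ∷ xg⁺ ∷ [])
    (map-swap (map-rotate (xe⁺ ∷ []) (ef ∷ fg ∷ (g , x , true) ∷ [])
      (map-split (ef ∷ fg ∷ []) (he ∷ ex⁺ ∷ xp ∷ py ∷ yq ∷ qx ∷ []) xg x≢g M)))
  step₃ : ∀ {R} → Map G₂ κ ((yq ∷ qx ∷ xg⁺ ∷ gh ∷ he ∷ ex⁺ ∷ xp ∷ py ∷ []) ∷ R) →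
    Map G₃ κ ((yq ∷ qx ∷ xg⁺ ∷ gh ∷ he ∷ (e , y , true) ∷ []) ∷ quad x p y e α true ∷ R)
  step₃ M = map-swap (map-rotate (ex⁺ ∷ []) (xp ∷ py ∷ (y , e , true) ∷ []) (map-swap
    (map-split (qx ∷ xg⁺ ∷ gh ∷ he ∷ []) (xp ∷ py ∷ []) ye y≢e M)))
  step₄ : ∀ {R} → Map G₃ κ ((yq ∷ qx ∷ xg⁺ ∷ gh ∷ he ∷ (e , y , true) ∷ []) ∷ R) →
    Map (addEdge G₃ y g) κ (quad y q x g β true ∷ quad g h e y δ true ∷ R)
  step₄ = map-split (qx ∷ xg⁺ ∷ []) (he ∷ (e , y , true) ∷ []) yg y≢g
  finish : ∀ {G A B C D} → Map G κ (D ∷ B ∷ C ∷ A ∷ Ws) → Map G κ (A ∷ B ∷ C ∷ D ∷ Ws)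
  finish = map-resp-↭ (↭-trans
    (prep _ (↭-trans (prep _ (swap _ _ ↭-refl)) (swap _ _ ↭-refl)))
    (↭-trans (swap _ _ ↭-refl) (prep _ (↭-trans (swap _ _ ↭-refl) (prep _ (swap _ _ ↭-refl))))))

addPath : SimpleGraph n → Pair n → Fin n → Pair n → Fin n → SimpleGraph n
addPath G (x₁ , y₁) w (x₂ , y₂) g = addEdge (addEdge (addEdge (addEdge G x₁ g) w x₂) w y₂) y₁ g

-- Again one merge and three splits; the new faces x₂gx₁w, y₂q₂x₂w, y₁q₁x₁g, gy₂wy₁ are not needed later.
map-attach-path : ∀ {x₁ y₁ q₁ w x₂ y₂ q₂ g β₁ β₂} →
  x₁ ≢ y₁ → x₂ ≢ y₂ → w ≢ g → q₁ ≢ g → q₂ ≢ w → Apart (x₁ , y₁) (x₂ , y₂) → Apart (w , g) (x₁ , y₁) → Apart (w , g) (x₂ , y₂) →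
  adj G x₁ g ≡ false → adj G w x₂ ≡ false → adj G w y₂ ≡ false → adj G y₁ g ≡ false →
  Map G κ (quad y₁ q₁ x₁ w β₁ true ∷ quad y₂ q₂ x₂ g β₂ true ∷ Ws) →
  Map (addPath G (x₁ , y₁) w (x₂ , y₂) g) κ Ws
map-attach-path {G = G} {κ} {Ws} {x₁} {y₁} {q₁} {w} {x₂} {y₂} {q₂} {g} {β₁} {β₂}
    x₁≢y₁ x₂≢y₂ w≢g q₁≢g q₂≢w ap₁₂ ap₁ ap₂ x₁g wx₂ wy₂ y₁g M =
    finish (step₄ (step₃ (step₂ (step₁ M))))
  where
  x₁≢g : x₁ ≢ g
  x₁≢g k = ap₁ (inj₂ refl) (inj₁ (≡-sym k))
  y₁≢g : y₁ ≢ g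
  y₁≢g k = ap₁ (inj₂ refl) (inj₂ (≡-sym k))
  w≢x₁ : w ≢ x₁
  w≢x₁ k = ap₁ (inj₁ refl) (inj₁ k)
  w≢y₁ : w ≢ y₁
  w≢y₁ k = ap₁ (inj₁ refl) (inj₂ k)
  w≢x₂ : w ≢ x₂
  w≢x₂ k = ap₂ (inj₁ refl) (inj₁ k)
  w≢y₂ : w ≢ y₂
  w≢y₂ k = ap₂ (inj₁ refl) (inj₂ k)
  y₁≢x₁ : y₁ ≢ x₁
  y₁≢x₁ = ≢-sym x₁≢y₁
  y₁≢x₂ : y₁ ≢ x₂
  y₁≢x₂ k = ap₁₂ (inj₂ refl) (inj₁ k)
  y₁≢y₂ : y₁ ≢ y₂
  y₁≢y₂ k = ap₁₂ (inj₂ refl) (inj₂ k)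
  x₁≢x₂ : x₁ ≢ x₂
  x₁≢x₂ k = ap₁₂ (inj₁ refl) (inj₁ k)
  G₁ = addEdge G x₁ g
  G₂ = addEdge G₁ w x₂
  G₃ = addEdge G₂ w y₂
  wx₂′ : adj G₁ w x₂ ≡ false
  wx₂′ = addEdge-false G wx₂ (λ k → w≢x₁ (proj₁ k)) (λ k → w≢g (proj₁ k))
  wy₂′ : adj G₂ w y₂ ≡ false
  wy₂′ = addEdge-false G₁ (addEdge-false G wy₂ (λ k → w≢x₁ (proj₁ k)) (λ k → w≢g (proj₁ k)))
    (λ k → x₂≢y₂ (≡-sym (proj₂ k))) (λ k → w≢x₂ (proj₁ k))
  y₁g′ : adj G₃ y₁ g ≡ false
  y₁g′ = addEdge-false G₂ (addEdge-false G₁ (addEdge-false G y₁g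
    (λ k → y₁≢x₁ (proj₁ k)) (λ k → y₁≢g (proj₁ k)))
    (λ k → w≢y₁ (≡-sym (proj₁ k))) (λ k → y₁≢x₂ (proj₁ k)))
    (λ k → w≢y₁ (≡-sym (proj₁ k))) (λ k → y₁≢y₂ (proj₁ k))
  y₁q₁ q₁x₁ x₁w wy₁ gy₂ y₂q₂ q₂x₂ x₂g x₁g⁺ gx₁⁺ : State _
  y₁q₁ = y₁ , q₁ , true
  q₁x₁ = q₁ , x₁ , β₁
  x₁w  = x₁ , w , true
  wy₁  = w , y₁ , true
  y₂q₂ = y₂ , q₂ , true
  q₂x₂ = q₂ , x₂ , β₂
  x₂g  = x₂ , g , true
  gy₂  = g , y₂ , true
  x₁g⁺ = x₁ , g , true
  gx₁⁺ = g , x₁ , true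
  step₁ : Map G κ (quad y₁ q₁ x₁ w β₁ true ∷ quad y₂ q₂ x₂ g β₂ true ∷ Ws) →
    Map G₁ κ ((wy₁ ∷ y₁q₁ ∷ q₁x₁ ∷ x₁g⁺ ∷ gy₂ ∷ y₂q₂ ∷ q₂x₂ ∷ x₂g ∷ gx₁⁺ ∷ x₁w ∷ []) ∷ Ws)
  step₁ M = map-rotate (x₁w ∷ []) (wy₁ ∷ y₁q₁ ∷ q₁x₁ ∷ x₁g⁺ ∷ gy₂ ∷ y₂q₂ ∷ q₂x₂ ∷ x₂g ∷ gx₁⁺ ∷ [])
    (map-merge (wy₁ ∷ y₁q₁ ∷ q₁x₁ ∷ []) (y₂q₂ ∷ q₂x₂ ∷ x₂g ∷ []) x₁g x₁≢g
      (map-rotate (y₁q₁ ∷ q₁x₁ ∷ []) (x₁w ∷ wy₁ ∷ [])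
        (map-swap (map-rotate (y₂q₂ ∷ q₂x₂ ∷ x₂g ∷ []) (gy₂ ∷ []) (map-swap M)))))
  step₂ : ∀ {R} → Map G₁ κ ((wy₁ ∷ y₁q₁ ∷ q₁x₁ ∷ x₁g⁺ ∷ gy₂ ∷ y₂q₂ ∷ q₂x₂ ∷ x₂g ∷ gx₁⁺ ∷ x₁w ∷ []) ∷ R) →
    Map G₂ κ ((wy₁ ∷ y₁q₁ ∷ q₁x₁ ∷ x₁g⁺ ∷ gy₂ ∷ y₂q₂ ∷ q₂x₂ ∷ (x₂ , w , true) ∷ []) ∷ quad x₂ g x₁ w true true ∷ R)
  step₂ = map-split (y₁q₁ ∷ q₁x₁ ∷ x₁g⁺ ∷ gy₂ ∷ y₂q₂ ∷ q₂x₂ ∷ []) (gx₁⁺ ∷ x₁w ∷ []) wx₂′ w≢x₂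
  step₃ : ∀ {R} → Map G₂ κ ((wy₁ ∷ y₁q₁ ∷ q₁x₁ ∷ x₁g⁺ ∷ gy₂ ∷ y₂q₂ ∷ q₂x₂ ∷ (x₂ , w , true) ∷ []) ∷ R) →
    Map G₃ κ ((y₁q₁ ∷ q₁x₁ ∷ x₁g⁺ ∷ gy₂ ∷ (y₂ , w , true) ∷ wy₁ ∷ []) ∷ quad y₂ q₂ x₂ w β₂ true ∷ R)
  step₃ M = map-rotate (wy₁ ∷ []) (y₁q₁ ∷ q₁x₁ ∷ x₁g⁺ ∷ gy₂ ∷ (y₂ , w , true) ∷ [])
    (map-split (y₁q₁ ∷ q₁x₁ ∷ x₁g⁺ ∷ gy₂ ∷ []) (q₂x₂ ∷ (x₂ , w , true) ∷ []) wy₂′ w≢y₂ M)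
  step₄ : ∀ {R} → Map G₃ κ ((y₁q₁ ∷ q₁x₁ ∷ x₁g⁺ ∷ gy₂ ∷ (y₂ , w , true) ∷ wy₁ ∷ []) ∷ R) →
    Map (addEdge G₃ y₁ g) κ (quad y₁ q₁ x₁ g β₁ true ∷ quad g y₂ w y₁ true true ∷ R)
  step₄ = map-split (q₁x₁ ∷ x₁g⁺ ∷ []) ((y₂ , w , true) ∷ wy₁ ∷ []) y₁g′ y₁≢g
  finish : ∀ {G} → Map G κ (quad y₁ q₁ x₁ g β₁ true ∷ quad g y₂ w y₁ true true ∷
    quad y₂ q₂ x₂ w β₂ true ∷ quad x₂ g x₁ w true true ∷ Ws) → Map G κ Ws
  finish M = map-drop (≢-sym x₁≢x₂) (≢-sym w≢g) (map-drop (≢-sym x₂≢y₂) q₂≢w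
    (map-drop (≢-sym w≢g) (≢-sym y₁≢y₂) (map-drop (≢-sym x₁≢y₁) q₁≢g M)))

-- Counting edges.

Sum : (Fin n → ℕ) → ℕ
Sum f = sum (tabulate f)

sum-allFin : (f : Fin n → ℕ) → sum (map f (allFin n)) ≡ Sum f
sum-allFin f = cong sum (map-tabulate id f)

Sum-cong : {f g : Fin n → ℕ} → (∀ i → f i ≡ g i) → Sum f ≡ Sum g
Sum-cong e = cong sum (tabulate-cong e)

Sum-+ : (f g : Fin n → ℕ) → Sum (λ i → f i + g i) ≡ Sum f + Sum g
Sum-+ {zero}  f g = refl
Sum-+ {suc n} f g rewrite Sum-+ (f ∘ suc) (g ∘ suc) =
  solve 4 (λ a b c d → a :+ b :+ (c :+ d) := a :+ c :+ (b :+ d)) refl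
    (f zero) (g zero) (Sum (f ∘ suc)) (Sum (g ∘ suc))
  where open +-*-Solver

Sum-zero : Sum {n} (λ _ → 0) ≡ 0
Sum-zero {zero}  = refl
Sum-zero {suc n} = Sum-zero {n}

suc-== : (i j : Fin n) → (suc i == suc j) ≡ (i == j)
suc-== i j with i ≟ j
... | yes _ = refl
... | no _  = refl

Sum-single : (a : Fin n) (c : ℕ) → Sum (λ i → if i == a then c else 0) ≡ c
Sum-single {suc n} zero    c = trans (cong (λ x → c + x) (Sum-zero {n})) (+-identityʳ c)
Sum-single {suc n} (suc a) c = trans (Sum-cong (λ i → cong (if_then c else 0) (suc-== i a))) (Sum-single a c)

Sum-split : ∀ k (f : Fin (k + n) → ℕ) → Sum f ≡ Sum (λ i → f (i ↑ˡ n)) + Sum (λ i → f (k ↑ʳ i))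
Sum-split zero    f = refl
Sum-split (suc k) f = trans (cong (λ x → f zero + x) (Sum-split k (f ∘ suc))) (≡-sym (+-assoc (f zero) _ _))

count : SimpleGraph n → Fin n → Fin n → ℕ
count G i j = if (toℕ i <ᵇ toℕ j) ∧ adj G i j then 1 else 0

edgeCount-Sum : (G : SimpleGraph n) → edgeCount G ≡ Sum (λ i → Sum (count G i))
edgeCount-Sum G = trans (sum-allFin (λ i → sum (map (count G i) (allFin _)))) (Sum-cong (λ i → sum-allFin (count G i)))

<ᵇ-true : ∀ {x y} → x < y → (x <ᵇ y) ≡ true
<ᵇ-true {x} {y} h with x <ᵇ y | <⇒<ᵇ h
... | true | _ = refl

<ᵇ-false : ∀ {x y} → ¬ x < y → (x <ᵇ y) ≡ false
<ᵇ-false {x} {y} h with x <ᵇ y in e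
... | false = refl
... | true  = ⊥-elim (h (<ᵇ⇒< x y (subst T (≡-sym e) tt)))

module _ (G : SimpleGraph n) where

  private
    single : Fin n → Fin n → Fin n → Fin n → ℕ
    single a b i j = if i == a then (if j == b then 1 else 0) else 0

  Sum-single² : ∀ a b → Sum (λ i → Sum (single a b i)) ≡ 1
  Sum-single² a b = trans (Sum-cong (λ i → inner i)) (Sum-single a 1)
    where
    inner : ∀ i → Sum (single a b i) ≡ (if i == a then 1 else 0)
    inner i with i == a
    ... | true  = Sum-single b 1
    ... | false = Sum-zero {n}

  -- `count` sees an edge only in the increasing order of its ends, hence the condition on a and b;
  -- the other order is reduced to it by symmetry in `edgeCount-addEdge`.
  count-addEdge : ∀ {a b} → adj G a b ≡ false → toℕ a < toℕ b → ∀ i j →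
    count (addEdge G a b) i j ≡ count G i j + single a b i j
  count-addEdge {a} {b} ab a<b i j = case i ≟ a of λ where
      (yes refl) → case j ≟ b of λ where
        (yes refl) → at-ab
        (no j≢b)   → other (λ k → j≢b (proj₂ k))
      (no i≢a) → other (λ k → i≢a (proj₁ k))
    where
    a≢b : a ≢ b
    a≢b refl = <-irrefl refl a<b
    at-ab : count (addEdge G a b) a b ≡ count G a b + single a b a b
    at-ab rewrite <ᵇ-true a<b | addEdge-new G a≢b | ab | ==-refl a | ==-refl b = refl
    single-0 : ∀ {i j} → ¬ (i ≡ a × j ≡ b) → single a b i j ≡ 0
    single-0 {i} {j} h with i ≟ a | j ≟ b
    ... | yes p | yes q = ⊥-elim (h (p , q))
    ... | yes p | no q  = refl
    ... | no p  | _     = refl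
    other : ∀ {i j} → ¬ (i ≡ a × j ≡ b) → count (addEdge G a b) i j ≡ count G i j + single a b i j
    other {i} {j} h rewrite single-0 h | +-identityʳ (count G i j) = go (toℕ i <ᵇ toℕ j) refl
      where
      go : ∀ t → (toℕ i <ᵇ toℕ j) ≡ t → count (addEdge G a b) i j ≡ count G i j
      go false e rewrite e = refl
      go true  e rewrite e = cong (if_then 1 else 0) (lem (adj G i j) refl)
        where
        lem : ∀ x → adj G i j ≡ x → adj (addEdge G a b) i j ≡ adj G i j
        lem true  x = trans (addEdge-old G x) (≡-sym x)
        lem false x = trans (addEdge-false G x h λ where
          (refl , refl) → true≢false (trans (≡-sym e) (<ᵇ-false (<-asym a<b)))) (≡-sym x)

  edgeCount-addEdge-< : ∀ {a b} → adj G a b ≡ false → toℕ a < toℕ b →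
    edgeCount (addEdge G a b) ≡ suc (edgeCount G)
  edgeCount-addEdge-< {a} {b} ab a<b = begin
    edgeCount (addEdge G a b)
      ≡⟨ edgeCount-Sum (addEdge G a b) ⟩
    Sum (λ i → Sum (count (addEdge G a b) i))
      ≡⟨ Sum-cong (λ i → trans (Sum-cong (count-addEdge ab a<b i)) (Sum-+ (count G i) (single a b i))) ⟩
    Sum (λ i → Sum (count G i) + Sum (single a b i))
      ≡⟨ Sum-+ (λ i → Sum (count G i)) (λ i → Sum (single a b i)) ⟩
    Sum (λ i → Sum (count G i)) + Sum (λ i → Sum (single a b i))
      ≡⟨ cong₂ _+_ (≡-sym (edgeCount-Sum G)) (Sum-single² a b) ⟩
    edgeCount G + 1
      ≡⟨ +-comm (edgeCount G) 1 ⟩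
    suc (edgeCount G) ∎
    where open ≡-Reasoning

edgeCount-cong : {G H : SimpleGraph n} → (∀ u v → adj G u v ≡ adj H u v) → edgeCount G ≡ edgeCount H
edgeCount-cong {G = G} {H} e = trans (edgeCount-Sum G) (trans
  (Sum-cong λ i → Sum-cong λ j → cong (λ x → if (toℕ i <ᵇ toℕ j) ∧ x then 1 else 0) (e i j)) (≡-sym (edgeCount-Sum H)))

edgeCount-addEdge : (G : SimpleGraph n) {a b : Fin n} → adj G a b ≡ false → a ≢ b →
  edgeCount (addEdge G a b) ≡ suc (edgeCount G)
edgeCount-addEdge G {a} {b} ab a≢b with <-cmp (toℕ a) (toℕ b)
... | tri< a<b _ _ = edgeCount-addEdge-< G ab a<b
... | tri≈ _ e _   = ⊥-elim (a≢b (toℕ-injective e))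
... | tri> _ _ b<a = trans (edgeCount-cong {G = addEdge G a b} {addEdge G b a} flip)
                           (edgeCount-addEdge-< G (trans (sym G b a) ab) b<a)
  where
  flip : ∀ u v → adj (addEdge G a b) u v ≡ adj (addEdge G b a) u v
  flip u v = cong (λ x → adj G u v ∨ (x ∧ not (u == v))) (∨-comm ((u == a) ∧ (v == b)) _)

-- Disjoint unions, with the vertices of H first

glue : {A : Set} {k n : ℕ} → (Fin k → Fin k → A) → (Fin n → Fin n → A) → A →
  Fin k ⊎ Fin n → Fin k ⊎ Fin n → A
glue p q z (inj₁ i) (inj₁ j) = p i j
glue p q z (inj₂ i) (inj₂ j) = q i j
glue p q z _        _        = z

module _ {k n : ℕ} where

  glue-sym : {A : Set} {p : Fin k → Fin k → A} {q : Fin n → Fin n → A} {z : A} →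
    (∀ i j → p i j ≡ p j i) → (∀ i j → q i j ≡ q j i) → ∀ x y → glue p q z x y ≡ glue p q z y x
  glue-sym hp hq (inj₁ i) (inj₁ j) = hp i j
  glue-sym hp hq (inj₁ i) (inj₂ j) = refl
  glue-sym hp hq (inj₂ i) (inj₁ j) = refl
  glue-sym hp hq (inj₂ i) (inj₂ j) = hq i j

  _⊕_ : SimpleGraph k → SimpleGraph n → SimpleGraph (k + n)
  adj    (H ⊕ G) u v = glue (adj H) (adj G) false (splitAt k u) (splitAt k v)
  sym    (H ⊕ G) u v = glue-sym (sym H) (sym G) (splitAt k u) (splitAt k v)
  irrefl (H ⊕ G) v with splitAt k v
  ... | inj₁ i = irrefl H i
  ... | inj₂ j = irrefl G j

  module _ (H : SimpleGraph k) (G : SimpleGraph n) where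

    adj-ll : ∀ i j → adj (H ⊕ G) (i ↑ˡ n) (j ↑ˡ n) ≡ adj H i j
    adj-ll i j rewrite splitAt-↑ˡ k i n | splitAt-↑ˡ k j n = refl

    adj-rr : ∀ i j → adj (H ⊕ G) (k ↑ʳ i) (k ↑ʳ j) ≡ adj G i j
    adj-rr i j rewrite splitAt-↑ʳ k n i | splitAt-↑ʳ k n j = refl

    adj-lr : ∀ i j → adj (H ⊕ G) (i ↑ˡ n) (k ↑ʳ j) ≡ false
    adj-lr i j rewrite splitAt-↑ˡ k i n | splitAt-↑ʳ k n j = refl

    adj-rl : ∀ i j → adj (H ⊕ G) (k ↑ʳ i) (j ↑ˡ n) ≡ false
    adj-rl i j rewrite splitAt-↑ˡ k j n | splitAt-↑ʳ k n i = refl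

    edgeCount-⊕ : edgeCount (H ⊕ G) ≡ edgeCount H + edgeCount G
    edgeCount-⊕ = begin
      edgeCount (H ⊕ G)                            ≡⟨ edgeCount-Sum (H ⊕ G) ⟩
      Sum (λ i → Sum (count (H ⊕ G) i))            ≡⟨ Sum-split k _ ⟩
      Sum (λ i → Sum (count (H ⊕ G) (i ↑ˡ n))) + Sum (λ i → Sum (count (H ⊕ G) (k ↑ʳ i)))
        ≡⟨ cong₂ _+_ (Sum-cong left) (Sum-cong right) ⟩
      Sum (λ i → Sum (count H i)) + Sum (λ i → Sum (count G i))
        ≡⟨ cong₂ _+_ (edgeCount-Sum H) (edgeCount-Sum G) ⟨
      edgeCount H + edgeCount G                    ∎
      where
      open ≡-Reasoning
      no-edge : ∀ b → (if b ∧ false then 1 else 0) ≡ 0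
      no-edge b rewrite ∧-zeroʳ b = refl
      <ᵇ-shift : ∀ m x y → (m + x <ᵇ m + y) ≡ (x <ᵇ y)
      <ᵇ-shift zero    x y = refl
      <ᵇ-shift (suc m) x y = <ᵇ-shift m x y
      left : ∀ i → Sum (count (H ⊕ G) (i ↑ˡ n)) ≡ Sum (count H i)
      left i = trans (Sum-split k _) (trans (cong₂ _+_
          (Sum-cong λ j → cong₂ (λ b x → if b ∧ x then 1 else 0)
            (cong₂ _<ᵇ_ (toℕ-↑ˡ i n) (toℕ-↑ˡ j n)) (adj-ll i j))
          (trans (Sum-cong λ j → trans (cong (λ x → if (toℕ (i ↑ˡ n) <ᵇ toℕ (k ↑ʳ j)) ∧ x then 1 else 0) (adj-lr i j))
                                       (no-edge _)) (Sum-zero {n})))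
        (+-identityʳ _))
      right : ∀ i → Sum (count (H ⊕ G) (k ↑ʳ i)) ≡ Sum (count G i)
      right i = trans (Sum-split k _) (cong₂ _+_
          (trans (Sum-cong λ j → trans (cong (λ x → if (toℕ (k ↑ʳ i) <ᵇ toℕ (j ↑ˡ n)) ∧ x then 1 else 0) (adj-rl i j))
                                       (no-edge _)) (Sum-zero {k}))
          (Sum-cong λ j → cong₂ (λ b x → if b ∧ x then 1 else 0)
            (trans (cong₂ _<ᵇ_ (toℕ-↑ʳ k i) (toℕ-↑ʳ k j)) (<ᵇ-shift k (toℕ i) (toℕ j))) (adj-rr i j)))

-- Connectivity

reach-trans : {G : SimpleGraph n} {u v w : Fin n} → Reach G u v → Reach G v w → Reach G u w
reach-trans here       q = q
reach-trans (step e p) q = step e (reach-trans p q)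

reach-map : {m : ℕ} {H : SimpleGraph m} {G : SimpleGraph n} (f : Fin m → Fin n) →
  (∀ {u v} → adj H u v ≡ true → adj G (f u) (f v) ≡ true) → ∀ {u v} → Reach H u v → Reach G (f u) (f v)
reach-map f h here       = here
reach-map f h (step e p) = step (h e) (reach-map f h p)

-- Embeddings of disjoint unions.

mapState : {m n : ℕ} → (Fin m → Fin n) → State m → State n
mapState f (u , v , ε) = f u , f v , ε

mapState-injective : {m n : ℕ} {f : Fin m → Fin n} → (∀ {i j} → f i ≡ f j → i ≡ j) →
  ∀ {s t} → mapState f s ≡ mapState f t → s ≡ t
mapState-injective inj e =
  cong₂ _,_ (inj (cong proj₁ e)) (cong₂ _,_ (inj (cong (proj₁ ∘ proj₂) e)) (cong (proj₂ ∘ proj₂) e))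

path-map : {A B : Set} (f : A → A) (g : B → B) (φ : A → B) → (∀ x → g (φ x) ≡ φ (f x)) →
  ∀ {x xs z} → Path f x xs z → Path g (φ x) (map φ xs) (φ z)
path-map f g φ h []      = []
path-map f g φ h {x} (e ◂ p) = trans (h x) (cong φ e) ◂ path-map f g φ h p

iter-map : {A B : Set} {f : A → A} {g : B → B} (φ : A → B) → (∀ x → g (φ x) ≡ φ (f x)) →
  ∀ k x → iter g k (φ x) ≡ φ (iter f k x)
iter-map φ h zero    x = refl
iter-map {g = g} φ h (suc k) x = trans (cong g (iter-map φ h k x)) (h _)

good-map : {m n : ℕ} (F : State m → State m) (F′ : State n → State n) (f : Fin m → Fin n) →
  (∀ {i j} → f i ≡ f j → i ≡ j) → (∀ s → F′ (mapState f s) ≡ mapState f (F s)) →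
  ∀ s → Good F s → Good F′ (mapState f s)
good-map F F′ f inj h s (e , a , b , c , d , p , q)
  rewrite h s | h (F s) | h (F (F s)) | h (F (F (F s))) =
  cong (mapState f) e , a ∘ inj , b ∘ inj , c ∘ inj , d ∘ inj , p ∘ inj , q ∘ inj

rotation-map : {m n : ℕ} {N : Fin m → Bool} {N′ : Fin n → Bool}
  {r s : Fin m → Fin m} {r′ s′ : Fin n → Fin n} (f : Fin m → Fin n) →
  (∀ u → N′ (f u) ≡ N u) → (∀ u → N′ u ≡ true → ∃ λ i → u ≡ f i) →
  (∀ u → r′ (f u) ≡ f (r u)) → (∀ u → s′ (f u) ≡ f (s u)) →
  IsRotation N r s → IsRotation N′ r′ s′
rotation-map {N = N} {N′} {r} {s} {r′} {s′} f hN sur hr hs R = record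
  { f-nbr = λ u p → case sur u p of λ where
      (i , refl) → trans (cong N′ (hr i)) (trans (hN (r i)) (f-nbr i (trans (≡-sym (hN i)) p)))
  ; g-nbr = λ u p → case sur u p of λ where
      (i , refl) → trans (cong N′ (hs i)) (trans (hN (s i)) (g-nbr i (trans (≡-sym (hN i)) p)))
  ; gf = λ u p → case sur u p of λ where
      (i , refl) → trans (cong s′ (hr i)) (trans (hs (r i)) (cong f (gf i (trans (≡-sym (hN i)) p))))
  ; fg = λ u p → case sur u p of λ where
      (i , refl) → trans (cong r′ (hs i)) (trans (hr (s i)) (cong f (fg i (trans (≡-sym (hN i)) p))))
  ; orbit = λ u w p q → case (sur u p , sur w q) of λ where
      ((i , refl) , (j , refl)) →
        let l , e = orbit i j (trans (≡-sym (hN i)) p) (trans (≡-sym (hN j)) q) in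
        l , trans (iter-map f hr l i) (cong f e)
  }
  where open IsRotation R

_⊔_ : Kind → Kind → Kind
ori ⊔ κ = κ
non ⊔ _ = non

module DisjointUnion {k n : ℕ} {H : SimpleGraph k} {G : SimpleGraph n} where

  view : (u : Fin (k + n)) → (∃ λ i → u ≡ i ↑ˡ n) ⊎ (∃ λ j → u ≡ k ↑ʳ j)
  view u with splitAt k u | join-splitAt k n u
  ... | inj₁ i | e = inj₁ (i , ≡-sym e)
  ... | inj₂ j | e = inj₂ (j , ≡-sym e)

  left-right : ∀ {i j} → i ↑ˡ n ≢ k ↑ʳ j
  left-right {i} {j} e
    with trans (≡-sym (splitAt-↑ˡ k i n)) (trans (cong (splitAt k) e) (splitAt-↑ʳ k n j))
  ... | ()

  act : (Fin k → Fin k → Fin k) → (Fin n → Fin n → Fin n) → Fin (k + n) → Fin (k + n) → Fin (k + n)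
  act p q v u = glue (λ i j → p i j ↑ˡ n) (λ i j → k ↑ʳ q i j) v (splitAt k v) (splitAt k u)

  module _ (p : Fin k → Fin k → Fin k) (q : Fin n → Fin n → Fin n) where

    act-l : ∀ i j → act p q (i ↑ˡ n) (j ↑ˡ n) ≡ p i j ↑ˡ n
    act-l i j rewrite splitAt-↑ˡ k i n | splitAt-↑ˡ k j n = refl

    act-r : ∀ i j → act p q (k ↑ʳ i) (k ↑ʳ j) ≡ k ↑ʳ q i j
    act-r i j rewrite splitAt-↑ʳ k n i | splitAt-↑ʳ k n j = refl

  module _ (D : Embedding H) (E : Embedding G) where

    sig⊕ : Fin (k + n) → Fin (k + n) → Bool
    sig⊕ u v = glue (sig D) (sig E) false (splitAt k u) (splitAt k v)

    sig-l : ∀ i j → sig⊕ (i ↑ˡ n) (j ↑ˡ n) ≡ sig D i j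
    sig-l i j rewrite splitAt-↑ˡ k i n | splitAt-↑ˡ k j n = refl

    sig-r : ∀ i j → sig⊕ (k ↑ʳ i) (k ↑ʳ j) ≡ sig E i j
    sig-r i j rewrite splitAt-↑ʳ k n i | splitAt-↑ʳ k n j = refl

    rotation⊕ : ∀ v → IsRotation (adj (H ⊕ G) v) (act (ρ D) (ρ E) v) (act (σ D) (σ E) v)
    rotation⊕ v = case view v of λ where
      (inj₁ (i , refl)) → rotation-map (_↑ˡ n) (adj-ll H G i)
        (λ u h → case view u of λ where
          (inj₁ x)          → x
          (inj₂ (j , refl)) → ⊥-elim (true≢false (trans (≡-sym h) (adj-lr H G i j))))
        (act-l (ρ D) (ρ E) i) (act-l (σ D) (σ E) i) (rotation D i)
      (inj₂ (i , refl)) → rotation-map (k ↑ʳ_) (adj-rr H G i)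
        (λ u h → case view u of λ where
          (inj₂ x)          → x
          (inj₁ (j , refl)) → ⊥-elim (true≢false (trans (≡-sym h) (adj-rl H G i j))))
        (act-r (ρ D) (ρ E) i) (act-r (σ D) (σ E) i) (rotation E i)

    emb⊕ : Embedding (H ⊕ G)
    emb⊕ = mkEmbedding (act (ρ D) (ρ E)) (act (σ D) (σ E)) sig⊕ rotation⊕
      (λ u v → glue-sym (sig-sym D) (sig-sym E) (splitAt k u) (splitAt k v))

    F : State (k + n) → State (k + n)
    F = faceStep emb⊕

    inl : State k → State (k + n)
    inl = mapState (_↑ˡ n)
    inr : State n → State (k + n)
    inr = mapState (k ↑ʳ_)

    step-l : ∀ s → F (inl s) ≡ inl (faceStep D s)
    step-l (u , v , ε) rewrite sig-l u v = cong (λ x → v ↑ˡ n , x , ε xor sig D u v) (lem (ε xor sig D u v))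
      where
      lem : ∀ δ → turn emb⊕ (v ↑ˡ n) (u ↑ˡ n) δ ≡ turn D v u δ ↑ˡ n
      lem true  = act-l (ρ D) (ρ E) v u
      lem false = act-l (σ D) (σ E) v u

    step-r : ∀ s → F (inr s) ≡ inr (faceStep E s)
    step-r (u , v , ε) rewrite sig-r u v = cong (λ x → k ↑ʳ v , x , ε xor sig E u v) (lem (ε xor sig E u v))
      where
      lem : ∀ δ → turn emb⊕ (k ↑ʳ v) (k ↑ʳ u) δ ≡ k ↑ʳ turn E v u δ
      lem true  = act-r (ρ D) (ρ E) v u
      lem false = act-r (σ D) (σ E) v u

    rev-l : ∀ s → rev emb⊕ (inl s) ≡ inl (rev D s)
    rev-l (u , v , ε) = cong (λ x → v ↑ˡ n , u ↑ˡ n , not (ε xor x)) (sig-l u v)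

    rev-r : ∀ s → rev emb⊕ (inr s) ≡ inr (rev E s)
    rev-r (u , v , ε) = cong (λ x → k ↑ʳ v , k ↑ʳ u , not (ε xor x)) (sig-r u v)

    inl≢inr : ∀ {s t} → inl s ≢ inr t
    inl≢inr e = left-right (cong proj₁ e)

    exempt⊕ : ∀ {L M} → Exempt D L → Exempt E M → Exempt emb⊕ (map inl L ++ map inr M)
    exempt⊕ {L} {M} X Y = record { valid-L = vl ; unique = un ; one-way = ow ; good = gd }
      where
      module X = Exempt X
      module Y = Exempt Y
      Z = map inl L ++ map inr M
      elim : ∀ {s} → s ∈ Z → (∃ λ t → t ∈ L × s ≡ inl t) ⊎ (∃ λ t → t ∈ M × s ≡ inr t)
      elim h = case ∈-++⁻ (map inl L) h of λ where
        (inj₁ a) → inj₁ (∈-map⁻ inl a)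
        (inj₂ b) → inj₂ (∈-map⁻ inr b)
      in-l : ∀ {t} → t ∈ L → inl t ∈ Z
      in-l h = ∈-++⁺ˡ (∈-map⁺ inl h)
      in-r : ∀ {t} → t ∈ M → inr t ∈ Z
      in-r h = ∈-++⁺ʳ (map inl L) (∈-map⁺ inr h)
      vl : ∀ {s} → s ∈ Z → valid (H ⊕ G) s
      vl h = case elim h of λ where
        (inj₁ ((u , v , _) , t∈ , refl)) → trans (adj-ll H G u v) (X.valid-L t∈)
        (inj₂ ((u , v , _) , t∈ , refl)) → trans (adj-rr H G u v) (Y.valid-L t∈)
      un : Unique Z
      un = Unique.++⁺ (Unique.map⁺ (mapState-injective (↑ˡ-injective n _ _)) X.unique)
                      (Unique.map⁺ (mapState-injective (↑ʳ-injective k _ _)) Y.unique)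
        (λ { (a , b) → let s , _ , e = ∈-map⁻ inl a ; t , _ , e′ = ∈-map⁻ inr b in
               inl≢inr {s} {t} (trans (≡-sym e) e′) })
      ow : ∀ {s t} → s ∈ Z → t ∈ Z → s ≢ rev emb⊕ t
      ow h k e = case (elim h , elim k) of λ where
        (inj₁ (s , s∈ , refl) , inj₁ (t , t∈ , refl)) →
          X.one-way s∈ t∈ (mapState-injective (↑ˡ-injective n _ _) (trans e (rev-l t)))
        (inj₂ (s , s∈ , refl) , inj₂ (t , t∈ , refl)) →
          Y.one-way s∈ t∈ (mapState-injective (↑ʳ-injective _ _ _) (trans e (rev-r t)))
        (inj₁ (s , s∈ , refl) , inj₂ (t , t∈ , refl)) → inl≢inr {s} {rev E t} (trans e (rev-r t))
        (inj₂ (s , s∈ , refl) , inj₁ (t , t∈ , refl)) →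
          inl≢inr {rev D t} {s} (≡-sym (trans e (rev-l t)))
      gd-l : ∀ t → valid H t → inl t ∈ Z ⊎ rev emb⊕ (inl t) ∈ Z ⊎ Good F (inl t)
      gd-l t v = case X.good t v of λ where
        (inj₁ h)        → inj₁ (in-l h)
        (inj₂ (inj₁ h)) → inj₂ (inj₁ (subst (_∈ Z) (≡-sym (rev-l t)) (in-l h)))
        (inj₂ (inj₂ h)) → inj₂ (inj₂ (good-map (faceStep D) F (_↑ˡ n) (↑ˡ-injective n _ _) step-l t h))
      gd-r : ∀ t → valid G t → inr t ∈ Z ⊎ rev emb⊕ (inr t) ∈ Z ⊎ Good F (inr t)
      gd-r t v = case Y.good t v of λ where
        (inj₁ h)        → inj₁ (in-r h)
        (inj₂ (inj₁ h)) → inj₂ (inj₁ (subst (_∈ Z) (≡-sym (rev-r t)) (in-r h)))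
        (inj₂ (inj₂ h)) → inj₂ (inj₂ (good-map (faceStep E) F (k ↑ʳ_) (↑ʳ-injective k _ _) step-r t h))
      gd : ∀ s → valid (H ⊕ G) s → s ∈ Z ⊎ rev emb⊕ s ∈ Z ⊎ Good F s
      gd (u , v , ε) h = case (view u , view v) of λ where
        (inj₁ (i , refl) , inj₁ (j , refl)) → gd-l (i , j , ε) (trans (≡-sym (adj-ll H G i j)) h)
        (inj₂ (i , refl) , inj₂ (j , refl)) → gd-r (i , j , ε) (trans (≡-sym (adj-rr H G i j)) h)
        (inj₁ (i , refl) , inj₂ (j , refl)) → ⊥-elim (true≢false (trans (≡-sym h) (adj-lr H G i j)))
        (inj₂ (i , refl) , inj₁ (j , refl)) → ⊥-elim (true≢false (trans (≡-sym h) (adj-rl H G i j)))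

    sys⊕ : ∀ {Vs Ws} → Sys D Vs → Sys E Ws → Sys emb⊕ (map (map inl) Vs ++ map (map inr) Ws)
    sys⊕ {Vs} {Ws} (mkSys X c) (mkSys Y d) = mkSys
      (subst (Exempt emb⊕) (trans (cong₂ _++_ (≡-sym (concat-map Vs)) (≡-sym (concat-map Ws)))
                              (concat-++ (map (map inl) Vs) (map (map inr) Ws))) (exempt⊕ X Y))
      (All.++⁺ (All.map⁺ (All.map (λ { (x , p) → inl x , path-map (faceStep D) F inl step-l p }) c))
               (All.map⁺ (All.map (λ { (x , p) → inr x , path-map (faceStep E) F inr step-r p }) d)))

    ori⊕ : HasKind ori D → HasKind ori E → HasKind ori emb⊕
    ori⊕ h h′ u v = go (splitAt k u) (splitAt k v)
      where
      go : ∀ x y → glue (sig D) (sig E) false x y ≡ false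
      go (inj₁ i) (inj₁ j) = h i j
      go (inj₂ i) (inj₂ j) = h′ i j
      go (inj₁ _) (inj₂ _) = refl
      go (inj₂ _) (inj₁ _) = refl

    non-l : ¬ Orientable D → ¬ Orientable emb⊕
    non-l h (f , b) = h (f ∘ (_↑ˡ n) , λ i j e →
      trans (≡-sym (sig-l i j)) (b (i ↑ˡ n) (j ↑ˡ n) (trans (adj-ll H G i j) e)))

    non-r : ¬ Orientable E → ¬ Orientable emb⊕
    non-r h (f , b) = h (f ∘ (k ↑ʳ_) , λ i j e →
      trans (≡-sym (sig-r i j)) (b (k ↑ʳ i) (k ↑ʳ j) (trans (adj-rr H G i j) e)))

    kind⊕ : ∀ κ λ′ → HasKind κ D → HasKind λ′ E → HasKind (κ ⊔ λ′) emb⊕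
    kind⊕ ori ori = ori⊕
    kind⊕ non _   = λ h _ → non-l h
    kind⊕ ori non = λ _ → non-r

  -- Two surfaces side by side form one disconnected embedding. A tube from one to the other is then
  -- the same operation as a tube within one surface.
  map⊕ : ∀ {κ κ′ Vs Ws} → Map H κ Vs → Map G κ′ Ws →
    Map (H ⊕ G) (κ ⊔ κ′) (map (map (mapState (_↑ˡ n))) Vs ++ map (map (mapState (k ↑ʳ_))) Ws)
  map⊕ {κ} {κ′} M N = record
    { emb = emb⊕ (Map.emb M) (Map.emb N)
    ; kind = kind⊕ (Map.emb M) (Map.emb N) κ κ′ (Map.kind M) (Map.kind N)
    ; sys = sys⊕ (Map.emb M) (Map.emb N) (Map.sys M) (Map.sys N) }

-- Embeddings with reserved quadrilaterals.

record Face (n : ℕ) : Set where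
  constructor face
  field
    e f g h : Fin n
    γ δ     : Bool

walk : Face n → List (State n)
walk (face e f g h γ δ) = quad e f g h γ δ

ends : Face n → Pair n
ends (face e f g h γ δ) = e , g

-- `map-drop` asks for both diagonals to be nondegenerate. For the first this follows from the
-- distinctness of the vertices in the list of pairs; the second has to be recorded.
ProperMid : Face n → Set
ProperMid (face e f g h γ δ) = f ≢ h

-- An embedding with a distinguished quadrilateral for each pair in ps, having
-- that pair as a diagonal; distinct pairs get distinct quadrilaterals.
record Deco (G : SimpleGraph n) (κ : Kind) (ps : List (Pair n)) : Set where
  constructor deco
  field
    faces  : List (Face n)
    ends≡  : map ends faces ≡ ps
    proper : All ProperMid faces
    dmap   : Map G κ (map walk faces)

deco-resp-↭ : ps ↭ ps′ → Deco G κ ps → Deco G κ ps′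
deco-resp-↭ p (deco Fs refl pr M) with ↭-map-inv ends p
... | Fs′ , e , q = deco Fs′ (≡-sym e) (All-resp-↭ q pr) (map-resp-↭ (↭-map⁺ walk q) M)

Nondeg : Pair n → Set
Nondeg (x , y) = x ≢ y

module _ (G : SimpleGraph n) {P Q : Pair n} where

  addK22-old : ∀ {u v} → adj G u v ≡ true → adj (addK22 G P Q) u v ≡ true
  addK22-old h = addEdge-old G₃ (addEdge-old G₂ (addEdge-old G₁ (addEdge-old G h)))
    where
    G₁ = addEdge G (proj₁ P) (proj₁ Q)
    G₂ = addEdge G₁ (proj₁ P) (proj₂ Q)
    G₃ = addEdge G₂ (proj₂ P) (proj₁ Q)

  addK22-new : proj₁ P ≢ proj₁ Q → adj (addK22 G P Q) (proj₁ P) (proj₁ Q) ≡ true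
  addK22-new h = addEdge-old G₃ (addEdge-old G₂ (addEdge-old G₁ (addEdge-new G h)))
    where
    G₁ = addEdge G (proj₁ P) (proj₁ Q)
    G₂ = addEdge G₁ (proj₁ P) (proj₂ Q)
    G₃ = addEdge G₂ (proj₂ P) (proj₁ Q)

  addK22-false : ∀ {u v} → adj G u v ≡ false → ¬ (u ∈ₚ P × v ∈ₚ Q) → ¬ (v ∈ₚ P × u ∈ₚ Q) →
    adj (addK22 G P Q) u v ≡ false
  addK22-false h ¬1 ¬2 =
    addEdge-false G₃ (addEdge-false G₂ (addEdge-false G₁ (addEdge-false G h
      (λ (a , b) → ¬1 (inj₁ a , inj₁ b)) (λ (a , b) → ¬2 (inj₁ b , inj₁ a)))
      (λ (a , b) → ¬1 (inj₁ a , inj₂ b)) (λ (a , b) → ¬2 (inj₁ b , inj₂ a)))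
      (λ (a , b) → ¬1 (inj₂ a , inj₁ b)) (λ (a , b) → ¬2 (inj₂ b , inj₁ a)))
      (λ (a , b) → ¬1 (inj₂ a , inj₂ b)) (λ (a , b) → ¬2 (inj₂ b , inj₂ a))
    where
    G₁ = addEdge G (proj₁ P) (proj₁ Q)
    G₂ = addEdge G₁ (proj₁ P) (proj₂ Q)
    G₃ = addEdge G₂ (proj₂ P) (proj₁ Q)

  edgeCount-addK22 : Nondeg P → Nondeg Q → Apart P Q → NonAdj G P Q →
    edgeCount (addK22 G P Q) ≡ 4 + edgeCount G
  edgeCount-addK22 P≢ Q≢ ap na =
    trans (edgeCount-addEdge G₃ (addEdge-false G₂ (addEdge-false G₁ (addEdge-false G (na (inj₂ refl) (inj₂ refl))
         (λ k → P≢ (≡-sym (proj₁ k))) (λ k → ap (inj₂ refl) (inj₁ (proj₁ k))))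
         (λ k → P≢ (≡-sym (proj₁ k))) (λ k → ap (inj₂ refl) (inj₂ (proj₁ k))))
         (λ k → Q≢ (≡-sym (proj₂ k))) (λ k → ap (inj₂ refl) (inj₁ (proj₁ k)))) (λ k → ap (inj₂ refl) (inj₂ k)))
    (cong suc (trans (edgeCount-addEdge G₂ (addEdge-false G₁ (addEdge-false G (na (inj₂ refl) (inj₁ refl))
         (λ k → P≢ (≡-sym (proj₁ k))) (λ k → ap (inj₂ refl) (inj₁ (proj₁ k))))
         (λ k → P≢ (≡-sym (proj₁ k))) (λ k → ap (inj₂ refl) (inj₂ (proj₁ k)))) (λ k → ap (inj₂ refl) (inj₁ k)))
    (cong suc (trans (edgeCount-addEdge G₁ (addEdge-false G (na (inj₁ refl) (inj₂ refl))
         (λ k → Q≢ (≡-sym (proj₂ k))) (λ k → ap (inj₁ refl) (inj₁ (proj₁ k)))) (λ k → ap (inj₁ refl) (inj₂ k)))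
    (cong suc (edgeCount-addEdge G (na (inj₁ refl) (inj₁ refl)) (λ k → ap (inj₁ refl) (inj₁ k))))))))
    where
    G₁ = addEdge G (proj₁ P) (proj₁ Q)
    G₂ = addEdge G₁ (proj₁ P) (proj₂ Q)
    G₃ = addEdge G₂ (proj₂ P) (proj₁ Q)

-- Opposite vertices of a new quadrilateral are told apart in the graph before the tube: an old
-- boundary vertex has a neighbour on its own side to which the vertex from the other side is not
-- yet adjacent.
≢-by-adj : (G : SimpleGraph n) {u u′ v : Fin n} → adj G u v ≡ true → adj G u′ v ≡ false → u ≢ u′
≢-by-adj G t f refl = true≢false (trans (≡-sym t) f)

map-pull : ∀ {W Ws} Vs → Map G κ (Vs ++ W ∷ Ws) → Map G κ (W ∷ Vs ++ Ws)
map-pull Vs = map-resp-↭ (shift _ Vs _)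

deco-attach : ∀ {P Q} → Nondeg P → Nondeg Q → Apart P Q → NonAdj G P Q →
  Deco G κ (P ∷ Q ∷ ps) → Deco (addK22 G P Q) κ (P ∷ Q ∷ ps)
deco-attach {G = G} P≢ Q≢ ap na (deco (face x p y q α β ∷ face e f g h γ δ ∷ Fs) refl (_ ∷ _ ∷ pr) M) =
  deco (face x p y e α true ∷ face e f g x γ true ∷ Fs) refl
    (≢-by-adj G (val (there (here refl))) (nae (inj₁ refl) (inj₂ refl)) ∷
     ≢-by-adj G (val (there (there (there (there (there (here refl))))))) (na (inj₁ refl) (inj₂ refl)) ∷ pr)
    (map-swap (map-drop (≢-sym P≢) (≢-by-adj G (val (there (there (there (here refl))))) (nae (inj₂ refl) (inj₁ refl)))
      (map-pull (_ ∷ _ ∷ []) (map-drop (≢-sym Q≢)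
        (≢-by-adj G (val (there (there (there (there (there (there (there (here refl))))))))) (na (inj₂ refl) (inj₁ refl)))
        (map-pull (_ ∷ []) (map-attach P≢ Q≢ ap na M))))))
  where
  val = map-valid M
  nae : ∀ {u v} → u ∈ₚ _ → v ∈ₚ _ → adj G u v ≡ false
  nae a b = trans (sym G _ _) (na b a)

infix 4 _⊑_
_⊑_ : SimpleGraph n → SimpleGraph n → Set
G ⊑ H = ∀ {u v} → adj G u v ≡ true → adj H u v ≡ true

pull-pair : ∀ {A : Set} {x : A} {xs} → x ∈ xs → ∃ λ ys → xs ↭ x ∷ ys
pull-pair h with ys , zs , refl ← ∈-∃++ h = ys ++ zs , shift _ ys zs

deco-attach-∈ : ∀ {P Q} → P ∈ ps → Q ∈ ps → Nondeg P → Nondeg Q → Apart P Q → NonAdj G P Q →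
  Deco G κ ps → Deco (addK22 G P Q) κ ps
deco-attach-∈ {P = P} {Q} P∈ Q∈ P≢ Q≢ ap na Δ with pull-pair P∈
... | ys , p with ∈-resp-↭ p Q∈
...   | here refl = ⊥-elim (ap (inj₁ refl) (inj₁ refl))
...   | there Q∈′ with zs , q ← pull-pair Q∈′ =
  deco-resp-↭ (↭-sym r) (deco-attach P≢ Q≢ ap na (deco-resp-↭ r Δ))
  where r = ↭-trans p (prep P q)

-- The third vertex w of a block is joined to A₁ along with e, and to A₂ by the path step.
addBlock : SimpleGraph n → (e w g : Fin n) → Pair n → Pair n → SimpleGraph n
addBlock G e w g A₁ A₂ = addPath (addK22 (addK22 G A₁ (e , w)) A₂ (e , g)) A₁ w A₂ g

record BlockFresh (G : SimpleGraph n) (e w g : Fin n) (A₁ A₂ : Pair n) : Set where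
  field
    e≢w : e ≢ w
    e≢g : e ≢ g
    w≢g : w ≢ g
    A₁≢ : Nondeg A₁
    A₂≢ : Nondeg A₂
    A₁A₂ : Apart A₁ A₂
    A₁ew : Apart A₁ (e , w)
    A₁eg : Apart A₁ (e , g)
    A₂ew : Apart A₂ (e , w)
    A₂eg : Apart A₂ (e , g)
    n₁ew : NonAdj G A₁ (e , w)
    n₁eg : NonAdj G A₁ (e , g)
    n₂ew : NonAdj G A₂ (e , w)
    n₂eg : NonAdj G A₂ (e , g)

apart-wg : ∀ {A : Pair n} {e w g} → Apart A (e , w) → Apart A (e , g) → Apart (w , g) A
apart-wg ew eg (inj₁ refl) k = ew k (inj₂ refl)
apart-wg ew eg (inj₂ refl) k = eg k (inj₂ refl)

module Block {G : SimpleGraph n} {e w g : Fin n} {A₁ A₂ : Pair n} (fr : BlockFresh G e w g A₁ A₂) where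
  open BlockFresh fr

  x₁ = proj₁ A₁
  y₁ = proj₂ A₁
  x₂ = proj₁ A₂
  y₂ = proj₂ A₂

  G₁ G₂ H₁ H₂ H₃ : SimpleGraph n
  G₁ = addK22 G A₁ (e , w)
  G₂ = addK22 G₁ A₂ (e , g)
  H₁ = addEdge G₂ x₁ g
  H₂ = addEdge H₁ w x₂
  H₃ = addEdge H₂ w y₂

  Row Col : Fin n → Set
  Row u = u ∈ₚ A₁ ⊎ u ∈ₚ A₂
  Col u = u ≡ e ⊎ u ≡ w ⊎ u ≡ g

  false₂ : ∀ {u v} → adj G u v ≡ false →
    ¬ (u ∈ₚ A₁ × v ∈ₚ (e , w)) → ¬ (v ∈ₚ A₁ × u ∈ₚ (e , w)) →
    ¬ (u ∈ₚ A₂ × v ∈ₚ (e , g)) → ¬ (v ∈ₚ A₂ × u ∈ₚ (e , g)) → adj G₂ u v ≡ false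
  false₂ h a b c d = addK22-false G₁ (addK22-false G h a b) c d

  n₂eg′ : NonAdj G₁ A₂ (e , g)
  n₂eg′ u∈ v∈ = addK22-false G (n₂eg u∈ v∈) (λ k → A₁A₂ (proj₁ k) u∈) (λ k → A₁eg (proj₁ k) v∈)

  A₁g : ∀ {u} → u ∈ₚ A₁ → adj G₂ u g ≡ false
  A₁g {u} u∈ = false₂ (n₁eg u∈ (inj₂ refl))
    (λ { (_ , inj₁ k) → e≢g (≡-sym k) ; (_ , inj₂ k) → w≢g (≡-sym k) })
    (λ k → A₁eg (proj₁ k) (inj₂ refl)) (λ k → A₁A₂ u∈ (proj₁ k)) (λ k → A₂eg (proj₁ k) (inj₂ refl))

  wA₂ : ∀ {v} → v ∈ₚ A₂ → adj G₂ w v ≡ false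
  wA₂ {v} v∈ = false₂ (trans (sym G _ _) (n₂ew v∈ (inj₂ refl)))
    (λ k → A₁ew (proj₁ k) (inj₂ refl)) (λ k → A₁A₂ (proj₁ k) v∈) (λ k → A₂ew (proj₁ k) (inj₂ refl))
    (λ { (_ , inj₁ k) → e≢w (≡-sym k) ; (_ , inj₂ k) → w≢g k })

  wgA₁ = apart-wg A₁ew A₁eg
  wgA₂ = apart-wg A₂ew A₂eg

  old : ∀ {u v} → adj G u v ≡ true → adj (addBlock G e w g A₁ A₂) u v ≡ true
  old h = addEdge-old H₃ (addEdge-old H₂ (addEdge-old H₁ (addEdge-old G₂ (addK22-old G₁ (addK22-old G h)))))

  still-false : ∀ {u v} → adj G u v ≡ false → ¬ (Row u × Col v) → ¬ (Row v × Col u) →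
    adj (addBlock G e w g A₁ A₂) u v ≡ false
  still-false h a b = addEdge-false H₃ (addEdge-false H₂ (addEdge-false H₁ (addEdge-false G₂ (false₂ h
      (λ (p , q) → a (inj₁ p , ew q)) (λ (p , q) → b (inj₁ p , ew q))
      (λ (p , q) → a (inj₂ p , eg q)) (λ (p , q) → b (inj₂ p , eg q)))
      (λ (p , q) → a (inj₁ (inj₁ p) , inj₂ (inj₂ q))) (λ (p , q) → b (inj₁ (inj₁ q) , inj₂ (inj₂ p))))
      (λ (p , q) → b (inj₂ (inj₁ q) , inj₂ (inj₁ p))) (λ (p , q) → a (inj₂ (inj₁ p) , inj₂ (inj₁ q))))
      (λ (p , q) → b (inj₂ (inj₂ q) , inj₂ (inj₁ p))) (λ (p , q) → a (inj₂ (inj₂ p) , inj₂ (inj₁ q))))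
      (λ (p , q) → a (inj₁ (inj₂ p) , inj₂ (inj₂ q))) (λ (p , q) → b (inj₁ (inj₂ q) , inj₂ (inj₂ p)))
    where
    ew : ∀ {u} → u ∈ₚ (e , w) → Col u
    ew (inj₁ k) = inj₁ k
    ew (inj₂ k) = inj₂ (inj₁ k)
    eg : ∀ {u} → u ∈ₚ (e , g) → Col u
    eg (inj₁ k) = inj₁ k
    eg (inj₂ k) = inj₂ (inj₂ k)

  -- 12 = 3 · 4: a block is the complete bipartite graph between e, w, g and the four vertices of
  -- `A₁` and `A₂`.
  edges : edgeCount (addBlock G e w g A₁ A₂) ≡ 12 + edgeCount G
  edges = trans (edgeCount-addEdge H₃ y₁g (λ k → wgA₁ (inj₂ refl) (inj₂ (≡-sym k))))
    (cong suc (trans (edgeCount-addEdge H₂ wy₂ (λ k → wgA₂ (inj₁ refl) (inj₂ k)))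
    (cong suc (trans (edgeCount-addEdge H₁ wx₂ (λ k → wgA₂ (inj₁ refl) (inj₁ k)))
    (cong suc (trans (edgeCount-addEdge G₂ (A₁g (inj₁ refl)) (λ k → wgA₁ (inj₂ refl) (inj₁ (≡-sym k))))
    (cong suc (trans (edgeCount-addK22 G₁ A₂≢ e≢g A₂eg n₂eg′)
      (cong (λ x → 4 + x) (edgeCount-addK22 G A₁≢ e≢w A₁ew n₁ew))))))))))
    where
    wx₂ : adj H₁ w x₂ ≡ false
    wx₂ = addEdge-false G₂ (wA₂ (inj₁ refl)) (λ k → wgA₁ (inj₁ refl) (inj₁ (proj₁ k))) (λ k → w≢g (proj₁ k))
    wy₂ : adj H₂ w y₂ ≡ false
    wy₂ = addEdge-false H₁ (addEdge-false G₂ (wA₂ (inj₂ refl)) (λ k → wgA₁ (inj₁ refl) (inj₁ (proj₁ k))) (λ k → w≢g (proj₁ k)))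
      (λ k → A₂≢ (≡-sym (proj₂ k))) (λ k → wgA₂ (inj₁ refl) (inj₁ (proj₁ k)))
    y₁g : adj H₃ y₁ g ≡ false
    y₁g = addEdge-false H₂ (addEdge-false H₁ (addEdge-false G₂ (A₁g (inj₂ refl))
      (λ k → A₁≢ (≡-sym (proj₁ k))) (λ k → wgA₁ (inj₂ refl) (inj₂ (≡-sym (proj₁ k)))))
      (λ k → wgA₁ (inj₁ refl) (inj₂ (≡-sym (proj₁ k)))) (λ k → A₁A₂ (inj₂ refl) (inj₁ (proj₁ k))))
      (λ k → wgA₁ (inj₁ refl) (inj₂ (≡-sym (proj₁ k)))) (λ k → A₁A₂ (inj₂ refl) (inj₂ (proj₁ k)))

  -- Each of the two tubes leaves a spare quadrilateral, y₁q₁x₁w and y₂q₂x₂g, and the path is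
  -- attached between these. The four reserved faces are those that the tubes return, so the path
  -- costs no reservation.
  deco-block : ∀ {κ ps} → Deco G κ ((e , w) ∷ (e , g) ∷ A₁ ∷ A₂ ∷ ps) →
    Deco (addBlock G e w g A₁ A₂) κ ((e , w) ∷ (e , g) ∷ A₁ ∷ A₂ ∷ ps)
  deco-block (deco (face e fw w hw γw δw ∷ face e fb g hb γb δb ∷ face x₁ p₁ y₁ q₁ α₁ β₁ ∷ face x₂ p₂ y₂ q₂ α₂ β₂ ∷ Fs)
      refl (_ ∷ _ ∷ _ ∷ _ ∷ pr) M) =
    deco (face e fw w x₁ γw true ∷ face e fb g x₂ γb true ∷ face x₁ p₁ y₁ e α₁ true ∷ face x₂ p₂ y₂ e α₂ true ∷ Fs) refl
      (≢-by-adj G (v (there (here refl))) (n₁ew (inj₁ refl) (inj₂ refl)) ∷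
       ≢-by-adj G (v (there (there (there (there (there (here refl))))))) (n₂eg (inj₁ refl) (inj₂ refl)) ∷
       ≢-by-adj G (v (i₈ (there (here refl)))) (~ (n₁ew (inj₂ refl) (inj₁ refl))) ∷
       ≢-by-adj G (v (i₈ (there (there (there (there (there (here refl)))))))) (~ (n₂ew (inj₂ refl) (inj₁ refl))) ∷ pr)
      (map-pull (_ ∷ _ ∷ _ ∷ []) (map-pull (_ ∷ _ ∷ []) (map-pull (_ ∷ _ ∷ _ ∷ []) (map-pull (_ ∷ []) (map-attach-path A₁≢ A₂≢ w≢g
        (≢-by-adj G (v (i₈ (there (there (there (here refl)))))) (~ (n₁eg (inj₁ refl) (inj₂ refl))))
        (≢-by-adj G (v (i₈ (there (there (there (there (there (there (there (here refl)))))))))) (~ (n₂ew (inj₁ refl) (inj₂ refl))))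
        A₁A₂ wgA₁ wgA₂ (A₁g (inj₁ refl)) (wA₂ (inj₁ refl)) (wA₂ (inj₂ refl)) (A₁g (inj₂ refl))
        (step₂ (step₁ M)))))))
    where
    v = map-valid M
    ~ : ∀ {u v} → adj G u v ≡ false → adj G v u ≡ false
    ~ = trans (sym G _ _)
    i₈ : ∀ {A : Set} {x : A} {a b c d e f g h xs} → x ∈ xs → x ∈ a ∷ b ∷ c ∷ d ∷ e ∷ f ∷ g ∷ h ∷ xs
    i₈ k = there (there (there (there (there (there (there (there k)))))))
    step₁ : ∀ {Ws} → Map G _ (quad e fw w hw γw δw ∷ quad e fb g hb γb δb ∷ quad x₁ p₁ y₁ q₁ α₁ β₁ ∷ quad x₂ p₂ y₂ q₂ α₂ β₂ ∷ Ws) →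
      Map G₁ _ (quad e fw w x₁ γw true ∷ quad x₁ p₁ y₁ e α₁ true ∷ quad y₁ q₁ x₁ w β₁ true ∷ quad e fb g hb γb δb ∷ quad x₂ p₂ y₂ q₂ α₂ β₂ ∷ Ws)
    step₁ M = map-drop (≢-sym e≢w)
      (≢-by-adj G (map-valid M (there (there (there (here refl))))) (n₁ew (inj₂ refl) (inj₁ refl)))
      (map-pull (_ ∷ []) (map-attach A₁≢ e≢w A₁ew n₁ew (map-pull (_ ∷ _ ∷ []) M)))
    step₂ : ∀ {Ws} → Map G₁ _ (quad e fw w x₁ γw true ∷ quad x₁ p₁ y₁ e α₁ true ∷ quad y₁ q₁ x₁ w β₁ true ∷ quad e fb g hb γb δb ∷ quad x₂ p₂ y₂ q₂ α₂ β₂ ∷ Ws) →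
      Map G₂ _ (quad y₁ q₁ x₁ w β₁ true ∷ quad y₂ q₂ x₂ g β₂ true ∷ quad e fb g x₂ γb true ∷ quad x₂ p₂ y₂ e α₂ true ∷ quad e fw w x₁ γw true ∷ quad x₁ p₁ y₁ e α₁ true ∷ Ws)
    step₂ M = map-pull (_ ∷ _ ∷ _ ∷ _ ∷ _ ∷ []) (map-pull (_ ∷ _ ∷ []) (map-drop (≢-sym e≢g)
      (≢-by-adj G₁ (map-valid M (i₈ (there (there (there (there (there (there (there (here refl))))))))))
        (n₂eg′ (inj₂ refl) (inj₁ refl)))
      (map-pull (_ ∷ []) (map-attach A₂≢ e≢g A₂eg n₂eg′
        (map-swap (map-pull (_ ∷ _ ∷ _ ∷ _ ∷ []) (map-pull (_ ∷ _ ∷ _ ∷ _ ∷ []) M)))))))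

-- Lists of disjoint pairs.

flat : List (Pair n) → List (Fin n)
flat []             = []
flat ((x , y) ∷ ps) = x ∷ y ∷ flat ps

flat-++ : (ps qs : List (Pair n)) → flat (ps ++ qs) ≡ flat ps ++ flat qs
flat-++ []       qs = refl
flat-++ (_ ∷ ps) qs = cong (λ l → _ ∷ _ ∷ l) (flat-++ ps qs)

mapPair : {m n : ℕ} → (Fin m → Fin n) → Pair m → Pair n
mapPair f (x , y) = f x , f y

flat-map : {m n : ℕ} (f : Fin m → Fin n) (ps : List (Pair m)) → flat (map (mapPair f) ps) ≡ map f (flat ps)
flat-map f []       = refl
flat-map f (_ ∷ ps) = cong (λ l → _ ∷ _ ∷ l) (flat-map f ps)

length-flat : (ps : List (Pair n)) → length (flat ps) ≡ 2 * length ps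
length-flat []       = refl
length-flat (_ ∷ ps) = trans (cong (λ x → 2 + x) (length-flat ps)) (≡-sym (*-suc 2 (length ps)))

∈-flat : ∀ {P} {u : Fin n} → P ∈ ps → u ∈ₚ P → u ∈ flat ps
∈-flat (here refl) (inj₁ refl) = here refl
∈-flat (here refl) (inj₂ refl) = there (here refl)
∈-flat (there h)   k           = there (there (∈-flat h k))

nondeg-flat : ∀ {P : Pair n} → Unique (flat ps) → P ∈ ps → Nondeg P
nondeg-flat ((x≢y ∷ _) ∷ _) (here refl) = x≢y
nondeg-flat (_ ∷ _ ∷ u)     (there h)   = nondeg-flat u h

same-pair : ∀ {P Q} {u : Fin n} → Unique (flat ps) → P ∈ ps → Q ∈ ps → u ∈ₚ P → u ∈ₚ Q → P ≡ Q
same-pair U             (here refl) (here refl) _ _ = refl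
same-pair U             (here refl) (there q) a b =
  ⊥-elim (unique-disjoint {xs = _ ∷ _ ∷ []} U (∈-flat (here refl) a) (∈-flat q b))
same-pair U             (there p) (here refl) a b =
  ⊥-elim (unique-disjoint {xs = _ ∷ _ ∷ []} U (∈-flat (here refl) b) (∈-flat p a))
same-pair (_ ∷ _ ∷ U)   (there p) (there q) a b = same-pair U p q a b

unique-pairs : {ps : List (Pair n)} → Unique (flat ps) → Unique ps
unique-pairs {ps = []}    _                  = []
unique-pairs {ps = _ ∷ _} U@(_ ∷ _ ∷ V) =
  All.tabulate (λ { h refl → unique-disjoint {xs = _ ∷ _ ∷ []} U (here refl) (∈-flat h (inj₁ refl)) }) ∷ unique-pairs V

-- Attaching many tubes.

record Grown (G : SimpleGraph n) (κ : Kind) (ps : List (Pair n)) (c : ℕ) : Set where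
  constructor grown
  field
    graph   : SimpleGraph n
    Δ       : Deco graph κ ps
    edges   : edgeCount graph ≡ c + edgeCount G
    extends : G ⊑ graph

-- The tube for (P , Q) creates no edge between P′ and Q′, so the nonadjacency needed by a later
-- tube survives.
Indep : Pair n × Pair n → Pair n × Pair n → Set
Indep (P , Q) (P′ , Q′) = ∀ {u v} → u ∈ₚ P′ → v ∈ₚ Q′ → ¬ (u ∈ₚ P × v ∈ₚ Q) × ¬ (v ∈ₚ P × u ∈ₚ Q)

record Attachable (ps : List (Pair n)) (P Q : Pair n) : Set where
  field
    P∈ : P ∈ ps
    Q∈ : Q ∈ ps
    P≢ : Nondeg P
    Q≢ : Nondeg Q
    ap : Apart P Q

-- The adjacency returned for each tube is what later connects the two parts of a union.
attach-all : (todo : List (Pair n × Pair n)) → All (λ (P , Q) → Attachable ps P Q) todo →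
  AllPairs Indep todo → All (λ (P , Q) → NonAdj G P Q) todo → Deco G κ ps →
  ∃ λ (r : Grown G κ ps (4 * length todo)) →
    All (λ (P , Q) → adj (Grown.graph r) (proj₁ P) (proj₁ Q) ≡ true) todo
attach-all [] _ _ _ Δ = grown _ Δ refl (λ h → h) , []
attach-all {ps = ps} {G} {κ} ((P , Q) ∷ todo) (a ∷ as) (i ∷ is) (na ∷ nas) Δ =
  let r , l = attach-all todo as is
                (All.zipWith (λ (ind , na′) {u} {v} u∈ v∈ → addK22-false G (na′ u∈ v∈) (proj₁ (ind u∈ v∈)) (proj₂ (ind u∈ v∈)))
                  (i , nas))
                (deco-attach-∈ P∈ Q∈ P≢ Q≢ ap na Δ)
  in grown (Grown.graph r) (Grown.Δ r)
       (trans (Grown.edges r) (trans (cong (λ x → 4 * length todo + x) (edgeCount-addK22 G P≢ Q≢ ap na))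
         (trans (≡-sym (+-assoc (4 * length todo) 4 (edgeCount G)))
           (cong (_+ edgeCount G) (trans (+-comm (4 * length todo) 4) (≡-sym (*-suc 4 (length todo))))))))
       (λ h → Grown.extends r (addK22-old G h))
     , Grown.extends r (addK22-new G (λ e → ap (inj₁ refl) (inj₁ e))) ∷ l
  where open Attachable a

module Cross {L R : List (Pair n)} (U : Unique (flat L ++ flat R)) where

  private
    UL = unique-++ˡ (flat L) U
    UR = unique-++ʳ (flat L) U

  apart : ∀ {P Q u} → P ∈ L → Q ∈ R → u ∈ₚ P → ¬ u ∈ₚ Q
  apart P∈ Q∈ a b = unique-disjoint U (∈-flat P∈ a) (∈-flat Q∈ b)

  cross : List (Pair n × Pair n)
  cross = cartesianProduct L R

  indep : ∀ {i j} → i ∈ cross → j ∈ cross → i ≢ j → Indep i j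
  indep {P , Q} {P′ , Q′} i∈ j∈ i≢j u∈ v∈ =
    let P∈ , Q∈ = ∈-cartesianProduct⁻ L R i∈ ; P′∈ , Q′∈ = ∈-cartesianProduct⁻ L R j∈ in
    (λ (a , b) → i≢j (cong₂ _,_ (same-pair UL P∈ P′∈ a u∈) (same-pair UR Q∈ Q′∈ b v∈))) ,
    (λ (a , b) → apart P∈ Q′∈ a v∈)

  all-indep : (todo : List (Pair n × Pair n)) → All (_∈ cross) todo → Unique todo → AllPairs Indep todo
  all-indep []         _        _       = []
  all-indep (i ∷ todo) (h ∷ hs) (x ∷ u) =
    All.zipWith (λ (i≢j , j∈) {u} {v} → indep h j∈ i≢j {u} {v}) (x , hs) ∷ all-indep todo hs u

  -- `drop s` leaves out s of the tubes between L and R. As every tube carries four edges, this is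
  -- how t is increased in steps of four.
  join-cross : ∀ {all : List (Pair n)} s → (∀ {P} → P ∈ L → P ∈ all) → (∀ {Q} → Q ∈ R → Q ∈ all) →
    (∀ {P Q} → P ∈ L → Q ∈ R → NonAdj G P Q) → Deco G κ all →
    ∃ λ (r : Grown G κ all (4 * length (drop s cross))) →
      All (λ (P , Q) → adj (Grown.graph r) (proj₁ P) (proj₁ Q) ≡ true) (drop s cross)
  join-cross {G = G} s L⊆ R⊆ na = attach-all (drop s cross)
      (All.map (λ h → let P∈ , Q∈ = ∈-cartesianProduct⁻ L R h in record
        { P∈ = L⊆ P∈ ; Q∈ = R⊆ Q∈ ; P≢ = nondeg-flat UL P∈ ; Q≢ = nondeg-flat UR Q∈ ; ap = apart P∈ Q∈ }) sub)
      (all-indep _ sub (Unique.drop⁺ s (Unique.cartesianProduct⁺ (unique-pairs UL) (unique-pairs UR))))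
      (All.map (λ h → let P∈ , Q∈ = ∈-cartesianProduct⁻ L R h in λ {u} {v} → na P∈ Q∈ {u} {v}) sub)
    where
    sub : All (_∈ cross) (drop s cross)
    sub = All.drop⁺ s (All.tabulate (λ h → h))

length-cartesianProduct : {A B : Set} (xs : List A) (ys : List B) →
  length (cartesianProduct xs ys) ≡ length xs * length ys
length-cartesianProduct []       ys = refl
length-cartesianProduct (x ∷ xs) ys = trans (length-++ (map (x ,_) ys))
  (cong₂ _+_ (length-map (x ,_) ys) (length-cartesianProduct xs ys))

unpair : List (Pair n × Pair n) → List (Pair n)
unpair []             = []
unpair ((A , B) ∷ bs) = A ∷ B ∷ unpair bs

private
  pull-two : ∀ {A : Set} {x y : A} {xs} → x ∈ xs → y ∈ xs → x ≢ y → ∃ λ ys → xs ↭ x ∷ y ∷ ys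
  pull-two x∈ y∈ x≢y with pull-pair x∈
  ... | ys , p with ∈-resp-↭ p y∈
  ...   | here refl = ⊥-elim (x≢y refl)
  ...   | there h with zs , q ← pull-pair h = zs , ↭-trans p (prep _ q)

-- A block uses two pairs, because each of them supplies one face for the path step; hence the
-- grouping by `unpair`. The second component says that no edge was added away from e, w, g, which
-- leaves the other pairs free for ordinary tubes.
attach-blocks : ∀ {e w g : Fin n} {rest} (bs : List (Pair n × Pair n)) →
  Unique (e ∷ w ∷ g ∷ flat (unpair bs)) → (∀ {P} → P ∈ unpair bs → P ∈ rest) →
  (∀ {u v} → u ∈ flat (unpair bs) → v ∈ e ∷ w ∷ g ∷ [] → adj G u v ≡ false) →
  Deco G κ ((e , w) ∷ (e , g) ∷ rest) →
  ∃ λ (r : Grown G κ ((e , w) ∷ (e , g) ∷ rest) (12 * length bs)) →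
    ∀ {u v} → adj G u v ≡ false → u ∉ e ∷ w ∷ g ∷ [] → v ∉ e ∷ w ∷ g ∷ [] → adj (Grown.graph r) u v ≡ false
attach-blocks [] U sub na Δ = grown _ Δ refl (λ h → h) , λ h _ _ → h
attach-blocks {G = G} {κ} {e} {w} {g} {rest} ((A₁ , A₂) ∷ bs)
  U@((e≢w ∷ e≢g ∷ _) ∷ (w≢g ∷ _) ∷ _ ∷ UA) sub na Δ
  with ys , p ← pull-two (sub (here refl)) (sub (there (here refl)))
                  (λ { refl → unique-disjoint {xs = _ ∷ _ ∷ []} UA (here refl) (here refl) }) =
  let r , still = attach-blocks bs U′ (sub ∘ there ∘ there) na′ Δ′
  in grown (Grown.graph r) (Grown.Δ r)
       (trans (Grown.edges r) (trans (cong (λ x → 12 * length bs + x) Bl.edges)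
         (trans (≡-sym (+-assoc (12 * length bs) 12 (edgeCount G)))
           (cong (_+ edgeCount G) (trans (+-comm (12 * length bs) 12) (≡-sym (*-suc 12 (length bs))))))))
       (λ h → Grown.extends r (Bl.old h))
     , λ h u∉ v∉ → still (Bl.still-false h (λ (_ , k) → v∉ (col k)) (λ (_ , k) → u∉ (col k))) u∉ v∉
  where
  Us = unpair bs
  apart-A : ∀ {u} → u ∈ flat (A₁ ∷ A₂ ∷ Us) → u ∉ e ∷ w ∷ g ∷ []
  apart-A h k = unique-disjoint {xs = e ∷ w ∷ g ∷ []} U k h
  i₁ : ∀ {u} → u ∈ₚ A₁ → u ∈ flat (A₁ ∷ A₂ ∷ Us)
  i₁ = ∈-flat (here refl)
  i₂ : ∀ {u} → u ∈ₚ A₂ → u ∈ flat (A₁ ∷ A₂ ∷ Us)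
  i₂ = ∈-flat (there (here refl))
  ew : ∀ {u} → u ∈ₚ (e , w) → u ∈ e ∷ w ∷ g ∷ []
  ew (inj₁ refl) = here refl
  ew (inj₂ refl) = there (here refl)
  eg : ∀ {u} → u ∈ₚ (e , g) → u ∈ e ∷ w ∷ g ∷ []
  eg (inj₁ refl) = here refl
  eg (inj₂ refl) = there (there (here refl))
  fr : BlockFresh G e w g A₁ A₂
  fr = record
    { e≢w = e≢w ; e≢g = e≢g ; w≢g = w≢g
    ; A₁≢ = nondeg-flat UA (here refl) ; A₂≢ = nondeg-flat UA (there (here refl))
    ; A₁A₂ = λ a b → unique-disjoint {xs = _ ∷ _ ∷ []} UA (∈-flat (here refl) a) (∈-flat (here refl) b)
    ; A₁ew = λ a b → apart-A (i₁ a) (ew b) ; A₁eg = λ a b → apart-A (i₁ a) (eg b)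
    ; A₂ew = λ a b → apart-A (i₂ a) (ew b) ; A₂eg = λ a b → apart-A (i₂ a) (eg b)
    ; n₁ew = λ a b → na (i₁ a) (ew b) ; n₁eg = λ a b → na (i₁ a) (eg b)
    ; n₂ew = λ a b → na (i₂ a) (ew b) ; n₂eg = λ a b → na (i₂ a) (eg b)
    }
  module Bl = Block fr
  r₀ : (e , w) ∷ (e , g) ∷ rest ↭ (e , w) ∷ (e , g) ∷ A₁ ∷ A₂ ∷ ys
  r₀ = prep _ (prep _ p)
  Δ′ = deco-resp-↭ (↭-sym r₀) (Bl.deco-block (deco-resp-↭ r₀ Δ))
  U′ : Unique (e ∷ w ∷ g ∷ flat Us)
  U′ with (a ∷ b ∷ c) ∷ (d ∷ f) ∷ h ∷ V ← U =
    (a ∷ b ∷ All.++⁻ʳ (flat (A₁ ∷ A₂ ∷ [])) c) ∷ (d ∷ All.++⁻ʳ (flat (A₁ ∷ A₂ ∷ [])) f)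
    ∷ All.++⁻ʳ (flat (A₁ ∷ A₂ ∷ [])) h ∷ unique-++ʳ (flat (A₁ ∷ A₂ ∷ [])) V
  col : ∀ {u} → Bl.Col u → u ∈ e ∷ w ∷ g ∷ []
  col (inj₁ refl)        = here refl
  col (inj₂ (inj₁ refl)) = there (here refl)
  col (inj₂ (inj₂ refl)) = there (there (here refl))
  row : ∀ {u} → Bl.Row u → u ∈ flat (A₁ ∷ A₂ ∷ [])
  row (inj₁ a) = ∈-flat (here refl) a
  row (inj₂ a) = ∈-flat (there (here refl)) a
  na′ : ∀ {u v} → u ∈ flat Us → v ∈ e ∷ w ∷ g ∷ [] → adj (addBlock G e w g A₁ A₂) u v ≡ false
  na′ u∈ v∈ = Bl.still-false (na (there (there (there (there u∈)))) v∈)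
    (λ (a , _) → unique-disjoint {xs = flat (A₁ ∷ A₂ ∷ [])} UA (row a) u∈)
    (λ (_ , b) → apart-A (there (there (there (there u∈)))) (col b))

-- Joining two decorated embeddings.

tri : ℕ → ℕ
tri zero    = 0
tri (suc n) = n + tri n

-- A complete graph on m + n vertices consists of two complete graphs and the m * n edges between
-- them.
tri-+ : ∀ m n → tri (m + n) ≡ tri m + tri n + m * n
tri-+ zero    n = ≡-sym (+-identityʳ (tri n))
tri-+ (suc m) n rewrite tri-+ m n =
  solve 4 (λ m n a b → m :+ n :+ (a :+ b :+ m :* n) := m :+ a :+ b :+ (n :+ m :* n)) refl m n (tri m) (tri n)
  where open +-*-Solver

mapFace : {m n : ℕ} → (Fin m → Fin n) → Face m → Face n
mapFace φ (face e f g h γ δ) = face (φ e) (φ f) (φ g) (φ h) γ δ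

module _ {k n : ℕ} {H : SimpleGraph k} {G : SimpleGraph n} {κ κ′ : Kind} where

  private
    l : Fin k → Fin (k + n)
    l = _↑ˡ n
    r : Fin n → Fin (k + n)
    r = k ↑ʳ_

  proper-map : {m j : ℕ} {φ : Fin m → Fin j} → (∀ {x y} → φ x ≡ φ y → x ≡ y) →
    (Fs : List (Face m)) → All ProperMid Fs → All ProperMid (map (mapFace φ) Fs)
  proper-map inj []                          []       = []
  proper-map inj (face e f g h γ δ ∷ Fs) (p ∷ ps) = (p ∘ inj) ∷ proper-map inj Fs ps

  deco⊕ : ∀ {qs ps} → Deco H κ qs → Deco G κ′ ps →
    Deco (H ⊕ G) (κ ⊔ κ′) (map (mapPair l) qs ++ map (mapPair r) ps)
  deco⊕ (deco Fs refl p M) (deco Fs′ refl p′ M′) =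
    deco (map (mapFace l) Fs ++ map (mapFace r) Fs′)
      (trans (map-++ ends (map (mapFace l) Fs) _) (cong₂ _++_ (swap-map ends (mapFace l) (mapPair l) Fs (λ _ → refl))
                                                        (swap-map ends (mapFace r) (mapPair r) Fs′ (λ _ → refl))))
      (All.++⁺ (proper-map (↑ˡ-injective n _ _) Fs p) (proper-map (↑ʳ-injective k _ _) Fs′ p′))
      (subst (Map (H ⊕ G) (κ ⊔ κ′))
        (≡-sym (trans (map-++ walk (map (mapFace l) Fs) _)
          (cong₂ _++_ (swap-map walk (mapFace l) (map (mapState l)) Fs (λ _ → refl))
                      (swap-map walk (mapFace r) (map (mapState r)) Fs′ (λ _ → refl)))))
        (DisjointUnion.map⊕ M M′))
    where
    swap-map : {A B C D : Set} (f : B → D) (g : A → B) (h : C → D) {f′ : A → C} (xs : List A) →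
      (∀ x → f (g x) ≡ h (f′ x)) → map f (map g xs) ≡ map h (map f′ xs)
    swap-map f g h xs e = trans (≡-sym (map-∘ xs)) (trans (map-cong e xs) (map-∘ xs))

  connected⊕ : Connected H → Connected G → {K : SimpleGraph (k + n)} → H ⊕ G ⊑ K →
    ∀ {i j} → adj K (l i) (r j) ≡ true → Connected K
  connected⊕ cH cG {K} sub {i} {j} ij u v = reach-trans (to u) (from v)
    where
    rl : ∀ {a b} → Reach K (l a) (l b)
    rl {a} {b} = reach-map l (λ {x} {y} h → sub (trans (adj-ll H G x y) h)) (cH a b)
    rr : ∀ {a b} → Reach K (r a) (r b)
    rr {a} {b} = reach-map r (λ {x} {y} h → sub (trans (adj-rr H G x y) h)) (cG a b)
    view = DisjointUnion.view {k} {n} {H} {G}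
    to : ∀ u → Reach K u (l i)
    to u = case view u of λ where
      (inj₁ (a , refl)) → rl
      (inj₂ (a , refl)) → reach-trans rr (step (trans (sym K (r j) (l i)) ij) here)
    from : ∀ u → Reach K (l i) u
    from u = case view u of λ where
      (inj₁ (a , refl)) → rl
      (inj₂ (a , refl)) → step ij rr

  na⊕ : ∀ {qs : List (Fin k)} {ps : List (Fin n)} {u v} → u ∈ map l qs → v ∈ map r ps → adj (H ⊕ G) u v ≡ false
  na⊕ u∈ v∈ with i , _ , refl ← ∈-map⁻ l u∈ | j , _ , refl ← ∈-map⁻ r v∈ = adj-lr H G i j

  unique⊕ : {us : List (Fin k)} {vs : List (Fin n)} → Unique us → Unique vs → Unique (map l us ++ map r vs)
  unique⊕ U V = Unique.++⁺ (Unique.map⁺ (↑ˡ-injective n _ _) U) (Unique.map⁺ (↑ʳ-injective k _ _) V)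
    λ (a , b) → let i , _ , e = ∈-map⁻ l a ; j , _ , e′ = ∈-map⁻ r b in
      DisjointUnion.left-right {k} {n} {H} {G} (trans (≡-sym e) e′)

record EvenMap (n t : ℕ) (κ : Kind) : Set where
  field
    graph     : SimpleGraph n
    connected : Connected graph
    pairs     : List (Pair n)
    unique    : Unique (flat pairs)
    total     : length (flat pairs) ≡ n
    size      : edgeCount graph + t ≡ tri n
    Δ         : Deco graph κ pairs

-- The vertices are w and those of the pairs (e , g) ∷ ps; the additional pair
-- (e , w) gives access to the unmatched vertex w.
record OddMap (n t : ℕ) (κ : Kind) : Set where
  field
    graph     : SimpleGraph n
    connected : Connected graph
    e w g     : Fin n
    pairs     : List (Pair n)
    unique    : Unique (e ∷ w ∷ g ∷ flat pairs)
    total     : length (e ∷ w ∷ g ∷ flat pairs) ≡ n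
    size      : edgeCount graph + t ≡ tri n
    Δ         : Deco graph κ ((e , w) ∷ (e , g) ∷ pairs)

drop-cons : {A : Set} (s : ℕ) (xs : List A) → s < length xs → ∃ λ x → x ∈ drop s xs × x ∈ xs
drop-cons zero    (x ∷ xs) _       = x , here refl , here refl
drop-cons (suc s) (x ∷ xs) (s≤s h) = let y , p , q = drop-cons s xs h in y , p , there q

length-drop-+ : {A : Set} (s : ℕ) (xs : List A) → s ≤ length xs → length (drop s xs) + s ≡ length xs
length-drop-+ s xs h = trans (cong (_+ s) (length-drop s xs)) (m∸n+n≡m h)

module _ {k n t t′ : ℕ} {κ κ′ : Kind} where

  private
    l : Fin k → Fin (k + n)
    l = _↑ˡ n
    r : Fin n → Fin (k + n)
    r = k ↑ʳ_

  -- All tubes together would carry 4 · |pairs Q| · |pairs P| = k · n edges, that is, every edge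
  -- between the parts; so the deficits t and t′ add up, and each omitted tube costs four. The
  -- strict bound on s keeps one tube, which connects the parts.
  join-even : (Q : EvenMap k t κ) (P : EvenMap n t′ κ′) (s : ℕ) →
    s < length (EvenMap.pairs Q) * length (EvenMap.pairs P) → EvenMap (k + n) (t + t′ + 4 * s) (κ ⊔ κ′)
  join-even Q P s s< = record
    { graph = Grown.graph R
    ; connected = connected′
    ; pairs = all
    ; unique = subst Unique (≡-sym flat-all) U
    ; total = trans (cong length flat-all) (trans (length-++ (flat L)) (cong₂ _+_
        (trans (cong length flat-L) (trans (length-map l (flat Q.pairs)) Q.total))
        (trans (cong length flat-M) (trans (length-map r (flat P.pairs)) P.total))))
    ; size = size′
    ; Δ = Grown.Δ R
    }
    where
    module Q = EvenMap Q
    module P = EvenMap P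
    L M all : List (Pair (k + n))
    L = map (mapPair l) Q.pairs
    M = map (mapPair r) P.pairs
    all = L ++ M
    flat-L : flat L ≡ map l (flat Q.pairs)
    flat-L = flat-map l Q.pairs
    flat-M : flat M ≡ map r (flat P.pairs)
    flat-M = flat-map r P.pairs
    flat-all : flat all ≡ flat L ++ flat M
    flat-all = flat-++ L M
    U : Unique (flat L ++ flat M)
    U = subst Unique (≡-sym (cong₂ _++_ flat-L flat-M)) (unique⊕ {H = Q.graph} {P.graph} {κ} {κ′} Q.unique P.unique)
    open Cross {L = L} {M} U using (cross; join-cross)
    length-cross : length cross ≡ length Q.pairs * length P.pairs
    length-cross = trans (length-cartesianProduct L M) (cong₂ _*_ (length-map _ Q.pairs) (length-map _ P.pairs))
    s<′ : s < length cross
    s<′ = subst (s <_) (≡-sym length-cross) s<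
    R,linked = join-cross s ∈-++⁺ˡ (∈-++⁺ʳ L)
      (λ P∈ Q∈ u∈ v∈ → na⊕ {H = Q.graph} {P.graph} {κ} {κ′} (subst (_ ∈_) flat-L (∈-flat P∈ u∈)) (subst (_ ∈_) flat-M (∈-flat Q∈ v∈)))
      (deco⊕ Q.Δ P.Δ)
    R = proj₁ R,linked
    connected′ : Connected (Grown.graph R)
    connected′ with (A , B) , h , h′ ← drop-cons s cross s<′
      with A∈ , B∈ ← ∈-cartesianProduct⁻ L M h′
      with a , _ , refl ← ∈-map⁻ (mapPair l) A∈ | b , _ , refl ← ∈-map⁻ (mapPair r) B∈ =
      connected⊕ {κ = κ} {κ′} Q.connected P.connected (Grown.extends R) (All.lookup (proj₂ R,linked) h)
    size′ : edgeCount (Grown.graph R) + (t + t′ + 4 * s) ≡ tri (k + n)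
    size′ = begin
      edgeCount (Grown.graph R) + (t + t′ + 4 * s)
        ≡⟨ cong (_+ (t + t′ + 4 * s)) (trans (Grown.edges R) (cong (λ x → 4 * len + x) (edgeCount-⊕ Q.graph P.graph))) ⟩
      4 * len + (edgeCount Q.graph + edgeCount P.graph) + (t + t′ + 4 * s)
        ≡⟨ solve 6 (λ c a b t t′ s → con 4 :* c :+ (a :+ b) :+ (t :+ t′ :+ con 4 :* s)
                                  := (a :+ t) :+ (b :+ t′) :+ con 4 :* (c :+ s)) refl
             len (edgeCount Q.graph) (edgeCount P.graph) t t′ s ⟩
      (edgeCount Q.graph + t) + (edgeCount P.graph + t′) + 4 * (len + s)
        ≡⟨ cong₂ _+_ (cong₂ _+_ Q.size P.size) (cong (4 *_) (trans (length-drop-+ s cross (<⇒≤ s<′)) length-cross)) ⟩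
      tri k + tri n + 4 * (length Q.pairs * length P.pairs)
        ≡⟨ cong (λ x → tri k + tri n + x) (solve 2 (λ a b → con 4 :* (a :* b) := (con 2 :* a) :* (con 2 :* b)) refl
             (length Q.pairs) (length P.pairs)) ⟩
      tri k + tri n + (2 * length Q.pairs) * (2 * length P.pairs)
        ≡⟨ cong (λ x → tri k + tri n + x) (cong₂ _*_ (trans (≡-sym (length-flat Q.pairs)) Q.total) (trans (≡-sym (length-flat P.pairs)) P.total)) ⟩
      tri k + tri n + k * n
        ≡⟨ tri-+ k n ⟨
      tri (k + n) ∎
      where
      open ≡-Reasoning
      open +-*-Solver
      len = length (drop s cross)

  -- The vertices e, w, g are served by blocks and the remaining pairs of P by ordinary tubes, from
  -- which the s omitted ones are taken. The count is 6 · |pairs Q| + 4 · |pairs Q| · |pairs P| = 2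
  -- · |pairs Q| · (3 + 2 · |pairs P|) = k · n.
  join-odd : (Q : EvenMap k t κ) (P : OddMap n t′ κ′) (bs : List (Pair k × Pair k)) →
    EvenMap.pairs Q ≡ unpair bs → (s : ℕ) →
    s < length (EvenMap.pairs Q) * length (OddMap.pairs P) → OddMap (k + n) (t + t′ + 4 * s) (κ ⊔ κ′)
  join-odd Q P bs qs≡ s s< = record
    { graph = Grown.graph R
    ; connected = connected′
    ; e = r P.e ; w = r P.w ; g = r P.g
    ; pairs = M ++ L
    ; unique = unique-resp-↭ perm-flat U₀
    ; total = trans (↭-length (↭-sym perm-flat)) (trans (length-++ (flat L)) (cong₂ _+_
        (trans (cong length flat-L) (trans (length-map l (flat Q.pairs)) Q.total))
        (trans (cong (λ x → 3 + x) (trans (cong length flat-M) (length-map r (flat P.pairs)))) P.total)))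
    ; size = size′
    ; Δ = Grown.Δ R
    }
    where
    module Q = EvenMap Q
    module P = OddMap P
    L M : List (Pair (k + n))
    L = map (mapPair l) Q.pairs
    M = map (mapPair r) P.pairs
    cols : List (Fin (k + n))
    cols = r P.e ∷ r P.w ∷ r P.g ∷ []
    flat-L : flat L ≡ map l (flat Q.pairs)
    flat-L = flat-map l Q.pairs
    flat-M : flat M ≡ map r (flat P.pairs)
    flat-M = flat-map r P.pairs
    U₀ : Unique (flat L ++ cols ++ flat M)
    U₀ = subst Unique (≡-sym (cong₂ _++_ flat-L (cong (cols ++_) flat-M))) (unique⊕ {H = Q.graph} {P.graph} {κ} {κ′} Q.unique P.unique)
    perm-flat : flat L ++ cols ++ flat M ↭ cols ++ flat (M ++ L)
    perm-flat = ↭-trans (++-comm (flat L) (cols ++ flat M))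
      (↭-reflexive (cong (cols ++_) (≡-sym (flat-++ M L))))
    bs′ : List (Pair (k + n) × Pair (k + n))
    bs′ = map (λ (A , B) → mapPair l A , mapPair l B) bs
    unpair-bs′ : ∀ bs → unpair (map (λ (A , B) → mapPair l A , mapPair l B) bs) ≡ map (mapPair l) (unpair bs)
    unpair-bs′ []       = refl
    unpair-bs′ (_ ∷ bs) = cong (λ x → _ ∷ _ ∷ x) (unpair-bs′ bs)
    L≡ : unpair bs′ ≡ L
    L≡ = trans (unpair-bs′ bs) (cong (map (mapPair l)) (≡-sym qs≡))
    na-flat : ∀ {u v} → u ∈ flat L → v ∈ cols ++ flat M → adj (Q.graph ⊕ P.graph) u v ≡ false
    na-flat {u} {v} u∈ v∈ = na⊕ {H = Q.graph} {P.graph} {κ} {κ′} {ps = P.e ∷ P.w ∷ P.g ∷ flat P.pairs}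
      (subst (u ∈_) flat-L u∈) (subst (λ x → v ∈ cols ++ x) flat-M v∈)
    U-bs : Unique (cols ++ flat (unpair bs′))
    U-bs = subst (λ x → Unique (cols ++ flat x)) (≡-sym L≡) (unique-resp-↭ (++-comm (flat L) cols)
      (unique-++ˡ (flat L ++ cols) (subst Unique (≡-sym (++-assoc (flat L) cols (flat M))) U₀)))
    blocks = attach-blocks bs′ U-bs (λ h → ∈-++⁺ʳ M (subst (_ ∈_) L≡ h))
      (λ u∈ v∈ → na-flat (subst (λ x → _ ∈ flat x) L≡ u∈) (∈-++⁺ˡ v∈))
      (deco-resp-↭ (++-comm L ((r P.e , r P.w) ∷ (r P.e , r P.g) ∷ M)) (deco⊕ Q.Δ P.Δ))
    B = proj₁ blocks
    U : Unique (flat L ++ flat M)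
    U = unique-++ʳ cols (unique-resp-↭ (↭-trans (++-comm (flat L) (cols ++ flat M)) (++⁺ˡ cols (++-comm (flat M) (flat L)))) U₀)
    open Cross {L = L} {M} U using (cross; join-cross)
    length-cross : length cross ≡ length Q.pairs * length P.pairs
    length-cross = trans (length-cartesianProduct L M) (cong₂ _*_ (length-map _ Q.pairs) (length-map _ P.pairs))
    s<′ : s < length cross
    s<′ = subst (s <_) (≡-sym length-cross) s<
    L-cols : ∀ {u} → u ∈ flat L → u ∉ cols
    L-cols h k = unique-disjoint U₀ h (∈-++⁺ˡ k)
    M-cols : ∀ {u} → u ∈ flat M → u ∉ cols
    M-cols h k = unique-disjoint {xs = cols} (unique-++ʳ (flat L) U₀) k h
    R,linked = join-cross s (λ h → there (there (∈-++⁺ʳ M h))) (λ h → there (there (∈-++⁺ˡ h)))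
      (λ P∈ Q∈ u∈ v∈ → proj₂ blocks (na-flat (∈-flat P∈ u∈) (∈-++⁺ʳ cols (∈-flat Q∈ v∈)))
        (L-cols (∈-flat P∈ u∈)) (M-cols (∈-flat Q∈ v∈)))
      (Grown.Δ B)
    R = proj₁ R,linked
    connected′ : Connected (Grown.graph R)
    connected′ with (A , B′) , h , h′ ← drop-cons s cross s<′
      with A∈ , B∈ ← ∈-cartesianProduct⁻ L M h′
      with a , _ , refl ← ∈-map⁻ (mapPair l) A∈ | b , _ , refl ← ∈-map⁻ (mapPair r) B∈ =
      connected⊕ {κ = κ} {κ′} Q.connected P.connected (λ x → Grown.extends R (Grown.extends B x)) (All.lookup (proj₂ R,linked) h)
    length-unpair : ∀ {m} (bs : List (Pair m × Pair m)) → length (unpair bs) ≡ 2 * length bs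
    length-unpair []       = refl
    length-unpair (_ ∷ bs) = trans (cong (λ x → 2 + x) (length-unpair bs)) (≡-sym (*-suc 2 (length bs)))
    size′ : edgeCount (Grown.graph R) + (t + t′ + 4 * s) ≡ tri (k + n)
    size′ = begin
      edgeCount (Grown.graph R) + (t + t′ + 4 * s)
        ≡⟨ cong (_+ (t + t′ + 4 * s)) (trans (Grown.edges R) (cong (λ x → 4 * len + x) (trans (Grown.edges B)
             (cong₂ _+_ (cong (12 *_) (length-map _ bs)) (edgeCount-⊕ Q.graph P.graph))))) ⟩
      4 * len + (12 * length bs + (edgeCount Q.graph + edgeCount P.graph)) + (t + t′ + 4 * s)
        ≡⟨ solve 7 (λ c d a b t t′ s → con 4 :* c :+ (con 12 :* d :+ (a :+ b)) :+ (t :+ t′ :+ con 4 :* s)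
                                  := (a :+ t) :+ (b :+ t′) :+ (con 6 :* (con 2 :* d) :+ con 4 :* (c :+ s))) refl
             len (length bs) (edgeCount Q.graph) (edgeCount P.graph) t t′ s ⟩
      (edgeCount Q.graph + t) + (edgeCount P.graph + t′) + (6 * (2 * length bs) + 4 * (len + s))
        ≡⟨ cong₂ _+_ (cong₂ _+_ Q.size P.size) (cong₂ (λ x y → 6 * x + 4 * y)
             (trans (≡-sym (length-unpair bs)) (cong length (≡-sym qs≡)))
             (trans (length-drop-+ s cross (<⇒≤ s<′)) length-cross)) ⟩
      tri k + tri n + (6 * length Q.pairs + 4 * (length Q.pairs * length P.pairs))
        ≡⟨ cong (λ x → tri k + tri n + x) (solve 2 (λ a b → con 6 :* a :+ con 4 :* (a :* b) := (con 2 :* a) :* (con 3 :+ con 2 :* b)) refl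
             (length Q.pairs) (length P.pairs)) ⟩
      tri k + tri n + (2 * length Q.pairs) * (3 + 2 * length P.pairs)
        ≡⟨ cong (λ x → tri k + tri n + x) (cong₂ _*_ (trans (≡-sym (length-flat Q.pairs)) Q.total)
             (trans (cong (λ x → 3 + x) (≡-sym (length-flat P.pairs))) P.total)) ⟩
      tri k + tri n + k * n
        ≡⟨ tri-+ k n ⟨
      tri (k + n) ∎
      where
      open ≡-Reasoning
      open +-*-Solver
      len = length (drop s cross)

-- Verification of explicit embeddings by computation.

∀ᵇ : (Fin n → Bool) → Bool
∀ᵇ {zero}  p = true
∀ᵇ {suc n} p = p zero ∧ ∀ᵇ (p ∘ suc)

∀ᵇ-sound : {p : Fin n → Bool} → ∀ᵇ p ≡ true → ∀ i → p i ≡ true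
∀ᵇ-sound {p = p} h zero    = proj₁ (∧-elim (p zero) _ h)
∀ᵇ-sound {p = p} h (suc i) = ∀ᵇ-sound (proj₂ (∧-elim (p zero) _ h)) i

infixr 4 _⇒ᵇ_
_⇒ᵇ_ : Bool → Bool → Bool
x ⇒ᵇ y = if x then y else true

⇒ᵇ-sound : ∀ {x y} → (x ⇒ᵇ y) ≡ true → x ≡ true → y ≡ true
⇒ᵇ-sound {true} h _ = h

allᵇ : (A → Bool) → List A → Bool
allᵇ p []       = true
allᵇ p (x ∷ xs) = p x ∧ allᵇ p xs

allᵇ-sound : {p : A → Bool} (xs : List A) → allᵇ p xs ≡ true → ∀ {x} → x ∈ xs → p x ≡ true
allᵇ-sound {p = p} (x ∷ xs) h (here refl) = proj₁ (∧-elim (p x) _ h)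
allᵇ-sound {p = p} (x ∷ xs) h (there i)   = allᵇ-sound xs (proj₂ (∧-elim (p x) _ h)) i

not-elim : ∀ {x} → not x ≡ true → x ≡ false
not-elim {false} _ = refl

not-elim′ : ∀ {x} → not x ≡ false → x ≡ true
not-elim′ {true} _ = refl

uniqueᵇ : (A → A → Bool) → List A → Bool
uniqueᵇ eq []       = true
uniqueᵇ eq (x ∷ xs) = allᵇ (λ y → not (eq x y)) xs ∧ uniqueᵇ eq xs

uniqueᵇ-sound : (eq : A → A → Bool) → (∀ x → eq x x ≡ true) → ∀ xs → uniqueᵇ eq xs ≡ true → Unique xs
uniqueᵇ-sound eq r []       h = []
uniqueᵇ-sound eq r (x ∷ xs) h = let a , b = ∧-elim _ _ h in
  All.tabulate (λ { i refl → true≢false (trans (≡-sym (r x)) (not-elim (allᵇ-sound xs a i))) }) ∷ uniqueᵇ-sound eq r xs b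

≢-sound : {u v : Fin n} → not (u == v) ≡ true → u ≢ v
≢-sound {u = u} h refl = true≢false (trans (≡-sym (==-refl u)) (not-elim h))

sameState : State n → State n → Bool
sameState (u , v , ε) (u′ , v′ , ε′) = (u == u′) ∧ (v == v′) ∧ not (ε xor ε′)

sameState-refl : (s : State n) → sameState s s ≡ true
sameState-refl (u , v , true)  rewrite ==-refl u | ==-refl v = refl
sameState-refl (u , v , false) rewrite ==-refl u | ==-refl v = refl

sameState-sound : (s t : State n) → sameState s t ≡ true → s ≡ t
sameState-sound (u , v , ε) (u′ , v′ , ε′) h =
  let a , h′ = ∧-elim (u == u′) _ h ; b , c = ∧-elim (v == v′) _ h′ in
  cong₂ _,_ (==-sound a) (cong₂ _,_ (==-sound b) (lem ε ε′ c))
  where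
  lem : ∀ x y → not (x xor y) ≡ true → x ≡ y
  lem true  true  _ = refl
  lem false false _ = refl

reaches : (Fin n → Fin n) → ℕ → Fin n → Fin n → Bool
reaches f zero    u w = u == w
reaches f (suc k) u w = (u == w) ∨ reaches f k (f u) w

iter-shift : (f : A → A) (k : ℕ) (x : A) → iter f k (f x) ≡ f (iter f k x)
iter-shift f zero    x = refl
iter-shift f (suc k) x = cong f (iter-shift f k x)

reaches-sound : (f : Fin n → Fin n) (k : ℕ) (u w : Fin n) → reaches f k u w ≡ true → ∃ λ j → iter f j u ≡ w
reaches-sound f zero    u w h = 0 , ==-sound h
reaches-sound f (suc k) u w h = case ∨-elim (u == w) _ h of λ where
  (inj₁ e) → 0 , ==-sound e
  (inj₂ e) → let j , e′ = reaches-sound f k (f u) w e in suc j , trans (≡-sym (iter-shift f j u)) e′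

goodᵇ : (State n → State n) → State n → Bool
goodᵇ f s₀ = go (f s₀)
  where
  go₄ : State _ → State _ → State _ → Bool
  go₄ s₁ s₂ s₃ = sameState (f s₃) s₀
    ∧ not (vtx s₀ == vtx s₁) ∧ not (vtx s₀ == vtx s₂) ∧ not (vtx s₀ == vtx s₃)
    ∧ not (vtx s₁ == vtx s₂) ∧ not (vtx s₁ == vtx s₃) ∧ not (vtx s₂ == vtx s₃)
  go₃ : State _ → State _ → Bool
  go₃ s₁ s₂ = go₄ s₁ s₂ (f s₂)
  go : State _ → Bool
  go s₁ = go₃ s₁ (f s₁)

goodᵇ-sound : (f : State n → State n) (s : State n) → goodᵇ f s ≡ true → Good f s
goodᵇ-sound f s h =
  let a , h₁ = ∧-elim _ _ h ; b , h₂ = ∧-elim _ _ h₁ ; c , h₃ = ∧-elim _ _ h₂ ; d , h₄ = ∧-elim _ _ h₃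
      p , h₅ = ∧-elim _ _ h₄ ; q , r = ∧-elim _ _ h₅ in
  sameState-sound _ _ a , ≢-sound b , ≢-sound c , ≢-sound d , ≢-sound p , ≢-sound q , ≢-sound r

first : {m : ℕ} → (Fin m → Fin n) → (Fin n → Bool) → Fin n → Fin n
first {m = zero}  g p d = d
first {m = suc m} g p d = if p (g zero) then g zero else first (g ∘ suc) p d

-- Row v of the table lists ρ v, with the dummy value v at the non-neighbours of v.
module Table (T : Vec (Vec (Fin n) n) n) (sg : Fin n → Fin n → Bool) where

  r s : Fin n → Fin n → Fin n
  r v u = lookup (lookup T v) u
  s v w = first id (λ u → r v u == w) w

  a : Fin n → Fin n → Bool
  a v u = not (r v u == v)

  _≡ᵇ_ : Bool → Bool → Bool
  x ≡ᵇ y = not (x xor y)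

  ≡ᵇ-sound : ∀ {x y} → (x ≡ᵇ y) ≡ true → x ≡ y
  ≡ᵇ-sound {true}  {true}  _ = refl
  ≡ᵇ-sound {false} {false} _ = refl

  rotationᵇ : Fin n → Fin n → Bool
  rotationᵇ v u = a v u ⇒ᵇ
    a v (r v u) ∧ a v (s v u) ∧ (s v (r v u) == u) ∧ (r v (s v u) == u) ∧
    ∀ᵇ (λ w → a v w ⇒ᵇ reaches (r v) n u w)

  -- Tests for a common neighbour instead of a path of any length: all tabulated graphs have
  -- diameter at most two.
  connectedᵇ : Fin n → Fin n → Bool
  connectedᵇ v u = (v == u) ∨ a v u ∨ not (∀ᵇ (λ w → not (a v w ∧ a w u)))

  graphᵇ : Bool
  graphᵇ = ∀ᵇ λ v → not (a v v) ∧ (∀ᵇ λ u → (a v u ≡ᵇ a u v) ∧ (sg v u ≡ᵇ sg u v) ∧ rotationᵇ v u ∧ connectedᵇ v u)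

  module Checked (ok : graphᵇ ≡ true) where

    private
      ok-v : ∀ v → (not (a v v) ∧ _) ≡ true
      ok-v = ∀ᵇ-sound ok
      ok-vu : ∀ v u → ((a v u ≡ᵇ a u v) ∧ (sg v u ≡ᵇ sg u v) ∧ rotationᵇ v u ∧ connectedᵇ v u) ≡ true
      ok-vu v = ∀ᵇ-sound (proj₂ (∧-elim (not (a v v)) _ (ok-v v)))

    graph : SimpleGraph n
    adj    graph = a
    sym    graph v u = ≡ᵇ-sound (proj₁ (∧-elim (a v u ≡ᵇ a u v) _ (ok-vu v u)))
    irrefl graph v = not-elim (proj₁ (∧-elim (not (a v v)) _ (ok-v v)))

    private
      ok-sig : ∀ v u → sg v u ≡ sg u v
      ok-sig v u = ≡ᵇ-sound (proj₁ (∧-elim (sg v u ≡ᵇ sg u v) _ (proj₂ (∧-elim (a v u ≡ᵇ a u v) _ (ok-vu v u)))))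

      ok-rot : ∀ v u → a v u ≡ true → _
      ok-rot v u = ⇒ᵇ-sound (proj₁ (∧-elim (rotationᵇ v u) _
        (proj₂ (∧-elim (sg v u ≡ᵇ sg u v) _ (proj₂ (∧-elim (a v u ≡ᵇ a u v) _ (ok-vu v u)))))))

      ok-conn : ∀ v u → connectedᵇ v u ≡ true
      ok-conn v u = proj₂ (∧-elim (rotationᵇ v u) _
        (proj₂ (∧-elim (sg v u ≡ᵇ sg u v) _ (proj₂ (∧-elim (a v u ≡ᵇ a u v) _ (ok-vu v u))))))

    rot : ∀ v → IsRotation (a v) (r v) (s v)
    rot v = record
      { f-nbr = λ u h → proj₁ (∧-elim (a v (r v u)) _ (ok-rot v u h))
      ; g-nbr = λ u h → proj₁ (∧-elim (a v (s v u)) _ (p₁ u h))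
      ; gf    = λ u h → ==-sound (proj₁ (∧-elim (s v (r v u) == u) _ (p₂ u h)))
      ; fg    = λ u h → ==-sound (proj₁ (∧-elim (r v (s v u) == u) _ (p₃ u h)))
      ; orbit = λ u w h k → reaches-sound (r v) n u w
          (⇒ᵇ-sound (∀ᵇ-sound {p = λ w → a v w ⇒ᵇ reaches (r v) n u w} (p₄ u h) w) k)
      }
      where
      p₁ : ∀ u → a v u ≡ true → _
      p₁ u h = proj₂ (∧-elim (a v (r v u)) _ (ok-rot v u h))
      p₂ : ∀ u → a v u ≡ true → _
      p₂ u h = proj₂ (∧-elim (a v (s v u)) _ (p₁ u h))
      p₃ : ∀ u → a v u ≡ true → _
      p₃ u h = proj₂ (∧-elim (s v (r v u) == u) _ (p₂ u h))
      p₄ : ∀ u → a v u ≡ true → _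
      p₄ u h = proj₂ (∧-elim (r v (s v u) == u) _ (p₃ u h))

    embedding : Embedding graph
    embedding = mkEmbedding r s sg rot ok-sig

    ∀ᵇ-false : ∀ {m} (p : Fin m → Bool) → ∀ᵇ p ≡ false → ∃ λ i → p i ≡ false
    ∀ᵇ-false {suc m} p h with p zero in e
    ... | false = zero , e
    ... | true  = let i , k = ∀ᵇ-false (p ∘ suc) h in suc i , k

    connected : Connected graph
    connected v u = case ∨-elim (v == u) _ (ok-conn v u) of λ where
      (inj₁ e) → subst (Reach graph v) (==-sound e) here
      (inj₂ h) → case ∨-elim (a v u) _ h of λ where
        (inj₁ e) → step e here
        (inj₂ e) → let w , k = ∀ᵇ-false _ (not-elim e)
                       p , q = ∧-elim (a v w) (a w u) (not-elim′ k) in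
          step p (step q here)
    F : State n → State n
    F = faceStep embedding

    goodAllᵇ : Bool
    goodAllᵇ = ∀ᵇ λ v → ∀ᵇ λ u → a v u ⇒ᵇ goodᵇ F (v , u , true) ∧ goodᵇ F (v , u , false)

    goodAll-sound : goodAllᵇ ≡ true → ∀ s → valid graph s → Good F s
    goodAll-sound h (v , u , ε) k = go ε
      where
      both : (goodᵇ F (v , u , true) ∧ goodᵇ F (v , u , false)) ≡ true
      both = ⇒ᵇ-sound (∀ᵇ-sound {p = λ u → a v u ⇒ᵇ goodᵇ F (v , u , true) ∧ goodᵇ F (v , u , false)} (∀ᵇ-sound h v) u) k
      go : ∀ ε → Good F (v , u , ε)
      go true  = goodᵇ-sound F _ (proj₁ (∧-elim _ _ both))
      go false = goodᵇ-sound F _ (proj₂ (∧-elim (goodᵇ F (v , u , true)) _ both))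

    quadrangular : goodAllᵇ ≡ true → Quadrangular embedding
    quadrangular h u v ε = goodAll-sound h (u , v , ε)

    closedᵇ : Face n → Bool
    closedᵇ (face e f g h γ δ) =
      sameState (F (e , f , true)) (f , g , γ) ∧ sameState (F (f , g , γ)) (g , h , true) ∧
      sameState (F (g , h , true)) (h , e , δ) ∧ sameState (F (h , e , δ)) (e , f , true) ∧ not (f == h)

    decoratedᵇ : List (Face n) → Bool
    decoratedᵇ Fs = goodAllᵇ ∧ allᵇ closedᵇ Fs ∧ allᵇ (λ (u , v , _) → a u v) L ∧ uniqueᵇ sameState L ∧
        allᵇ (λ x → allᵇ (λ y → not (sameState x (rev embedding y))) L) L
      where
      L = concat (map walk Fs)

    -- Every face of a checked table is a quadrilateral already; the walks in L are listed as
    -- reservations. That they are distinct faces is `uniqueᵇ` together with the test that no listed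
    -- state is the reversal of another.
    decorated : (κ : Kind) → HasKind κ embedding → (Fs : List (Face n)) → decoratedᵇ Fs ≡ true →
      Deco graph κ (map ends Fs)
    decorated κ hk Fs h = deco Fs refl (All.map (λ {F} → proper F) cl) record
      { emb = embedding ; kind = hk
      ; sys = mkSys record
          { valid-L = λ i → allᵇ-sound L h₃ i
          ; unique  = uniqueᵇ-sound sameState sameState-refl L h₄
          ; one-way = λ {x} {y} i j e → true≢false (trans
              (≡-sym (subst (λ z → sameState x z ≡ true) e (sameState-refl x)))
              (not-elim (allᵇ-sound L (allᵇ-sound {p = λ x → allᵇ (λ y → not (sameState x (rev embedding y))) L} L h₅ i) j)))
          ; good    = λ s v → inj₂ (inj₂ (goodAll-sound h₁ s v))
          } (All.map⁺ (All.map (λ {F} → closed F) cl))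
      }
      where
      L = concat (map walk Fs)
      p₁ = ∧-elim goodAllᵇ _ h
      p₂ = ∧-elim (allᵇ closedᵇ Fs) _ (proj₂ p₁)
      p₃ = ∧-elim (allᵇ (λ (u , v , _) → a u v) L) _ (proj₂ p₂)
      p₄ = ∧-elim (uniqueᵇ sameState L) _ (proj₂ p₃)
      h₁ = proj₁ p₁
      h₃ = proj₁ p₃
      h₄ = proj₁ p₄
      h₅ = proj₂ p₄
      cl : All (λ W → closedᵇ W ≡ true) Fs
      cl = All.tabulate (allᵇ-sound Fs (proj₁ p₂))
      proper : ∀ W → closedᵇ W ≡ true → ProperMid W
      proper (face e f g h γ δ) c = ≢-sound (proj₂ (∧-elim (sameState (F (h , e , δ)) (e , f , true)) _
        (proj₂ (∧-elim (sameState (F (g , h , true)) (h , e , δ)) _ (proj₂ (∧-elim (sameState (F (f , g , γ)) (g , h , true)) _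
          (proj₂ (∧-elim (sameState (F (e , f , true)) (f , g , γ)) _ c))))))))
      closed : ∀ W → closedᵇ W ≡ true → Closed F (walk W)
      closed (face e f g h γ δ) c =
        let a₁ , c₁ = ∧-elim (sameState (F (e , f , true)) (f , g , γ)) _ c
            a₂ , c₂ = ∧-elim (sameState (F (f , g , γ)) (g , h , true)) _ c₁
            a₃ , c₃ = ∧-elim (sameState (F (g , h , true)) (h , e , δ)) _ c₂
            a₄ , _  = ∧-elim (sameState (F (h , e , δ)) (e , f , true)) _ c₃ in
        (e , f , true) , sameState-sound _ _ a₁ ◂ sameState-sound _ _ a₂ ◂ sameState-sound _ _ a₃ ◂ sameState-sound _ _ a₄ ◂ []

    -- A closed walk through an odd number of twisted edges.
    oddᵇ : Fin n → Fin n → List (Fin n) → Bool → Bool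
    oddᵇ x u []       b = (u == x) ∧ b
    oddᵇ x u (v ∷ vs) b = a u v ∧ oddᵇ x v vs (b xor sg u v)

    -- Under a balancing f the twists along a walk from x to u telescope to `f x xor f u`, which is
    -- `false` on a closed walk.
    nonorientable : ∀ x vs → oddᵇ x x vs false ≡ true → ¬ Orientable embedding
    nonorientable x vs h (f , bal) = go x vs false h (≡-sym (xor-same (f x)))
      where
      xor-same : ∀ b → b xor b ≡ false
      xor-same true  = refl
      xor-same false = refl
      xor-trans : ∀ a b c → (a xor b) xor (b xor c) ≡ a xor c
      xor-trans true  true  true  = refl
      xor-trans true  true  false = refl
      xor-trans true  false true  = refl
      xor-trans true  false false = refl
      xor-trans false true  true  = refl
      xor-trans false true  false = refl
      xor-trans false false true  = refl
      xor-trans false false false = refl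
      go : ∀ u vs b → oddᵇ x u vs b ≡ true → b ≢ f x xor f u
      go u [] b h e = let p , q = ∧-elim (u == x) b h in
        true≢false (trans (≡-sym q) (trans e (trans (cong (λ y → f x xor f y) (==-sound p)) (xor-same (f x)))))
      go u (v ∷ vs) b h e = let p , q = ∧-elim (a u v) _ h in
        go v vs _ q (trans (cong₂ _xor_ e (bal u v p)) (xor-trans (f x) (f u) (f v)))

untwisted : Fin n → Fin n → Bool
untwisted _ _ = false

twistedAt : List (Pair n) → Fin n → Fin n → Bool
twistedAt []             u v = false
twistedAt ((a , b) ∷ es) u v = ((u == a) ∧ (v == b)) ∨ ((u == b) ∧ (v == a)) ∨ twistedAt es u v

module _ {n : ℕ} (T : Vec (Vec (Fin n) n) n) where
  open Table T

  even-map : (sg : Fin n → Fin n → Bool) (Fs : List (Face n)) (t : ℕ) (κ : Kind)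
    (ok : graphᵇ sg ≡ true) → HasKind κ (Checked.embedding sg ok) → Checked.decoratedᵇ sg ok Fs ≡ true →
    uniqueᵇ _==_ (flat (map ends Fs)) ≡ true → length (flat (map ends Fs)) ≡ n →
    edgeCount (Checked.graph sg ok) + t ≡ tri n → EvenMap n t κ
  even-map sg Fs t κ ok hk dec un len size = record
    { graph = Checked.graph sg ok ; connected = Checked.connected sg ok ; pairs = map ends Fs
    ; unique = uniqueᵇ-sound _==_ ==-refl _ un ; total = len ; size = size ; Δ = Checked.decorated sg ok κ hk Fs dec }

  ori-even : (Fs : List (Face n)) (t : ℕ) (ok : graphᵇ untwisted ≡ true) →
    Checked.decoratedᵇ untwisted ok Fs ≡ true →
    uniqueᵇ _==_ (flat (map ends Fs)) ≡ true → length (flat (map ends Fs)) ≡ n →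
    edgeCount (Checked.graph untwisted ok) + t ≡ tri n → EvenMap n t ori
  ori-even Fs t ok = even-map untwisted Fs t ori ok (λ _ _ → refl)

  non-even : (M : List (Pair n)) (Fs : List (Face n)) (t : ℕ) (x : Fin n) (vs : List (Fin n))
    (ok : graphᵇ (twistedAt M) ≡ true) → Checked.oddᵇ (twistedAt M) ok x x vs false ≡ true →
    Checked.decoratedᵇ (twistedAt M) ok Fs ≡ true →
    uniqueᵇ _==_ (flat (map ends Fs)) ≡ true → length (flat (map ends Fs)) ≡ n →
    edgeCount (Checked.graph (twistedAt M) ok) + t ≡ tri n → EvenMap n t non
  non-even M Fs t x vs ok odd = even-map (twistedAt M) Fs t non ok (Checked.nonorientable (twistedAt M) ok x vs odd)

  odd-map : (sg : Fin n → Fin n → Bool) (e w g f₁ h₁ f₂ h₂ : Fin n) (γ₁ δ₁ γ₂ δ₂ : Bool) (Fs : List (Face n)) (t : ℕ) (κ : Kind)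
    (ok : graphᵇ sg ≡ true) → HasKind κ (Checked.embedding sg ok) →
    Checked.decoratedᵇ sg ok (face e f₁ w h₁ γ₁ δ₁ ∷ face e f₂ g h₂ γ₂ δ₂ ∷ Fs) ≡ true →
    uniqueᵇ _==_ (e ∷ w ∷ g ∷ flat (map ends Fs)) ≡ true → length (e ∷ w ∷ g ∷ flat (map ends Fs)) ≡ n →
    edgeCount (Checked.graph sg ok) + t ≡ tri n → OddMap n t κ
  odd-map sg e w g f₁ h₁ f₂ h₂ γ₁ δ₁ γ₂ δ₂ Fs t κ ok hk dec un len size = record
    { graph = Checked.graph sg ok ; connected = Checked.connected sg ok ; e = e ; w = w ; g = g ; pairs = map ends Fs
    ; unique = uniqueᵇ-sound _==_ ==-refl _ un ; total = len ; size = size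
    ; Δ = Checked.decorated sg ok κ hk (face e f₁ w h₁ γ₁ δ₁ ∷ face e f₂ g h₂ γ₂ δ₂ ∷ Fs) dec }

  ori-odd : (e w g f₁ h₁ f₂ h₂ : Fin n) (γ₁ δ₁ γ₂ δ₂ : Bool) (Fs : List (Face n)) (t : ℕ)
    (ok : graphᵇ untwisted ≡ true) →
    Checked.decoratedᵇ untwisted ok (face e f₁ w h₁ γ₁ δ₁ ∷ face e f₂ g h₂ γ₂ δ₂ ∷ Fs) ≡ true →
    uniqueᵇ _==_ (e ∷ w ∷ g ∷ flat (map ends Fs)) ≡ true → length (e ∷ w ∷ g ∷ flat (map ends Fs)) ≡ n →
    edgeCount (Checked.graph untwisted ok) + t ≡ tri n → OddMap n t ori
  ori-odd e w g f₁ h₁ f₂ h₂ γ₁ δ₁ γ₂ δ₂ Fs t ok =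
    odd-map untwisted e w g f₁ h₁ f₂ h₂ γ₁ δ₁ γ₂ δ₂ Fs t ori ok (λ _ _ → refl)

  non-odd : (M : List (Pair n)) (e w g f₁ h₁ f₂ h₂ : Fin n) (γ₁ δ₁ γ₂ δ₂ : Bool) (Fs : List (Face n)) (t : ℕ)
    (x : Fin n) (vs : List (Fin n))
    (ok : graphᵇ (twistedAt M) ≡ true) → Checked.oddᵇ (twistedAt M) ok x x vs false ≡ true →
    Checked.decoratedᵇ (twistedAt M) ok (face e f₁ w h₁ γ₁ δ₁ ∷ face e f₂ g h₂ γ₂ δ₂ ∷ Fs) ≡ true →
    uniqueᵇ _==_ (e ∷ w ∷ g ∷ flat (map ends Fs)) ≡ true → length (e ∷ w ∷ g ∷ flat (map ends Fs)) ≡ n →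
    edgeCount (Checked.graph (twistedAt M) ok) + t ≡ tri n → OddMap n t non
  non-odd M e w g f₁ h₁ f₂ h₂ γ₁ δ₁ γ₂ δ₂ Fs t x vs ok odd =
    odd-map (twistedAt M) e w g f₁ h₁ f₂ h₂ γ₁ δ₁ γ₂ δ₂ Fs t non ok (Checked.nonorientable (twistedAt M) ok x vs odd)

-- The explicit embeddings.

pattern 10F = suc 9F
pattern 11F = suc 10F

-- The 4-cycle on the sphere, 4 - 4 + 2 = 2: one face is reserved for each of its two diagonals.
ori-4-2 : EvenMap 4 2 ori
ori-4-2 = ori-even
   ((0F ∷ 3F ∷ 0F ∷ 1F ∷ []) ∷
    (2F ∷ 1F ∷ 0F ∷ 1F ∷ []) ∷
    (2F ∷ 3F ∷ 2F ∷ 1F ∷ []) ∷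
    (2F ∷ 3F ∷ 0F ∷ 3F ∷ []) ∷ [])
  (face 0F 1F 2F 3F true true ∷
   face 1F 0F 3F 2F true true ∷ [])
  2 refl refl refl refl refl

-- K₅ on the torus, 5 - 10 + 5 = 0. With e = 1F, w = 0F, g = 2F there remains the single ordinary
-- pair of 3F and 4F.
ori-5-0 : OddMap 5 0 ori
ori-5-0 = ori-odd
   ((0F ∷ 4F ∷ 1F ∷ 2F ∷ 3F ∷ []) ∷
    (4F ∷ 1F ∷ 3F ∷ 0F ∷ 2F ∷ []) ∷
    (1F ∷ 3F ∷ 2F ∷ 4F ∷ 0F ∷ []) ∷
    (2F ∷ 0F ∷ 4F ∷ 3F ∷ 1F ∷ []) ∷
    (3F ∷ 2F ∷ 0F ∷ 1F ∷ 4F ∷ []) ∷ [])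
  1F 0F 2F 3F 2F 4F 0F true true true true
  (face 3F 2F 4F 0F true true ∷ [])
  0 refl refl refl refl refl

ori-6-3 : EvenMap 6 3 ori
ori-6-3 = ori-even
   ((0F ∷ 4F ∷ 3F ∷ 1F ∷ 2F ∷ 0F ∷ []) ∷
    (2F ∷ 1F ∷ 4F ∷ 0F ∷ 3F ∷ 1F ∷ []) ∷
    (5F ∷ 3F ∷ 2F ∷ 4F ∷ 0F ∷ 1F ∷ []) ∷
    (4F ∷ 2F ∷ 0F ∷ 3F ∷ 1F ∷ 3F ∷ []) ∷
    (3F ∷ 5F ∷ 1F ∷ 2F ∷ 4F ∷ 0F ∷ []) ∷
    (5F ∷ 5F ∷ 4F ∷ 5F ∷ 2F ∷ 5F ∷ []) ∷ [])
  (face 0F 1F 2F 3F true true ∷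
   face 1F 4F 5F 2F true true ∷
   face 3F 2F 4F 1F true true ∷ [])
  3 refl refl refl refl refl

ori-7-3 : OddMap 7 3 ori
ori-7-3 = ori-odd
   ((0F ∷ 6F ∷ 1F ∷ 2F ∷ 0F ∷ 0F ∷ 3F ∷ []) ∷
    (5F ∷ 1F ∷ 3F ∷ 0F ∷ 6F ∷ 4F ∷ 2F ∷ []) ∷
    (1F ∷ 3F ∷ 2F ∷ 4F ∷ 5F ∷ 0F ∷ 2F ∷ []) ∷
    (4F ∷ 0F ∷ 6F ∷ 3F ∷ 5F ∷ 2F ∷ 1F ∷ []) ∷
    (4F ∷ 3F ∷ 5F ∷ 6F ∷ 4F ∷ 1F ∷ 2F ∷ []) ∷
    (5F ∷ 2F ∷ 6F ∷ 1F ∷ 3F ∷ 5F ∷ 4F ∷ []) ∷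
    (3F ∷ 5F ∷ 6F ∷ 1F ∷ 0F ∷ 4F ∷ 6F ∷ []) ∷ [])
  1F 0F 2F 3F 2F 5F 0F true true true true
  (face 3F 4F 6F 0F true true ∷
   face 4F 3F 5F 1F true true ∷ [])
  3 refl refl refl refl refl

ori-8-0 : EvenMap 8 0 ori
ori-8-0 = ori-even
   ((0F ∷ 7F ∷ 4F ∷ 5F ∷ 6F ∷ 2F ∷ 1F ∷ 3F ∷ []) ∷
    (2F ∷ 1F ∷ 5F ∷ 7F ∷ 6F ∷ 3F ∷ 0F ∷ 4F ∷ []) ∷
    (1F ∷ 6F ∷ 2F ∷ 0F ∷ 5F ∷ 7F ∷ 4F ∷ 3F ∷ []) ∷
    (5F ∷ 7F ∷ 1F ∷ 3F ∷ 2F ∷ 4F ∷ 0F ∷ 6F ∷ []) ∷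
    (3F ∷ 6F ∷ 1F ∷ 2F ∷ 4F ∷ 0F ∷ 7F ∷ 5F ∷ []) ∷
    (6F ∷ 0F ∷ 3F ∷ 7F ∷ 2F ∷ 5F ∷ 4F ∷ 1F ∷ []) ∷
    (5F ∷ 2F ∷ 0F ∷ 4F ∷ 7F ∷ 3F ∷ 6F ∷ 1F ∷ []) ∷
    (6F ∷ 2F ∷ 4F ∷ 5F ∷ 3F ∷ 0F ∷ 1F ∷ 7F ∷ []) ∷ [])
  (face 0F 2F 1F 5F true true ∷
   face 2F 5F 3F 4F true true ∷
   face 4F 0F 6F 5F true true ∷
   face 5F 2F 7F 4F true true ∷ [])
  0 refl refl refl refl refl

ori-10-1 : EvenMap 10 1 ori
ori-10-1 = ori-even
   ((0F ∷ 3F ∷ 6F ∷ 8F ∷ 7F ∷ 9F ∷ 5F ∷ 1F ∷ 2F ∷ 4F ∷ []) ∷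
    (9F ∷ 1F ∷ 7F ∷ 8F ∷ 5F ∷ 3F ∷ 2F ∷ 4F ∷ 0F ∷ 6F ∷ []) ∷
    (5F ∷ 8F ∷ 2F ∷ 6F ∷ 1F ∷ 4F ∷ 7F ∷ 9F ∷ 3F ∷ 0F ∷ []) ∷
    (8F ∷ 9F ∷ 1F ∷ 3F ∷ 2F ∷ 6F ∷ 7F ∷ 0F ∷ 4F ∷ 5F ∷ []) ∷
    (8F ∷ 0F ∷ 1F ∷ 9F ∷ 4F ∷ 6F ∷ 3F ∷ 2F ∷ 5F ∷ 7F ∷ []) ∷
    (4F ∷ 2F ∷ 8F ∷ 0F ∷ 7F ∷ 5F ∷ 9F ∷ 6F ∷ 3F ∷ 1F ∷ []) ∷
    (9F ∷ 5F ∷ 4F ∷ 8F ∷ 0F ∷ 2F ∷ 6F ∷ 6F ∷ 1F ∷ 3F ∷ []) ∷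
    (1F ∷ 4F ∷ 5F ∷ 9F ∷ 2F ∷ 8F ∷ 7F ∷ 7F ∷ 3F ∷ 0F ∷ []) ∷
    (7F ∷ 2F ∷ 6F ∷ 1F ∷ 9F ∷ 0F ∷ 5F ∷ 4F ∷ 8F ∷ 3F ∷ []) ∷
    (3F ∷ 7F ∷ 4F ∷ 5F ∷ 8F ∷ 1F ∷ 2F ∷ 6F ∷ 0F ∷ 9F ∷ []) ∷ [])
  (face 0F 7F 1F 4F true true ∷
   face 2F 6F 4F 3F true true ∷
   face 3F 6F 8F 5F true true ∷
   face 5F 4F 6F 0F true true ∷
   face 7F 2F 9F 4F true true ∷ [])
  1 refl refl refl refl refl

ori-11-1 : OddMap 11 1 ori
ori-11-1 = ori-odd
   ((0F ∷ 6F ∷ 7F ∷ 10F ∷ 1F ∷ 2F ∷ 5F ∷ 3F ∷ 4F ∷ 8F ∷ 9F ∷ []) ∷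
    (2F ∷ 1F ∷ 9F ∷ 6F ∷ 0F ∷ 4F ∷ 10F ∷ 8F ∷ 3F ∷ 7F ∷ 5F ∷ []) ∷
    (6F ∷ 4F ∷ 2F ∷ 9F ∷ 0F ∷ 10F ∷ 7F ∷ 8F ∷ 3F ∷ 5F ∷ 1F ∷ []) ∷
    (10F ∷ 4F ∷ 6F ∷ 3F ∷ 5F ∷ 8F ∷ 9F ∷ 2F ∷ 7F ∷ 0F ∷ 1F ∷ []) ∷
    (5F ∷ 3F ∷ 0F ∷ 8F ∷ 4F ∷ 9F ∷ 1F ∷ 2F ∷ 7F ∷ 6F ∷ 4F ∷ []) ∷
    (9F ∷ 2F ∷ 4F ∷ 1F ∷ 8F ∷ 5F ∷ 0F ∷ 10F ∷ 7F ∷ 3F ∷ 6F ∷ []) ∷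
    (4F ∷ 10F ∷ 5F ∷ 8F ∷ 3F ∷ 1F ∷ 6F ∷ 9F ∷ 2F ∷ 0F ∷ 7F ∷ []) ∷
    (4F ∷ 6F ∷ 8F ∷ 1F ∷ 2F ∷ 10F ∷ 5F ∷ 7F ∷ 9F ∷ 3F ∷ 0F ∷ []) ∷
    (7F ∷ 3F ∷ 4F ∷ 9F ∷ 1F ∷ 0F ∷ 2F ∷ 6F ∷ 8F ∷ 10F ∷ 5F ∷ []) ∷
    (8F ∷ 10F ∷ 7F ∷ 4F ∷ 2F ∷ 6F ∷ 1F ∷ 0F ∷ 5F ∷ 9F ∷ 3F ∷ []) ∷
    (9F ∷ 5F ∷ 1F ∷ 7F ∷ 10F ∷ 6F ∷ 3F ∷ 8F ∷ 0F ∷ 2F ∷ 10F ∷ []) ∷ [])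
  2F 0F 1F 4F 1F 10F 5F true true true true
  (face 3F 9F 4F 6F true true ∷
   face 5F 9F 6F 0F true true ∷
   face 7F 2F 8F 4F true true ∷
   face 9F 8F 10F 0F true true ∷ [])
  1 refl refl refl refl refl

non-5-2 : OddMap 5 2 non
non-5-2 = non-odd
   ((0F ∷ 2F ∷ 4F ∷ 1F ∷ 3F ∷ []) ∷
    (3F ∷ 1F ∷ 0F ∷ 4F ∷ 2F ∷ []) ∷
    (1F ∷ 3F ∷ 2F ∷ 0F ∷ 2F ∷ []) ∷
    (2F ∷ 0F ∷ 1F ∷ 3F ∷ 3F ∷ []) ∷
    (1F ∷ 0F ∷ 4F ∷ 4F ∷ 4F ∷ []) ∷ [])
  ((0F , 1F) ∷ (0F , 2F) ∷ (0F , 3F) ∷ (0F , 4F) ∷ (1F , 2F) ∷ (1F , 3F) ∷ (1F , 4F) ∷ (2F , 3F) ∷ [])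
  1F 0F 2F 2F 4F 3F 0F false false false false
  (face 3F 0F 4F 1F false false ∷ [])
  2 0F (1F ∷ 2F ∷ 0F ∷ []) refl refl refl refl refl refl

non-6-1 : EvenMap 6 1 non
non-6-1 = non-even
   ((0F ∷ 3F ∷ 5F ∷ 2F ∷ 1F ∷ 4F ∷ []) ∷
    (5F ∷ 1F ∷ 3F ∷ 4F ∷ 0F ∷ 2F ∷ []) ∷
    (5F ∷ 0F ∷ 2F ∷ 2F ∷ 1F ∷ 4F ∷ []) ∷
    (4F ∷ 5F ∷ 3F ∷ 3F ∷ 1F ∷ 0F ∷ []) ∷
    (2F ∷ 5F ∷ 3F ∷ 1F ∷ 4F ∷ 0F ∷ []) ∷
    (1F ∷ 4F ∷ 0F ∷ 2F ∷ 3F ∷ 5F ∷ []) ∷ [])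
  ((1F , 3F) ∷ (2F , 4F) ∷ (2F , 5F) ∷ (3F , 5F) ∷ [])
  (face 0F 5F 1F 2F true true ∷
   face 2F 5F 3F 0F false true ∷
   face 4F 2F 5F 0F false true ∷ [])
  1 0F (1F ∷ 3F ∷ 0F ∷ []) refl refl refl refl refl refl

-- Twelve edges bound six quadrilaterals, and 6 - 12 + 6 = 0; a nonorientable surface with this
-- Euler characteristic is the Klein bottle.
non-6-3 : EvenMap 6 3 non
non-6-3 = non-even
   ((0F ∷ 4F ∷ 0F ∷ 5F ∷ 3F ∷ 1F ∷ []) ∷
    (5F ∷ 1F ∷ 1F ∷ 0F ∷ 3F ∷ 4F ∷ []) ∷
    (2F ∷ 2F ∷ 2F ∷ 4F ∷ 5F ∷ 3F ∷ []) ∷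
    (2F ∷ 0F ∷ 5F ∷ 3F ∷ 3F ∷ 1F ∷ []) ∷
    (1F ∷ 2F ∷ 5F ∷ 4F ∷ 4F ∷ 0F ∷ []) ∷
    (3F ∷ 2F ∷ 0F ∷ 4F ∷ 1F ∷ 5F ∷ []) ∷ [])
  ((0F , 1F) ∷ (0F , 3F) ∷ (0F , 4F) ∷ (0F , 5F) ∷ (1F , 5F) ∷ (2F , 3F) ∷ (2F , 5F) ∷ (4F , 5F) ∷ [])
  (face 0F 5F 2F 3F false false ∷
   face 1F 0F 5F 3F false true ∷
   face 3F 0F 4F 1F false true ∷ [])
  3 0F (1F ∷ 5F ∷ 0F ∷ []) refl refl refl refl refl refl

non-7-1 : OddMap 7 1 non
non-7-1 = non-odd
   ((0F ∷ 4F ∷ 1F ∷ 5F ∷ 6F ∷ 2F ∷ 3F ∷ []) ∷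
    (6F ∷ 1F ∷ 5F ∷ 0F ∷ 2F ∷ 3F ∷ 4F ∷ []) ∷
    (1F ∷ 5F ∷ 2F ∷ 4F ∷ 6F ∷ 3F ∷ 0F ∷ []) ∷
    (5F ∷ 4F ∷ 1F ∷ 3F ∷ 6F ∷ 2F ∷ 0F ∷ []) ∷
    (1F ∷ 5F ∷ 3F ∷ 0F ∷ 4F ∷ 2F ∷ 4F ∷ []) ∷
    (1F ∷ 2F ∷ 4F ∷ 6F ∷ 3F ∷ 5F ∷ 0F ∷ []) ∷
    (5F ∷ 0F ∷ 1F ∷ 2F ∷ 6F ∷ 3F ∷ 6F ∷ []) ∷ [])
  ((0F , 4F) ∷ (0F , 5F) ∷ (0F , 6F) ∷ (1F , 3F) ∷ (1F , 4F) ∷ (1F , 5F) ∷ (1F , 6F) ∷ (2F , 4F) ∷ (2F , 6F) ∷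
   (4F , 5F) ∷ (5F , 6F) ∷ [])
  1F 0F 2F 4F 6F 6F 0F false false false true
  (face 3F 1F 5F 2F false true ∷
   face 4F 3F 6F 2F true false ∷ [])
  1 0F (1F ∷ 3F ∷ 0F ∷ []) refl refl refl refl refl refl

non-7-3 : OddMap 7 3 non
non-7-3 = non-odd
   ((0F ∷ 4F ∷ 5F ∷ 1F ∷ 2F ∷ 6F ∷ 3F ∷ []) ∷
    (6F ∷ 1F ∷ 0F ∷ 4F ∷ 5F ∷ 2F ∷ 3F ∷ []) ∷
    (1F ∷ 4F ∷ 2F ∷ 0F ∷ 3F ∷ 2F ∷ 2F ∷ []) ∷
    (6F ∷ 0F ∷ 1F ∷ 3F ∷ 2F ∷ 3F ∷ 4F ∷ []) ∷
    (3F ∷ 2F ∷ 0F ∷ 5F ∷ 4F ∷ 6F ∷ 1F ∷ []) ∷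
    (1F ∷ 6F ∷ 5F ∷ 5F ∷ 0F ∷ 5F ∷ 4F ∷ []) ∷
    (1F ∷ 3F ∷ 6F ∷ 5F ∷ 0F ∷ 4F ∷ 6F ∷ []) ∷ [])
  ((0F , 2F) ∷ (0F , 3F) ∷ (0F , 4F) ∷ (0F , 6F) ∷ (1F , 2F) ∷ (3F , 6F) ∷ (4F , 5F) ∷ [])
  1F 0F 2F 2F 5F 4F 3F false true true true
  (face 3F 0F 6F 1F false true ∷
   face 4F 1F 5F 6F true true ∷ [])
  3 0F (1F ∷ 3F ∷ 0F ∷ []) refl refl refl refl refl refl

non-8-0 : EvenMap 8 0 non
non-8-0 = non-even
   ((0F ∷ 6F ∷ 7F ∷ 5F ∷ 3F ∷ 1F ∷ 2F ∷ 4F ∷ []) ∷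
    (3F ∷ 1F ∷ 0F ∷ 4F ∷ 6F ∷ 2F ∷ 7F ∷ 5F ∷ []) ∷
    (5F ∷ 7F ∷ 2F ∷ 4F ∷ 6F ∷ 3F ∷ 1F ∷ 0F ∷ []) ∷
    (2F ∷ 0F ∷ 6F ∷ 3F ∷ 5F ∷ 1F ∷ 7F ∷ 4F ∷ []) ∷
    (3F ∷ 0F ∷ 5F ∷ 6F ∷ 4F ∷ 7F ∷ 2F ∷ 1F ∷ []) ∷
    (2F ∷ 4F ∷ 7F ∷ 0F ∷ 6F ∷ 5F ∷ 3F ∷ 1F ∷ []) ∷
    (2F ∷ 7F ∷ 5F ∷ 1F ∷ 3F ∷ 4F ∷ 6F ∷ 0F ∷ []) ∷
    (5F ∷ 3F ∷ 6F ∷ 0F ∷ 1F ∷ 2F ∷ 4F ∷ 7F ∷ []) ∷ [])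
  ((0F , 2F) ∷ (0F , 3F) ∷ (1F , 3F) ∷ (2F , 3F) ∷ (2F , 4F) ∷ (2F , 7F) ∷ (3F , 4F) ∷ (3F , 5F) ∷ (3F , 6F) ∷
   (3F , 7F) ∷ (4F , 6F) ∷ (5F , 6F) ∷ (5F , 7F) ∷ [])
  (face 0F 3F 1F 4F false true ∷
   face 2F 7F 5F 1F false true ∷
   face 3F 6F 4F 2F false false ∷
   face 6F 1F 7F 3F true false ∷ [])
  0 0F (1F ∷ 2F ∷ 0F ∷ []) refl refl refl refl refl refl

non-8-2 : EvenMap 8 2 non
non-8-2 = non-even
   ((0F ∷ 7F ∷ 1F ∷ 6F ∷ 2F ∷ 3F ∷ 4F ∷ 5F ∷ []) ∷
    (7F ∷ 1F ∷ 4F ∷ 2F ∷ 6F ∷ 3F ∷ 0F ∷ 5F ∷ []) ∷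
    (5F ∷ 7F ∷ 2F ∷ 4F ∷ 1F ∷ 3F ∷ 2F ∷ 0F ∷ []) ∷
    (5F ∷ 4F ∷ 7F ∷ 3F ∷ 0F ∷ 6F ∷ 2F ∷ 1F ∷ []) ∷
    (1F ∷ 7F ∷ 3F ∷ 5F ∷ 4F ∷ 0F ∷ 4F ∷ 2F ∷ []) ∷
    (4F ∷ 0F ∷ 6F ∷ 7F ∷ 2F ∷ 5F ∷ 3F ∷ 1F ∷ []) ∷
    (1F ∷ 7F ∷ 6F ∷ 5F ∷ 6F ∷ 0F ∷ 6F ∷ 3F ∷ []) ∷
    (1F ∷ 2F ∷ 4F ∷ 5F ∷ 3F ∷ 6F ∷ 0F ∷ 7F ∷ []) ∷ [])
  ((0F , 3F) ∷ (0F , 5F) ∷ (0F , 6F) ∷ (0F , 7F) ∷ (1F , 2F) ∷ (1F , 3F) ∷ (1F , 6F) ∷ (2F , 3F) ∷ (2F , 4F) ∷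
   (2F , 5F) ∷ (3F , 4F) ∷ (3F , 5F) ∷ (3F , 6F) ∷ (3F , 7F) ∷ (4F , 5F) ∷ (4F , 7F) ∷ (5F , 6F) ∷ [])
  (face 0F 4F 1F 6F true false ∷
   face 2F 5F 4F 0F false true ∷
   face 3F 5F 6F 0F false false ∷
   face 5F 0F 7F 1F false true ∷ [])
  2 0F (1F ∷ 2F ∷ 0F ∷ []) refl refl refl refl refl refl

non-8-4 : EvenMap 8 4 non
non-8-4 = non-even
   ((0F ∷ 6F ∷ 3F ∷ 4F ∷ 1F ∷ 2F ∷ 7F ∷ 5F ∷ []) ∷
    (7F ∷ 1F ∷ 5F ∷ 2F ∷ 3F ∷ 0F ∷ 4F ∷ 6F ∷ []) ∷
    (7F ∷ 4F ∷ 2F ∷ 1F ∷ 6F ∷ 0F ∷ 5F ∷ 3F ∷ []) ∷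
    (5F ∷ 0F ∷ 4F ∷ 3F ∷ 1F ∷ 2F ∷ 3F ∷ 3F ∷ []) ∷
    (1F ∷ 2F ∷ 3F ∷ 7F ∷ 4F ∷ 0F ∷ 4F ∷ 5F ∷ []) ∷
    (4F ∷ 3F ∷ 7F ∷ 2F ∷ 1F ∷ 5F ∷ 5F ∷ 0F ∷ []) ∷
    (7F ∷ 0F ∷ 1F ∷ 6F ∷ 6F ∷ 6F ∷ 6F ∷ 2F ∷ []) ∷
    (1F ∷ 6F ∷ 4F ∷ 7F ∷ 0F ∷ 2F ∷ 5F ∷ 7F ∷ []) ∷ [])
  ((0F , 1F) ∷ (2F , 7F) ∷ (4F , 5F) ∷ (4F , 7F) ∷ (5F , 7F) ∷ (6F , 7F) ∷ [])
  (face 0F 7F 1F 6F true true ∷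
   face 2F 0F 3F 5F true true ∷
   face 4F 2F 6F 1F true true ∷
   face 5F 4F 7F 0F false true ∷ [])
  4 0F (1F ∷ 2F ∷ 0F ∷ []) refl refl refl refl refl refl

non-9-0 : OddMap 9 0 non
non-9-0 = non-odd
   ((0F ∷ 2F ∷ 5F ∷ 6F ∷ 7F ∷ 4F ∷ 8F ∷ 3F ∷ 1F ∷ []) ∷
    (2F ∷ 1F ∷ 6F ∷ 7F ∷ 5F ∷ 8F ∷ 3F ∷ 4F ∷ 0F ∷ []) ∷
    (8F ∷ 3F ∷ 2F ∷ 5F ∷ 0F ∷ 6F ∷ 7F ∷ 4F ∷ 1F ∷ []) ∷
    (1F ∷ 8F ∷ 6F ∷ 3F ∷ 2F ∷ 0F ∷ 5F ∷ 4F ∷ 7F ∷ []) ∷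
    (6F ∷ 3F ∷ 0F ∷ 5F ∷ 4F ∷ 2F ∷ 7F ∷ 8F ∷ 1F ∷ []) ∷
    (4F ∷ 6F ∷ 7F ∷ 8F ∷ 2F ∷ 5F ∷ 0F ∷ 3F ∷ 1F ∷ []) ∷
    (7F ∷ 0F ∷ 4F ∷ 1F ∷ 5F ∷ 8F ∷ 6F ∷ 2F ∷ 3F ∷ []) ∷
    (5F ∷ 3F ∷ 0F ∷ 4F ∷ 2F ∷ 6F ∷ 8F ∷ 7F ∷ 1F ∷ []) ∷
    (7F ∷ 2F ∷ 0F ∷ 4F ∷ 5F ∷ 6F ∷ 1F ∷ 3F ∷ 8F ∷ []) ∷ [])
  ((0F , 3F) ∷ (0F , 6F) ∷ (0F , 7F) ∷ (1F , 2F) ∷ (1F , 3F) ∷ (1F , 5F) ∷ (1F , 6F) ∷ (1F , 7F) ∷ (1F , 8F) ∷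
   (2F , 5F) ∷ (2F , 6F) ∷ (2F , 7F) ∷ (2F , 8F) ∷ (3F , 4F) ∷ (3F , 8F) ∷ (4F , 8F) ∷ (7F , 8F) ∷ [])
  1F 0F 2F 3F 6F 0F 8F false false true false
  (face 3F 7F 4F 8F true false ∷
   face 5F 6F 8F 1F true false ∷
   face 6F 4F 7F 2F true false ∷ [])
  0 0F (1F ∷ 2F ∷ 0F ∷ []) refl refl refl refl refl refl

non-9-2 : OddMap 9 2 non
non-9-2 = non-odd
   ((0F ∷ 2F ∷ 6F ∷ 4F ∷ 5F ∷ 1F ∷ 8F ∷ 3F ∷ 7F ∷ []) ∷
    (3F ∷ 1F ∷ 1F ∷ 5F ∷ 8F ∷ 4F ∷ 7F ∷ 0F ∷ 6F ∷ []) ∷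
    (7F ∷ 2F ∷ 2F ∷ 0F ∷ 3F ∷ 4F ∷ 2F ∷ 8F ∷ 5F ∷ []) ∷
    (4F ∷ 5F ∷ 8F ∷ 3F ∷ 1F ∷ 6F ∷ 2F ∷ 0F ∷ 7F ∷ []) ∷
    (6F ∷ 5F ∷ 1F ∷ 7F ∷ 4F ∷ 3F ∷ 8F ∷ 0F ∷ 2F ∷ []) ∷
    (6F ∷ 2F ∷ 7F ∷ 0F ∷ 1F ∷ 5F ∷ 8F ∷ 3F ∷ 4F ∷ []) ∷
    (3F ∷ 4F ∷ 6F ∷ 7F ∷ 5F ∷ 0F ∷ 6F ∷ 8F ∷ 1F ∷ []) ∷
    (2F ∷ 8F ∷ 1F ∷ 4F ∷ 0F ∷ 6F ∷ 3F ∷ 7F ∷ 5F ∷ []) ∷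
    (5F ∷ 4F ∷ 0F ∷ 6F ∷ 3F ∷ 1F ∷ 7F ∷ 2F ∷ 8F ∷ []) ∷ [])
  ((0F , 4F) ∷ (1F , 4F) ∷ (1F , 5F) ∷ (1F , 8F) ∷ (3F , 7F) ∷ (3F , 8F) ∷ (4F , 5F) ∷ (4F , 8F) ∷ (5F , 6F) ∷
   (5F , 7F) ∷ (5F , 8F) ∷ (6F , 7F) ∷ (6F , 8F) ∷ (7F , 8F) ∷ [])
  2F 0F 1F 8F 7F 7F 0F true true true true
  (face 3F 8F 4F 2F false true ∷
   face 5F 3F 6F 7F true false ∷
   face 7F 3F 8F 6F false false ∷ [])
  2 0F (1F ∷ 5F ∷ 0F ∷ []) refl refl refl refl refl refl

non-10-1 : EvenMap 10 1 non
non-10-1 = non-even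
   ((0F ∷ 2F ∷ 7F ∷ 1F ∷ 5F ∷ 9F ∷ 8F ∷ 6F ∷ 4F ∷ 3F ∷ []) ∷
    (4F ∷ 1F ∷ 9F ∷ 2F ∷ 5F ∷ 8F ∷ 7F ∷ 0F ∷ 3F ∷ 6F ∷ []) ∷
    (8F ∷ 4F ∷ 2F ∷ 5F ∷ 6F ∷ 7F ∷ 9F ∷ 0F ∷ 1F ∷ 3F ∷ []) ∷
    (7F ∷ 8F ∷ 6F ∷ 3F ∷ 0F ∷ 9F ∷ 1F ∷ 2F ∷ 5F ∷ 4F ∷ []) ∷
    (7F ∷ 0F ∷ 9F ∷ 1F ∷ 4F ∷ 3F ∷ 8F ∷ 6F ∷ 2F ∷ 5F ∷ []) ∷
    (8F ∷ 0F ∷ 9F ∷ 1F ∷ 3F ∷ 5F ∷ 7F ∷ 2F ∷ 6F ∷ 4F ∷ []) ∷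
    (5F ∷ 0F ∷ 1F ∷ 8F ∷ 9F ∷ 4F ∷ 6F ∷ 6F ∷ 2F ∷ 3F ∷ []) ∷
    (8F ∷ 0F ∷ 1F ∷ 9F ∷ 5F ∷ 3F ∷ 7F ∷ 7F ∷ 4F ∷ 2F ∷ []) ∷
    (5F ∷ 3F ∷ 7F ∷ 2F ∷ 6F ∷ 9F ∷ 1F ∷ 0F ∷ 8F ∷ 4F ∷ []) ∷
    (7F ∷ 2F ∷ 6F ∷ 4F ∷ 1F ∷ 3F ∷ 8F ∷ 5F ∷ 0F ∷ 9F ∷ []) ∷ [])
  ((0F , 2F) ∷ (0F , 5F) ∷ (0F , 6F) ∷ (0F , 9F) ∷ (1F , 2F) ∷ (1F , 3F) ∷ (1F , 4F) ∷ (1F , 6F) ∷ (1F , 9F) ∷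
   (2F , 5F) ∷ (2F , 6F) ∷ (2F , 7F) ∷ (2F , 9F) ∷ (3F , 4F) ∷ (3F , 6F) ∷ (4F , 6F) ∷ (4F , 7F) ∷ (4F , 8F) ∷
   (5F , 6F) ∷ (5F , 7F) ∷ (5F , 9F) ∷ (7F , 8F) ∷ (7F , 9F) ∷ [])
  (face 0F 6F 1F 7F false true ∷
   face 2F 1F 3F 8F false true ∷
   face 4F 7F 8F 0F false true ∷
   face 5F 9F 7F 2F false false ∷
   face 6F 1F 9F 2F false false ∷ [])
  1 0F (1F ∷ 3F ∷ 0F ∷ []) refl refl refl refl refl refl

non-11-1 : OddMap 11 1 non
non-11-1 = non-odd
   ((0F ∷ 4F ∷ 10F ∷ 5F ∷ 7F ∷ 8F ∷ 3F ∷ 2F ∷ 9F ∷ 1F ∷ 6F ∷ []) ∷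
    (3F ∷ 1F ∷ 0F ∷ 6F ∷ 2F ∷ 4F ∷ 7F ∷ 9F ∷ 5F ∷ 10F ∷ 8F ∷ []) ∷
    (5F ∷ 9F ∷ 2F ∷ 4F ∷ 7F ∷ 1F ∷ 3F ∷ 8F ∷ 0F ∷ 10F ∷ 6F ∷ []) ∷
    (6F ∷ 0F ∷ 5F ∷ 3F ∷ 1F ∷ 10F ∷ 7F ∷ 2F ∷ 4F ∷ 8F ∷ 9F ∷ []) ∷
    (3F ∷ 5F ∷ 0F ∷ 9F ∷ 4F ∷ 6F ∷ 8F ∷ 2F ∷ 7F ∷ 1F ∷ 4F ∷ []) ∷
    (1F ∷ 9F ∷ 10F ∷ 6F ∷ 2F ∷ 5F ∷ 0F ∷ 3F ∷ 7F ∷ 4F ∷ 8F ∷ []) ∷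
    (1F ∷ 8F ∷ 0F ∷ 5F ∷ 9F ∷ 2F ∷ 6F ∷ 10F ∷ 7F ∷ 3F ∷ 4F ∷ []) ∷
    (2F ∷ 8F ∷ 4F ∷ 9F ∷ 3F ∷ 10F ∷ 5F ∷ 7F ∷ 0F ∷ 6F ∷ 1F ∷ []) ∷
    (1F ∷ 5F ∷ 4F ∷ 0F ∷ 10F ∷ 6F ∷ 7F ∷ 2F ∷ 8F ∷ 3F ∷ 9F ∷ []) ∷
    (2F ∷ 3F ∷ 8F ∷ 0F ∷ 5F ∷ 6F ∷ 7F ∷ 10F ∷ 4F ∷ 9F ∷ 1F ∷ []) ∷
    (5F ∷ 3F ∷ 0F ∷ 7F ∷ 10F ∷ 1F ∷ 8F ∷ 9F ∷ 2F ∷ 6F ∷ 10F ∷ []) ∷ [])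
  ((0F , 1F) ∷ (0F , 2F) ∷ (0F , 3F) ∷ (0F , 5F) ∷ (0F , 6F) ∷ (0F , 9F) ∷ (1F , 2F) ∷ (1F , 3F) ∷ (1F , 4F) ∷
   (1F , 5F) ∷ (1F , 6F) ∷ (1F , 9F) ∷ (2F , 4F) ∷ (2F , 7F) ∷ (2F , 9F) ∷ (2F , 10F) ∷ (3F , 9F) ∷ (4F , 7F) ∷
   (4F , 9F) ∷ (5F , 7F) ∷ (5F , 8F) ∷ (5F , 9F) ∷ (5F , 10F) ∷ (6F , 9F) ∷ (6F , 10F) ∷ (7F , 8F) ∷
   (7F , 9F) ∷ (7F , 10F) ∷ (8F , 9F) ∷ (8F , 10F) ∷ [])
  1F 0F 3F 5F 8F 10F 9F false true true false
  (face 2F 8F 4F 7F true false ∷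
   face 5F 4F 6F 9F true false ∷
   face 7F 5F 8F 6F false true ∷
   face 9F 8F 10F 2F false false ∷ [])
  1 0F (1F ∷ 2F ∷ 0F ∷ []) refl refl refl refl refl refl

non-12-0 : EvenMap 12 0 non
non-12-0 = non-even
   ((0F ∷ 11F ∷ 8F ∷ 5F ∷ 10F ∷ 4F ∷ 9F ∷ 1F ∷ 3F ∷ 7F ∷ 6F ∷ 2F ∷ []) ∷
    (2F ∷ 1F ∷ 7F ∷ 6F ∷ 11F ∷ 4F ∷ 8F ∷ 9F ∷ 10F ∷ 3F ∷ 5F ∷ 0F ∷ []) ∷
    (11F ∷ 4F ∷ 2F ∷ 8F ∷ 5F ∷ 10F ∷ 0F ∷ 6F ∷ 9F ∷ 7F ∷ 3F ∷ 1F ∷ []) ∷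
    (6F ∷ 7F ∷ 4F ∷ 3F ∷ 11F ∷ 10F ∷ 2F ∷ 5F ∷ 9F ∷ 1F ∷ 0F ∷ 8F ∷ []) ∷
    (7F ∷ 3F ∷ 1F ∷ 8F ∷ 4F ∷ 10F ∷ 0F ∷ 2F ∷ 11F ∷ 5F ∷ 6F ∷ 9F ∷ []) ∷
    (6F ∷ 3F ∷ 1F ∷ 8F ∷ 2F ∷ 5F ∷ 10F ∷ 0F ∷ 9F ∷ 11F ∷ 4F ∷ 7F ∷ []) ∷
    (8F ∷ 9F ∷ 11F ∷ 5F ∷ 10F ∷ 0F ∷ 6F ∷ 1F ∷ 7F ∷ 2F ∷ 3F ∷ 4F ∷ []) ∷
    (2F ∷ 11F ∷ 9F ∷ 8F ∷ 1F ∷ 4F ∷ 10F ∷ 7F ∷ 6F ∷ 3F ∷ 5F ∷ 0F ∷ []) ∷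
    (11F ∷ 9F ∷ 4F ∷ 5F ∷ 3F ∷ 7F ∷ 10F ∷ 1F ∷ 8F ∷ 6F ∷ 0F ∷ 2F ∷ []) ∷
    (2F ∷ 7F ∷ 11F ∷ 5F ∷ 10F ∷ 4F ∷ 3F ∷ 6F ∷ 0F ∷ 9F ∷ 8F ∷ 1F ∷ []) ∷
    (5F ∷ 3F ∷ 6F ∷ 8F ∷ 2F ∷ 9F ∷ 0F ∷ 11F ∷ 7F ∷ 1F ∷ 10F ∷ 4F ∷ []) ∷
    (2F ∷ 3F ∷ 8F ∷ 4F ∷ 5F ∷ 10F ∷ 0F ∷ 1F ∷ 9F ∷ 7F ∷ 6F ∷ 11F ∷ []) ∷ [])
  ((0F , 1F) ∷ (0F , 2F) ∷ (0F , 3F) ∷ (0F , 6F) ∷ (0F , 9F) ∷ (0F , 10F) ∷ (1F , 2F) ∷ (1F , 4F) ∷ (1F , 7F) ∷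
   (1F , 8F) ∷ (1F , 9F) ∷ (1F , 10F) ∷ (2F , 3F) ∷ (2F , 4F) ∷ (2F , 6F) ∷ (2F , 7F) ∷ (2F , 10F) ∷
   (3F , 7F) ∷ (3F , 8F) ∷ (3F , 10F) ∷ (3F , 11F) ∷ (4F , 5F) ∷ (4F , 6F) ∷ (4F , 7F) ∷ (4F , 8F) ∷
   (4F , 9F) ∷ (4F , 11F) ∷ (5F , 6F) ∷ (5F , 7F) ∷ (5F , 9F) ∷ (5F , 10F) ∷ (5F , 11F) ∷ (6F , 8F) ∷
   (7F , 8F) ∷ (7F , 10F) ∷ (7F , 11F) ∷ (8F , 9F) ∷ (8F , 11F) ∷ (9F , 10F) ∷ (9F , 11F) ∷ (10F , 11F) ∷ [])
  (face 0F 11F 2F 1F true false ∷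
   face 1F 5F 3F 10F true false ∷
   face 4F 7F 5F 0F false true ∷
   face 6F 2F 7F 9F false true ∷
   face 8F 9F 10F 1F false false ∷
   face 9F 4F 11F 5F false false ∷ [])
  0 0F (1F ∷ 2F ∷ 0F ∷ []) refl refl refl refl refl refl

-- Graphs with the maximal number of edges.

Sum-mono : {f g : Fin n → ℕ} → (∀ i → f i ≤ g i) → Sum f ≤ Sum g
Sum-mono {zero}  h = z≤n
Sum-mono {suc n} h = +-mono-≤ (h zero) (Sum-mono (h ∘ suc))

complete : (n : ℕ) → SimpleGraph n
adj    (complete n) u v = not (u == v)
sym    (complete n) u v = cong not (==-sym u v)
irrefl (complete n) v   = cong not (==-refl v)

edgeCount-≤-complete : (G : SimpleGraph n) → edgeCount G ≤ edgeCount (complete n)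
edgeCount-≤-complete {n} G = subst₂ _≤_ (≡-sym (edgeCount-Sum G)) (≡-sym (edgeCount-Sum (complete n)))
    (Sum-mono λ i → Sum-mono (term i))
  where
  term : ∀ i j → count G i j ≤ count (complete n) i j
  term i j with toℕ i <ᵇ toℕ j
  ... | false = z≤n
  ... | true with adj G i j in e
  ...   | false = z≤n
  ...   | true rewrite ==-neq (adj-≢ G e) = ≤-refl

-- A missing edge could be added, giving more edges than the complete graph has.
full-graph : (G : SimpleGraph n) → edgeCount G ≡ edgeCount (complete n) → ∀ {u v} → u ≢ v → adj G u v ≡ true
full-graph {n} G e {u} {v} u≢v with adj G u v in uv
... | true  = refl
... | false = ⊥-elim (1+n≰n (≤-trans (≤-reflexive (trans (cong suc (≡-sym e)) (≡-sym (edgeCount-addEdge G uv u≢v))))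
    (edgeCount-≤-complete (addEdge G u v))))

-- Quadrangular embeddings of the complete graph on five vertices

Turn : Set
Turn = Fin 5 → Bool → Fin 5

∀ᵉ : (Bool → Bool) → Bool
∀ᵉ p = p true ∧ p false

∀ᵉ-sound : {p : Bool → Bool} → ∀ᵉ p ≡ true → ∀ b → p b ≡ true
∀ᵉ-sound {p} h true  = proj₁ (∧-elim (p true) _ h)
∀ᵉ-sound {p} h false = proj₂ (∧-elim (p true) _ h)

-- The rotation (a x y z), and its inverse at false.
row : (a x y z : Fin 5) → Turn
row a x y z u true  = if u == a then x else if u == x then y else if u == y then z else a
row a x y z u false = if u == x then a else if u == y then x else if u == z then y else z

-- A reference neighbour at which the rotation is written to start, so that each cyclic order of the
-- four neighbours is exactly one `row`.
base : Fin 5 → Fin 5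
base zero    = 1F
base (suc _) = 0F

_∉₂_ : Fin 5 → Fin 5 × Fin 5 → Bool
x ∉₂ (u , v) = not (x == u) ∧ not (x == v)

module _ (v : Fin 5) (k : Fin 5 → Fin 5 → Fin 5 → Bool) where

  for-z : (x y z : Fin 5) → Bool
  for-z x y z = not (z == x) ∧ not (z == y) ∧ z ∉₂ (v , base v) ⇒ᵇ k x y z

  for-y : (x y : Fin 5) → Bool
  for-y x y = not (y == x) ∧ y ∉₂ (v , base v) ⇒ᵇ ∀ᵇ (for-z x y)

  for-x : Fin 5 → Bool
  for-x x = x ∉₂ (v , base v) ⇒ᵇ ∀ᵇ (for-y x)

  forTriples : Bool
  forTriples = ∀ᵇ for-x

forRows : Fin 5 → (Turn → Bool) → Bool
forRows v k = forTriples v λ x y z → k (row (base v) x y z)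

-- A face through v and w does not close up after three steps.
noTriangle : Turn → Turn → Fin 5 → Fin 5 → Bool → Bool
noTriangle r s v w b = ∀ᵉ λ ε → not (r w (not ε) == s v (ε xor b))

rows : Turn → Turn → Turn → Turn → Turn → Fin 5 → Turn
rows r₀ r₁ r₂ r₃ r₄ 0F = r₀
rows r₀ r₁ r₂ r₃ r₄ 1F = r₁
rows r₀ r₁ r₂ r₃ r₄ 2F = r₂
rows r₀ r₁ r₂ r₃ r₄ 3F = r₃
rows r₀ r₁ r₂ r₃ r₄ 4F = r₄

bits : (b₁₂ b₁₃ b₂₃ b₁₄ b₂₄ b₃₄ : Bool) → Fin 5 → Fin 5 → Bool
bits b₁₂ b₁₃ b₂₃ b₁₄ b₂₄ b₃₄ 1F 2F = b₁₂
bits b₁₂ b₁₃ b₂₃ b₁₄ b₂₄ b₃₄ 2F 1F = b₁₂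
bits b₁₂ b₁₃ b₂₃ b₁₄ b₂₄ b₃₄ 1F 3F = b₁₃
bits b₁₂ b₁₃ b₂₃ b₁₄ b₂₄ b₃₄ 3F 1F = b₁₃
bits b₁₂ b₁₃ b₂₃ b₁₄ b₂₄ b₃₄ 2F 3F = b₂₃
bits b₁₂ b₁₃ b₂₃ b₁₄ b₂₄ b₃₄ 3F 2F = b₂₃
bits b₁₂ b₁₃ b₂₃ b₁₄ b₂₄ b₃₄ 1F 4F = b₁₄
bits b₁₂ b₁₃ b₂₃ b₁₄ b₂₄ b₃₄ 4F 1F = b₁₄
bits b₁₂ b₁₃ b₂₃ b₁₄ b₂₄ b₃₄ 2F 4F = b₂₄
bits b₁₂ b₁₃ b₂₃ b₁₄ b₂₄ b₃₄ 4F 2F = b₂₄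
bits b₁₂ b₁₃ b₂₃ b₁₄ b₂₄ b₃₄ 3F 4F = b₃₄
bits b₁₂ b₁₃ b₂₃ b₁₄ b₂₄ b₃₄ 4F 3F = b₃₄
bits b₁₂ b₁₃ b₂₃ b₁₄ b₂₄ b₃₄ _  _  = false

-- A face v w z x closes up if x precedes v. The left side finds x by tracing on through w and z,
-- the right side by the opposite turn at v from w.
closes : (Fin 5 → Turn) → (Fin 5 → Fin 5 → Bool) → Fin 5 → Fin 5 → Bool → Bool
closes R β v w ε = go (R w v (ε xor β v w))
  where
  go : Fin 5 → Bool
  go z = R z w ((ε xor β v w) xor β w z) == R v w (not ε)

allClose : (Fin 5 → Turn) → (Fin 5 → Fin 5 → Bool) → Bool
allClose R β = ∀ᵇ λ v → ∀ᵇ λ w → not (v == w) ⇒ᵇ ∀ᵉ (closes R β v w)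

module _ (r₀ r₁ r₂ : Turn) where

  module _ (b₁₂ : Bool) (r₃ : Turn) where

    module _ (b₁₃ b₂₃ : Bool) (r₄ : Turn) where

      search₃₄ : (b₁₄ b₂₄ b₃₄ : Bool) → Bool
      search₃₄ b₁₄ b₂₄ b₃₄ = noTriangle r₃ r₄ 3F 4F b₃₄ ⇒ᵇ
        allClose (rows r₀ r₁ r₂ r₃ r₄) (bits b₁₂ b₁₃ b₂₃ b₁₄ b₂₄ b₃₄) ⇒ᵇ
        not b₁₂ ∧ not b₁₃ ∧ not b₂₃ ∧ not b₁₄ ∧ not b₂₄ ∧ not b₃₄

      search₂₄ : (b₁₄ b₂₄ : Bool) → Bool
      search₂₄ b₁₄ b₂₄ = noTriangle r₂ r₄ 2F 4F b₂₄ ⇒ᵇ ∀ᵉ (search₃₄ b₁₄ b₂₄)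

      search₁₄ : Bool → Bool
      search₁₄ b₁₄ = noTriangle r₁ r₄ 1F 4F b₁₄ ⇒ᵇ ∀ᵉ (search₂₄ b₁₄)

    search₂₃ : (b₁₃ b₂₃ : Bool) → Bool
    search₂₃ b₁₃ b₂₃ = noTriangle r₂ r₃ 2F 3F b₂₃ ⇒ᵇ
      forRows 4F λ r₄ → noTriangle r₀ r₄ 0F 4F false ⇒ᵇ ∀ᵉ (search₁₄ b₁₃ b₂₃ r₄)

    search₁₃ : Bool → Bool
    search₁₃ b₁₃ = noTriangle r₁ r₃ 1F 3F b₁₃ ⇒ᵇ ∀ᵉ (search₂₃ b₁₃)

  search₁₂ : Bool → Bool
  search₁₂ b₁₂ = noTriangle r₁ r₂ 1F 2F b₁₂ ⇒ᵇ
    forRows 3F λ r₃ → noTriangle r₀ r₃ 0F 3F false ⇒ᵇ ∀ᵉ (search₁₃ b₁₂ r₃)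

-- There are 6⁵ · 2⁶ normalized rotation systems. Every pair of vertices is tested for triangles as
-- soon as its two rows and its bit are chosen, which prunes the search long before `allClose` is
-- evaluated.
search : Bool
search =
  forRows 0F λ r₀ → forRows 1F λ r₁ → noTriangle r₀ r₁ 0F 1F false ⇒ᵇ
  forRows 2F λ r₂ → noTriangle r₀ r₂ 0F 2F false ⇒ᵇ ∀ᵉ (search₁₂ r₀ r₁ r₂)

search-holds : search ≡ true
search-holds = refl

pigeonholeAt : (v x y z u : Fin 5) → Bool
pigeonholeAt v x y z u = (u == v) ∨ (u == base v) ∨ (u == x) ∨ (u == y) ∨ (u == z)

pigeonholeᵇ : Fin 5 → Bool
pigeonholeᵇ v = forTriples v λ x y z → ∀ᵇ (pigeonholeAt v x y z)

≢⇒not-== : {u v : Fin n} → u ≢ v → not (u == v) ≡ true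
≢⇒not-== h = cong not (==-neq h)

∧-intro : ∀ {x y} → x ≡ true → y ≡ true → x ∧ y ≡ true
∧-intro refl refl = refl

∀ᵇ-intro : {p : Fin n → Bool} → (∀ i → p i ≡ true) → ∀ᵇ p ≡ true
∀ᵇ-intro {zero}  h = refl
∀ᵇ-intro {suc n} h = ∧-intro (h zero) (∀ᵇ-intro (h ∘ suc))

base-≢ : ∀ v → base v ≢ v
base-≢ zero    ()
base-≢ (suc _) ()

module _ {v x y z : Fin 5} (x≢v : x ≢ v) (x≢a : x ≢ base v) (y≢v : y ≢ v) (y≢a : y ≢ base v) (y≢x : y ≢ x)
         (z≢v : z ≢ v) (z≢a : z ≢ base v) (z≢x : z ≢ x) (z≢y : z ≢ y) where

  forTriples-sound : ∀ k → forTriples v k ≡ true → k x y z ≡ true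
  forTriples-sound k h = ⇒ᵇ-sound (∀ᵇ-sound {p = for-z v k x y} (⇒ᵇ-sound (∀ᵇ-sound {p = for-y v k x}
      (⇒ᵇ-sound (∀ᵇ-sound {p = for-x v k} h x) gx) y) gy) z) gz
    where
    gx : x ∉₂ (v , base v) ≡ true
    gx = ∧-intro (≢⇒not-== x≢v) (≢⇒not-== x≢a)
    gy : not (y == x) ∧ y ∉₂ (v , base v) ≡ true
    gy = ∧-intro (≢⇒not-== y≢x) (∧-intro (≢⇒not-== y≢v) (≢⇒not-== y≢a))
    gz : not (z == x) ∧ not (z == y) ∧ z ∉₂ (v , base v) ≡ true
    gz = ∧-intro (≢⇒not-== z≢x) (∧-intro (≢⇒not-== z≢y) (∧-intro (≢⇒not-== z≢v) (≢⇒not-== z≢a)))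

  forRows-sound : ∀ k → forRows v k ≡ true → k (row (base v) x y z) ≡ true
  forRows-sound k = forTriples-sound λ x y z → k (row (base v) x y z)

  -- The finitely many admissible triples are run through by evaluation, in place of a counting
  -- argument.
  pigeonhole : ∀ u → u ≢ v → u ≡ base v ⊎ u ≡ x ⊎ u ≡ y ⊎ u ≡ z
  pigeonhole u u≢v = case ∨-elim (u == v) _ all of λ where
      (inj₁ e) → ⊥-elim (u≢v (==-sound e))
      (inj₂ h) → case ∨-elim (u == base v) _ h of λ where
        (inj₁ e) → inj₁ (==-sound e)
        (inj₂ h) → case ∨-elim (u == x) _ h of λ where
          (inj₁ e) → inj₂ (inj₁ (==-sound e))
          (inj₂ h) → case ∨-elim (u == y) _ h of λ where
            (inj₁ e) → inj₂ (inj₂ (inj₁ (==-sound e)))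
            (inj₂ e) → inj₂ (inj₂ (inj₂ (==-sound e)))
    where
    all : pigeonholeAt v x y z u ≡ true
    all = ∀ᵇ-sound {p = pigeonholeAt v x y z}
      (forTriples-sound (λ x y z → ∀ᵇ (pigeonholeAt v x y z)) (∀ᵇ-sound {p = pigeonholeᵇ} refl v)) u

-- The given rows and bits follow one branch of `search`: `s₀` to `s₄` select the row at each level,
-- and the other hypotheses discharge the tests on the way.
module SearchSound (R₀ R₁ R₂ R₃ R₄ : Turn) (b₁₂ b₁₃ b₂₃ b₁₄ b₂₄ b₃₄ : Bool)
  (s₀ : ∀ k → forRows 0F k ≡ true → k R₀ ≡ true) (s₁ : ∀ k → forRows 1F k ≡ true → k R₁ ≡ true)
  (s₂ : ∀ k → forRows 2F k ≡ true → k R₂ ≡ true) (s₃ : ∀ k → forRows 3F k ≡ true → k R₃ ≡ true)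
  (s₄ : ∀ k → forRows 4F k ≡ true → k R₄ ≡ true)
  (n₀₁ : noTriangle R₀ R₁ 0F 1F false ≡ true) (n₀₂ : noTriangle R₀ R₂ 0F 2F false ≡ true)
  (n₀₃ : noTriangle R₀ R₃ 0F 3F false ≡ true) (n₀₄ : noTriangle R₀ R₄ 0F 4F false ≡ true)
  (n₁₂ : noTriangle R₁ R₂ 1F 2F b₁₂ ≡ true) (n₁₃ : noTriangle R₁ R₃ 1F 3F b₁₃ ≡ true)
  (n₂₃ : noTriangle R₂ R₃ 2F 3F b₂₃ ≡ true) (n₁₄ : noTriangle R₁ R₄ 1F 4F b₁₄ ≡ true)
  (n₂₄ : noTriangle R₂ R₄ 2F 4F b₂₄ ≡ true) (n₃₄ : noTriangle R₃ R₄ 3F 4F b₃₄ ≡ true)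
  (all : allClose (rows R₀ R₁ R₂ R₃ R₄) (bits b₁₂ b₁₃ b₂₃ b₁₄ b₂₄ b₃₄) ≡ true) where

  private
    mp : ∀ x y → (x ⇒ᵇ y) ≡ true → x ≡ true → y ≡ true
    mp x y = ⇒ᵇ-sound

    k₀ k₁ k₂ k₃ k₄ : Turn → Bool
    k₀ r₀ = forRows 1F λ r₁ → noTriangle r₀ r₁ 0F 1F false ⇒ᵇ
      forRows 2F λ r₂ → noTriangle r₀ r₂ 0F 2F false ⇒ᵇ ∀ᵉ (search₁₂ r₀ r₁ r₂)
    k₁ r₁ = noTriangle R₀ r₁ 0F 1F false ⇒ᵇ
      forRows 2F λ r₂ → noTriangle R₀ r₂ 0F 2F false ⇒ᵇ ∀ᵉ (search₁₂ R₀ r₁ r₂)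
    k₂ r₂ = noTriangle R₀ r₂ 0F 2F false ⇒ᵇ ∀ᵉ (search₁₂ R₀ R₁ r₂)
    k₃ r₃ = noTriangle R₀ r₃ 0F 3F false ⇒ᵇ ∀ᵉ (search₁₃ R₀ R₁ R₂ b₁₂ r₃)
    k₄ r₄ = noTriangle R₀ r₄ 0F 4F false ⇒ᵇ ∀ᵉ (search₁₄ R₀ R₁ R₂ b₁₂ R₃ b₁₃ b₂₃ r₄)

    h₁ : forRows 2F k₂ ≡ true
    h₁ = mp (noTriangle R₀ R₁ 0F 1F false) (forRows 2F k₂) (s₁ k₁ (s₀ k₀ search-holds)) n₀₁
    h₂ : ∀ᵉ (search₁₂ R₀ R₁ R₂) ≡ true
    h₂ = mp (noTriangle R₀ R₂ 0F 2F false) (∀ᵉ (search₁₂ R₀ R₁ R₂)) (s₂ k₂ h₁) n₀₂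
    h₁₂ : forRows 3F k₃ ≡ true
    h₁₂ = mp (noTriangle R₁ R₂ 1F 2F b₁₂) (forRows 3F k₃) (∀ᵉ-sound {p = search₁₂ R₀ R₁ R₂} h₂ b₁₂) n₁₂
    h₃ : ∀ᵉ (search₁₃ R₀ R₁ R₂ b₁₂ R₃) ≡ true
    h₃ = mp (noTriangle R₀ R₃ 0F 3F false) (∀ᵉ (search₁₃ R₀ R₁ R₂ b₁₂ R₃)) (s₃ k₃ h₁₂) n₀₃
    h₁₃ : ∀ᵉ (search₂₃ R₀ R₁ R₂ b₁₂ R₃ b₁₃) ≡ true
    h₁₃ = mp (noTriangle R₁ R₃ 1F 3F b₁₃) (∀ᵉ (search₂₃ R₀ R₁ R₂ b₁₂ R₃ b₁₃))
            (∀ᵉ-sound {p = search₁₃ R₀ R₁ R₂ b₁₂ R₃} h₃ b₁₃) n₁₃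
    h₂₃ : forRows 4F k₄ ≡ true
    h₂₃ = mp (noTriangle R₂ R₃ 2F 3F b₂₃) (forRows 4F k₄) (∀ᵉ-sound {p = search₂₃ R₀ R₁ R₂ b₁₂ R₃ b₁₃} h₁₃ b₂₃) n₂₃
    h₄ : ∀ᵉ (search₁₄ R₀ R₁ R₂ b₁₂ R₃ b₁₃ b₂₃ R₄) ≡ true
    h₄ = mp (noTriangle R₀ R₄ 0F 4F false) (∀ᵉ (search₁₄ R₀ R₁ R₂ b₁₂ R₃ b₁₃ b₂₃ R₄)) (s₄ k₄ h₂₃) n₀₄
    h₁₄ : ∀ᵉ (search₂₄ R₀ R₁ R₂ b₁₂ R₃ b₁₃ b₂₃ R₄ b₁₄) ≡ true
    h₁₄ = mp (noTriangle R₁ R₄ 1F 4F b₁₄) (∀ᵉ (search₂₄ R₀ R₁ R₂ b₁₂ R₃ b₁₃ b₂₃ R₄ b₁₄))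
            (∀ᵉ-sound {p = search₁₄ R₀ R₁ R₂ b₁₂ R₃ b₁₃ b₂₃ R₄} h₄ b₁₄) n₁₄
    h₂₄ : ∀ᵉ (search₃₄ R₀ R₁ R₂ b₁₂ R₃ b₁₃ b₂₃ R₄ b₁₄ b₂₄) ≡ true
    h₂₄ = mp (noTriangle R₂ R₄ 2F 4F b₂₄) (∀ᵉ (search₃₄ R₀ R₁ R₂ b₁₂ R₃ b₁₃ b₂₃ R₄ b₁₄ b₂₄))
            (∀ᵉ-sound {p = search₂₄ R₀ R₁ R₂ b₁₂ R₃ b₁₃ b₂₃ R₄ b₁₄} h₁₄ b₂₄) n₂₄

  untwisted-bits : not b₁₂ ∧ not b₁₃ ∧ not b₂₃ ∧ not b₁₄ ∧ not b₂₄ ∧ not b₃₄ ≡ true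
  untwisted-bits = ⇒ᵇ-sound (⇒ᵇ-sound (∀ᵉ-sound {p = search₃₄ R₀ R₁ R₂ b₁₂ R₃ b₁₃ b₂₃ R₄ b₁₄ b₂₄} h₂₄ b₃₄) n₃₄) all

-- τ and β stand for an embedding of K₅ after switching, with `β-0` as the normalization. One, two
-- or three turns never return to the start, which makes each rotation a cycle of length four.
module Search (τ : Fin 5 → Turn) (β : Fin 5 → Fin 5 → Bool)
  (inverse : ∀ {v u} ε → u ≢ v → τ v (τ v u ε) (not ε) ≡ u)
  (nbr : ∀ {v u} ε → u ≢ v → τ v u ε ≢ v)
  (no₁ : ∀ {v u} → u ≢ v → τ v u true ≢ u)
  (no₂ : ∀ {v u} → u ≢ v → τ v (τ v u true) true ≢ u)
  (no₃ : ∀ {v u} → u ≢ v → τ v (τ v (τ v u true) true) true ≢ u)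
  (open-3 : ∀ {v w} ε → v ≢ w → τ v w (not ε) ≢ τ w v (ε xor β v w))
  (closed-4 : ∀ {v w} ε → v ≢ w →
    τ (τ w v (ε xor β v w)) w ((ε xor β v w) xor β w (τ w v (ε xor β v w))) ≡ τ v w (not ε))
  (β-sym : ∀ u v → β u v ≡ β v u) (β-0 : ∀ {v} → v ≢ 0F → β 0F v ≡ false) where

  module Row (v : Fin 5) where
    a x y z : Fin 5
    a = base v
    x = τ v a true
    y = τ v x true
    z = τ v y true

    a≢v : a ≢ v
    a≢v = base-≢ v
    x≢v : x ≢ v
    x≢v = nbr true a≢v
    y≢v : y ≢ v
    y≢v = nbr true x≢v
    z≢v : z ≢ v
    z≢v = nbr true y≢v
    x≢a : x ≢ a
    x≢a = no₁ a≢v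
    y≢a : y ≢ a
    y≢a = no₂ a≢v
    z≢a : z ≢ a
    z≢a = no₃ a≢v
    y≢x : y ≢ x
    y≢x = no₁ x≢v
    z≢x : z ≢ x
    z≢x = no₂ x≢v
    z≢y : z ≢ y
    z≢y = no₁ y≢v

    cases : ∀ u → u ≢ v → u ≡ a ⊎ u ≡ x ⊎ u ≡ y ⊎ u ≡ z
    cases = pigeonhole x≢v x≢a y≢v y≢a y≢x z≢v z≢a z≢x z≢y

    R : Turn
    R = row a x y z

    -- Were the fourth turn to lead to x, y or z, that vertex would have period three, two or one.
    za : τ v z true ≡ a
    za = case cases (τ v z true) (nbr true z≢v) of λ where
      (inj₁ e)               → e
      (inj₂ (inj₁ e))        → ⊥-elim (no₃ x≢v e)
      (inj₂ (inj₂ (inj₁ e))) → ⊥-elim (no₂ y≢v e)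
      (inj₂ (inj₂ (inj₂ e))) → ⊥-elim (no₁ z≢v e)

    next-a : R a true ≡ x
    next-a rewrite ==-refl a = refl
    next-x : R x true ≡ y
    next-x rewrite ==-neq x≢a | ==-refl x = refl
    next-y : R y true ≡ z
    next-y rewrite ==-neq y≢a | ==-neq y≢x | ==-refl y = refl
    next-z : R z true ≡ a
    next-z rewrite ==-neq z≢a | ==-neq z≢x | ==-neq z≢y = refl
    prev-a : R a false ≡ z
    prev-a rewrite ==-neq (≢-sym x≢a) | ==-neq (≢-sym y≢a) | ==-neq (≢-sym z≢a) = refl
    prev-x : R x false ≡ a
    prev-x rewrite ==-refl x = refl
    prev-y : R y false ≡ x
    prev-y rewrite ==-neq y≢x | ==-refl y = refl
    prev-z : R z false ≡ y
    prev-z rewrite ==-neq z≢x | ==-neq z≢y | ==-refl z = refl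

    agree : ∀ u ε → u ≢ v → R u ε ≡ τ v u ε
    agree u true u≢v = case cases u u≢v of λ where
          (inj₁ e)               → at e next-a
          (inj₂ (inj₁ e))        → at e next-x
          (inj₂ (inj₂ (inj₁ e))) → at e next-y
          (inj₂ (inj₂ (inj₂ e))) → at e (trans next-z (≡-sym za))
      where
      at : ∀ {t} → u ≡ t → R t true ≡ τ v t true → R u true ≡ τ v u true
      at refl h = h
    agree u false u≢v = case cases u u≢v of λ where
          (inj₁ e)               → at e (trans prev-a (≡-sym (trans (cong (λ t → τ v t false) (≡-sym za)) (inverse true z≢v))))
          (inj₂ (inj₁ e))        → at e (trans prev-x (≡-sym (inverse true a≢v)))
          (inj₂ (inj₂ (inj₁ e))) → at e (trans prev-y (≡-sym (inverse true x≢v)))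
          (inj₂ (inj₂ (inj₂ e))) → at e (trans prev-z (≡-sym (inverse true y≢v)))
      where
      at : ∀ {t} → u ≡ t → R t false ≡ τ v t false → R u false ≡ τ v u false
      at refl h = h

    sound : ∀ k → forRows v k ≡ true → k R ≡ true
    sound = forRows-sound x≢v x≢a y≢v y≢a y≢x z≢v z≢a z≢x z≢y

  R : Fin 5 → Turn
  R = Row.R

  agree : ∀ {v u} ε → u ≢ v → R v u ε ≡ τ v u ε
  agree {v} {u} ε = Row.agree v u ε

  R′ : Fin 5 → Turn
  R′ = rows (R 0F) (R 1F) (R 2F) (R 3F) (R 4F)

  R′≡R : ∀ v → R′ v ≡ R v
  R′≡R 0F = refl
  R′≡R 1F = refl
  R′≡R 2F = refl
  R′≡R 3F = refl
  R′≡R 4F = refl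

  β′ : Fin 5 → Fin 5 → Bool
  β′ = bits (β 1F 2F) (β 1F 3F) (β 2F 3F) (β 1F 4F) (β 2F 4F) (β 3F 4F)

  β-0′ : ∀ {v} → v ≢ 0F → β v 0F ≡ false
  β-0′ {v} h = trans (β-sym v 0F) (β-0 h)

  β′≡β : ∀ v w → v ≢ w → β′ v w ≡ β v w
  β′≡β 0F w h = ≡-sym (β-0 (≢-sym h))
  β′≡β 1F 0F h = ≡-sym (β-0′ h)
  β′≡β 2F 0F h = ≡-sym (β-0′ h)
  β′≡β 3F 0F h = ≡-sym (β-0′ h)
  β′≡β 4F 0F h = ≡-sym (β-0′ h)
  β′≡β 1F 1F h = ⊥-elim (h refl)
  β′≡β 2F 2F h = ⊥-elim (h refl)
  β′≡β 3F 3F h = ⊥-elim (h refl)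
  β′≡β 4F 4F h = ⊥-elim (h refl)
  β′≡β 1F 2F h = refl
  β′≡β 1F 3F h = refl
  β′≡β 1F 4F h = refl
  β′≡β 2F 3F h = refl
  β′≡β 2F 4F h = refl
  β′≡β 3F 4F h = refl
  β′≡β 2F 1F h = β-sym 1F 2F
  β′≡β 3F 1F h = β-sym 1F 3F
  β′≡β 4F 1F h = β-sym 1F 4F
  β′≡β 3F 2F h = β-sym 2F 3F
  β′≡β 4F 2F h = β-sym 2F 4F
  β′≡β 4F 3F h = β-sym 3F 4F

  ∀ᵉ-intro : {p : Bool → Bool} → (∀ b → p b ≡ true) → ∀ᵉ p ≡ true
  ∀ᵉ-intro h = ∧-intro (h true) (h false)

  ⇒ᵇ-intro : ∀ {x y} → (x ≡ true → y ≡ true) → (x ⇒ᵇ y) ≡ true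
  ⇒ᵇ-intro {true}  h = h refl
  ⇒ᵇ-intro {false} h = refl

  nt : ∀ v w {b} → v ≢ w → β v w ≡ b → noTriangle (R v) (R w) v w b ≡ true
  nt v w h refl = ∀ᵉ-intro {p = λ ε → not (R v w (not ε) == R w v (ε xor β v w))} λ ε →
    ≢⇒not-== (subst₂ _≢_ (≡-sym (agree (not ε) (≢-sym h))) (≡-sym (agree _ h)) (open-3 ε h))

  close : ∀ v w ε → v ≢ w → closes R′ β′ v w ε ≡ true
  close v w ε h = trans (cong (_== R′ v w (not ε)) eq) (==-refl (R′ v w (not ε)))
    where
    b = ε xor β v w
    z₀ = τ w v b
    z = R′ w v (ε xor β′ v w)
    z≡ : z ≡ z₀
    z≡ = trans (cong₂ (λ r c → r v (ε xor c)) (R′≡R w) (β′≡β v w h)) (agree b h)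
    w≢z₀ : w ≢ z₀
    w≢z₀ e = nbr b h (≡-sym e)
    eq : R′ z w ((ε xor β′ v w) xor β′ w z) ≡ R′ v w (not ε)
    eq = begin
      R′ z w ((ε xor β′ v w) xor β′ w z)
        ≡⟨ cong₂ (λ x c → R′ x w ((ε xor c) xor β′ w x)) z≡ (β′≡β v w h) ⟩
      R′ z₀ w (b xor β′ w z₀)
        ≡⟨ cong₂ (λ r c → r w (b xor c)) (R′≡R z₀) (β′≡β w z₀ w≢z₀) ⟩
      R z₀ w (b xor β w z₀)   ≡⟨ agree _ w≢z₀ ⟩
      τ z₀ w (b xor β w z₀)   ≡⟨ closed-4 ε h ⟩
      τ v w (not ε)           ≡⟨ agree (not ε) (≢-sym h) ⟨
      R v w (not ε)           ≡⟨ cong (λ r → r w (not ε)) (R′≡R v) ⟨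
      R′ v w (not ε)          ∎
      where open ≡-Reasoning

  allClose-holds : allClose R′ β′ ≡ true
  allClose-holds = ∀ᵇ-intro λ v → ∀ᵇ-intro λ w → ⇒ᵇ-intro λ h →
    ∀ᵉ-intro {p = closes R′ β′ v w} λ ε → close v w ε (≢-sound h)

  untwisted-bits : not (β 1F 2F) ∧ not (β 1F 3F) ∧ not (β 2F 3F) ∧ not (β 1F 4F) ∧ not (β 2F 4F) ∧ not (β 3F 4F) ≡ true
  untwisted-bits = SearchSound.untwisted-bits (R 0F) (R 1F) (R 2F) (R 3F) (R 4F)
      (β 1F 2F) (β 1F 3F) (β 2F 3F) (β 1F 4F) (β 2F 4F) (β 3F 4F)
      (Row.sound 0F) (Row.sound 1F) (Row.sound 2F) (Row.sound 3F) (Row.sound 4F)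
      (nt₀ 1F (λ ())) (nt₀ 2F (λ ())) (nt₀ 3F (λ ())) (nt₀ 4F (λ ()))
      (nt 1F 2F (λ ()) refl) (nt 1F 3F (λ ()) refl) (nt 2F 3F (λ ()) refl)
      (nt 1F 4F (λ ()) refl) (nt 2F 4F (λ ()) refl) (nt 3F 4F (λ ()) refl)
      allClose-holds
    where
    nt₀ : ∀ v → v ≢ 0F → noTriangle (R 0F) (R v) 0F v false ≡ true
    nt₀ v h = nt 0F v (≢-sym h) (β-0 h)

  untwisted-β : ∀ v w → v ≢ w → β v w ≡ false
  untwisted-β v w v≢w = trans (≡-sym (β′≡β v w v≢w)) (all-bits _ _ _ _ _ _ untwisted-bits v w)
    where
    all-bits : ∀ b₁₂ b₁₃ b₂₃ b₁₄ b₂₄ b₃₄ → not b₁₂ ∧ not b₁₃ ∧ not b₂₃ ∧ not b₁₄ ∧ not b₂₄ ∧ not b₃₄ ≡ true →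
      ∀ v w → bits b₁₂ b₁₃ b₂₃ b₁₄ b₂₄ b₃₄ v w ≡ false
    all-bits false false false false false false _ v w =
      not-elim (∀ᵇ-sound {p = λ w → not (bits false false false false false false v w)}
        (∀ᵇ-sound {p = λ v → ∀ᵇ λ w → not (bits false false false false false false v w)} refl v) w)

fewᵇ : (v u x y : Fin 5) → Bool
fewᵇ v u x y = not (∀ᵇ λ w → (w == v) ∨ (w == u) ∨ (w == x) ∨ (w == y))

module _ {v : Fin 5} {N : Fin 5 → Bool} {f g : Fin 5 → Fin 5} (rt : IsRotation N f g)
         (Nv : N v ≡ false) (full : ∀ {u} → u ≢ v → N u ≡ true) where
  open IsRotation rt

  private
    Nb : ∀ {u} → u ≢ v → N u ≡ true
    Nb = full
    ≢v : ∀ {u} → N u ≡ true → u ≢ v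
    ≢v Nu refl = true≢false (trans (≡-sym Nu) Nv)

  -- Otherwise the orbit of u would consist of at most three vertices, but it must contain all four
  -- neighbours of v.
  no-short-period : ∀ {u} → u ≢ v → ¬ (f (f (f u)) ≡ u ⊎ f (f (f u)) ≡ f u ⊎ f (f (f u)) ≡ f (f u))
  no-short-period {u} u≢v h = true≢false (trans (≡-sym bad) few)
    where
    few : (∀ᵇ λ w → (w == v) ∨ (w == u) ∨ (w == f u) ∨ (w == f (f u))) ≡ false
    few = not-elim (∀ᵇ-sound {p = fewᵇ v u (f u)} (∀ᵇ-sound {p = λ x → ∀ᵇ (fewᵇ v u x)}
      (∀ᵇ-sound {p = λ u → ∀ᵇ λ x → ∀ᵇ (fewᵇ v u x)} (∀ᵇ-sound {p = λ v → ∀ᵇ λ u → ∀ᵇ λ x → ∀ᵇ (fewᵇ v u x)} refl v) u)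
      (f u)) (f (f u)))
    near : ∀ k → iter f k u ≡ u ⊎ iter f k u ≡ f u ⊎ iter f k u ≡ f (f u)
    near zero    = inj₁ refl
    near (suc k) = case near k of λ where
      (inj₁ e)        → inj₂ (inj₁ (cong f e))
      (inj₂ (inj₁ e)) → inj₂ (inj₂ (cong f e))
      (inj₂ (inj₂ e)) → case h of λ where
        (inj₁ e′)        → inj₁ (trans (cong f e) e′)
        (inj₂ (inj₁ e′)) → inj₂ (inj₁ (trans (cong f e) e′))
        (inj₂ (inj₂ e′)) → inj₂ (inj₂ (trans (cong f e) e′))
    ==-true : ∀ {x y : Fin 5} → x ≡ y → (x == y) ≡ true
    ==-true {x} refl = ==-refl x
    bad : (∀ᵇ λ w → (w == v) ∨ (w == u) ∨ (w == f u) ∨ (w == f (f u))) ≡ true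
    bad = ∀ᵇ-intro λ w → case w ≟ v of λ where
      (yes e)  → ∨-introˡ _ (==-true e)
      (no w≢v) → let k , e = orbit u w (full u≢v) (full w≢v) in
        ∨-introʳ (w == v) (case near k of λ where
          (inj₁ e′)        → ∨-introˡ _ (==-true (trans (≡-sym e) e′))
          (inj₂ (inj₁ e′)) → ∨-introʳ (w == u) (∨-introˡ _ (==-true (trans (≡-sym e) e′)))
          (inj₂ (inj₂ e′)) → ∨-introʳ (w == u) (∨-introʳ (w == f u) (==-true (trans (≡-sym e) e′))))

  f≢₁ : ∀ {u} → u ≢ v → f u ≢ u
  f≢₁ u≢v e = no-short-period u≢v (inj₁ (trans (cong (f ∘ f) e) (trans (cong f e) e)))
  f≢₂ : ∀ {u} → u ≢ v → f (f u) ≢ u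
  f≢₂ u≢v e = no-short-period u≢v (inj₂ (inj₁ (cong f e)))
  f≢₃ : ∀ {u} → u ≢ v → f (f (f u)) ≢ u
  f≢₃ u≢v e = no-short-period u≢v (inj₁ e)

  gv : ∀ {u} → u ≢ v → g u ≢ v
  gv u≢v = ≢v (g-nbr _ (full u≢v))

  g≢₁ : ∀ {u} → u ≢ v → g u ≢ u
  g≢₁ u≢v e = f≢₁ u≢v (trans (cong f (≡-sym e)) (fg _ (full u≢v)))
  g≢₂ : ∀ {u} → u ≢ v → g (g u) ≢ u
  g≢₂ u≢v e = f≢₂ u≢v (trans (cong (f ∘ f) (≡-sym e)) (trans (cong f (fg _ (full (gv u≢v)))) (fg _ (full u≢v))))
  g≢₃ : ∀ {u} → u ≢ v → g (g (g u)) ≢ u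
  g≢₃ u≢v e = f≢₃ u≢v (trans (cong (f ∘ f ∘ f) (≡-sym e)) (trans (cong (f ∘ f) (fg _ (full (gv (gv u≢v)))))
    (trans (cong f (fg _ (full (gv u≢v)))) (fg _ (full u≢v)))))

module FiveVertices {G : SimpleGraph 5} (full : ∀ {u v} → u ≢ v → adj G u v ≡ true)
  (E : Embedding G) (Q : Quadrangular E) where

  -- The switching that untwists all edges at 0F. The second factor sets `s 0F` to `false`, whatever
  -- the value of `sig E 0F 0F`.
  s : Fin 5 → Bool
  s v = sig E 0F v ∧ not (v == 0F)

  -- Switching at v reverses the rotation there, so the orientation is read relative to `s v`.
  τ : Fin 5 → Turn
  τ v u ε = turn E v u (ε xor s v)

  β : Fin 5 → Fin 5 → Bool
  β v w = (sig E v w xor s v) xor s w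

  not-xorˡ : ∀ a b → not a xor b ≡ not (a xor b)
  not-xorˡ true  true  = refl
  not-xorˡ true  false = refl
  not-xorˡ false b     = refl

  -- For an edge with signature g and switchings p and q at its ends: crossing the switched edge and
  -- then undoing q agrees with undoing p and then crossing the original edge. Hence switching does
  -- not change the faces.
  xor-lemma : ∀ a g p q → (a xor ((g xor p) xor q)) xor q ≡ (a xor p) xor g
  xor-lemma true  true  true  true  = refl
  xor-lemma true  true  true  false = refl
  xor-lemma true  true  false true  = refl
  xor-lemma true  true  false false = refl
  xor-lemma true  false true  true  = refl
  xor-lemma true  false true  false = refl
  xor-lemma true  false false true  = refl
  xor-lemma true  false false false = refl
  xor-lemma false true  true  true  = refl
  xor-lemma false true  true  false = refl
  xor-lemma false true  false true  = refl
  xor-lemma false true  false false = refl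
  xor-lemma false false true  true  = refl
  xor-lemma false false true  false = refl
  xor-lemma false false false true  = refl
  xor-lemma false false false false = refl

  inverse : ∀ {v u} ε → u ≢ v → τ v (τ v u ε) (not ε) ≡ u
  inverse {v} {u} ε u≢v = trans (cong (turn E v (τ v u ε)) (not-xorˡ ε (s v)))
    (turn-turn E v u (ε xor s v) (full (≢-sym u≢v)))

  nbr : ∀ {v u} ε → u ≢ v → τ v u ε ≢ v
  nbr {v} {u} ε u≢v = ≢-sym (adj-≢ G (turn-nbr E v u (ε xor s v) (full (≢-sym u≢v))))

  module _ {v : Fin 5} where
    private
      full′ : ∀ {u} → u ≢ v → adj G v u ≡ true
      full′ h = full (≢-sym h)
      rt = rotation E v

    no₁ : ∀ {u} → u ≢ v → τ v u true ≢ u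
    no₁ with s v
    ... | true  = g≢₁ rt (irrefl G v) full′
    ... | false = f≢₁ rt (irrefl G v) full′
    no₂ : ∀ {u} → u ≢ v → τ v (τ v u true) true ≢ u
    no₂ with s v
    ... | true  = g≢₂ rt (irrefl G v) full′
    ... | false = f≢₂ rt (irrefl G v) full′
    no₃ : ∀ {u} → u ≢ v → τ v (τ v (τ v u true) true) true ≢ u
    no₃ with s v
    ... | true  = g≢₃ rt (irrefl G v) full′
    ... | false = f≢₃ rt (irrefl G v) full′

  F : State 5 → State 5
  F = faceStep E

  module _ {v w : Fin 5} (ε : Bool) (v≢w : v ≢ w) where
    private
      η = ε xor s v
      z = turn E w v (η xor sig E v w)
      x = turn E z w ((η xor sig E v w) xor sig E w z)

      z≡ : τ w v (ε xor β v w) ≡ z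
      z≡ = cong (turn E w v) (xor-lemma ε (sig E v w) (s v) (s w))

      x≡ : τ z w ((ε xor β v w) xor β w z) ≡ x
      x≡ = cong (turn E z w) (trans (xor-lemma (ε xor β v w) (sig E w z) (s w) (s z))
        (cong (_xor sig E w z) (xor-lemma ε (sig E v w) (s v) (s w))))

      quad-vw : Good F (v , w , η)
      quad-vw = Q v w η (full v≢w)

      y : Fin 5
      y = turn E x z (((η xor sig E v w) xor sig E w z) xor sig E z x)

      last : F (F (F (F (v , w , η)))) ≡ (v , w , η)
      last = proj₁ quad-vw

      y≡v : y ≡ v
      y≡v = cong proj₁ last

      η≡ : (((η xor sig E v w) xor sig E w z) xor sig E z x) xor sig E x y ≡ η
      η≡ = cong (proj₂ ∘ proj₂) last

      w≡ : turn E v x η ≡ w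
      w≡ = trans (cong₂ (λ a b → turn E a x b) (≡-sym y≡v) (≡-sym η≡)) (cong (proj₁ ∘ proj₂) last)

      x≢v : v ≢ x
      x≢v = proj₁ (proj₂ (proj₂ (proj₂ quad-vw)))

      -- On the face x comes just before v, so the turn at v from x leads to w, and the opposite
      -- turn leads from w back to x.
      x≡pred : x ≡ τ v w (not ε)
      x≡pred = trans (≡-sym (turn-turn E v x η (full x≢v)))
        (cong₂ (turn E v) w≡ (≡-sym (not-xorˡ ε (s v))))

    open-3 : τ v w (not ε) ≢ τ w v (ε xor β v w)
    open-3 e = proj₂ (proj₂ (proj₂ (proj₂ (proj₂ (proj₂ quad-vw)))))
      (≡-sym (trans x≡pred (trans e z≡)))

    closed-4 : τ (τ w v (ε xor β v w)) w ((ε xor β v w) xor β w (τ w v (ε xor β v w))) ≡ τ v w (not ε)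
    closed-4 = trans (cong (λ t → τ t w ((ε xor β v w) xor β w t)) z≡) (trans x≡ x≡pred)

  β-sym : ∀ u v → β u v ≡ β v u
  β-sym u v rewrite sig-sym E u v = lem (sig E v u) (s u) (s v)
    where
    lem : ∀ a b c → (a xor b) xor c ≡ (a xor c) xor b
    lem true  true  true  = refl
    lem true  true  false = refl
    lem true  false true  = refl
    lem true  false false = refl
    lem false true  true  = refl
    lem false true  false = refl
    lem false false true  = refl
    lem false false false = refl

  β-0 : ∀ {v} → v ≢ 0F → β 0F v ≡ false
  β-0 {v} h rewrite ==-neq h = lem (sig E 0F v) (sig E 0F 0F)
    where
    lem : ∀ a b → (a xor (b ∧ false)) xor (a ∧ true) ≡ false
    lem true  true  = refl
    lem true  false = refl
    lem false true  = refl
    lem false false = refl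

  -- After switching no edge is twisted, so the switching function itself balances the signature.
  orientable : Orientable E
  orientable = s , λ u v uv → lem (sig E u v) (s u) (s v)
      (Search.untwisted-β τ β inverse nbr no₁ no₂ no₃ open-3 closed-4 β-sym β-0 u v (adj-≢ G uv))
    where
    lem : ∀ a b c → (a xor b) xor c ≡ false → a ≡ b xor c
    lem true  true  false _ = refl
    lem true  false true  _ = refl
    lem false true  true  _ = refl
    lem false false false _ = refl

no-nonorientable-K₅ : ¬ NonorientableQuad 5 10
no-nonorientable-K₅ (G , _ , e , E , Q , ¬o) = ¬o (FiveVertices.orientable (full-graph G e) E Q)

-- Quadrangulations from decorated embeddings.

data SomeMap (n t : ℕ) (κ : Kind) : Set where
  even : EvenMap n t κ → SomeMap n t κ
  odd  : OddMap n t κ → SomeMap n t κ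

map-drop-all : ∀ {n} {G : SimpleGraph n} {κ} (Fs : List (Face n)) → All (λ F → Nondeg (ends F)) Fs →
  All ProperMid Fs → Map G κ (map walk Fs) → Map G κ []
map-drop-all []                       []       []       M = M
map-drop-all (face e f g h γ δ ∷ Fs) (p ∷ ps) (q ∷ qs) M = map-drop-all Fs ps qs (map-drop p q M)

-- At the end the reservations are given up: every reserved face is a quadrilateral, and with the
-- list empty no face is exempt.
deco-map : ∀ {n} {G : SimpleGraph n} {κ ps} → Deco G κ ps → (∀ {P} → P ∈ ps → Nondeg P) → Map G κ []
deco-map (deco Fs refl pr M) nd = map-drop-all Fs (All.tabulate (λ h → nd (∈-ends h))) pr M
  where
  ∈-ends : ∀ {F} {Fs : List (Face _)} → F ∈ Fs → ends F ∈ map ends Fs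
  ∈-ends (here refl) = here refl
  ∈-ends (there h)   = there (∈-ends h)

map-quadrangular : ∀ {n} {G : SimpleGraph n} {κ} (M : Map G κ []) → Quadrangular (Map.emb M)
map-quadrangular M u v ε h = case Exempt.good (Sys.exempt (Map.sys M)) (u , v , ε) h of λ where
  (inj₂ (inj₂ g)) → g

tri≡C : ∀ n → tri n ≡ n C 2
tri≡C zero    = refl
tri≡C (suc n) = trans (cong₂ _+_ (≡-sym (nC1≡n n)) (tri≡C n)) (nCk+nC[k+1]≡[n+1]C[k+1] n 1)

size-C : ∀ n {m t} → m + t ≡ tri n → m ≡ n C 2 ∸ t
size-C n {m} {t} e = trans (≡-sym (m+n∸n≡m m t)) (cong (_∸ t) (trans e (tri≡C n)))

QuadOf : Kind → ℕ → ℕ → Set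
QuadOf κ n t = Σ (SimpleGraph n) λ G → Connected G × (edgeCount G ≡ n C 2 ∸ t) × Map G κ []

quad-of : ∀ {n t κ} → SomeMap n t κ → QuadOf κ n t
quad-of {n} {t} (even P) = graph , connected , size-C n size , deco-map Δ (nondeg-flat unique)
  where open EvenMap P
quad-of {n} {t} (odd P) = graph , connected , size-C n size , deco-map Δ nd
  where
  open OddMap P
  nd : ∀ {Q} → Q ∈ (e , w) ∷ (e , g) ∷ pairs → Nondeg Q
  nd (here refl)         k = unique-disjoint {xs = e ∷ []} unique (here refl) (here k)
  nd (there (here refl)) k = unique-disjoint {xs = e ∷ []} unique (here refl) (there (here k))
  nd (there (there h))     = nondeg-flat (unique-++ʳ (e ∷ w ∷ g ∷ []) unique) h

orientable-quad : ∀ {n t} → SomeMap n t ori → OrientableQuad n (n C 2 ∸ t)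
orientable-quad P = let G , c , e , M = quad-of P in
  G , c , e , Map.emb M , map-quadrangular M , (λ _ → false) , λ u v _ → Map.kind M u v

nonorientable-quad : ∀ {n t} → SomeMap n t non → NonorientableQuad n (n C 2 ∸ t)
nonorientable-quad P = let G , c , e , M = quad-of P in G , c , e , Map.emb M , map-quadrangular M , Map.kind M

length-pos : ∀ {n} (ps : List (Pair n)) → 1 ≤ length (flat ps) → 1 ≤ length ps
length-pos (_ ∷ _) _ = s≤s z≤n

-- For 4 ≤ n the second part has at least one ordinary pair, in the odd case because only three
-- vertices lie outside these pairs. So at least as many tubes exist as `Q` has pairs, and the bound
-- on s leaves one of them.
join : ∀ {k n t t′ κ κ′} (Q : EvenMap k t κ) bs → EvenMap.pairs Q ≡ unpair bs → SomeMap n t′ κ′ → 4 ≤ n →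
  ∀ s → s < length (EvenMap.pairs Q) → SomeMap (k + n) (t + t′ + 4 * s) (κ ⊔ κ′)
join {κ = κ} Q bs e (even P) n≥4 s h = even (join-even Q P s
  (≤-trans (subst (suc s ≤_) (≡-sym (*-identityʳ _)) h) (*-mono-≤ (≤-refl {length (EvenMap.pairs Q)})
    (length-pos (EvenMap.pairs P) (subst (1 ≤_) (≡-sym (EvenMap.total P)) (≤-trans (s≤s z≤n) n≥4))))))
join Q bs e (odd P) n≥4 s h = odd (join-odd Q P bs e s
  (≤-trans (subst (suc s ≤_) (≡-sym (*-identityʳ _)) h) (*-mono-≤ (≤-refl {length (EvenMap.pairs Q)})
    (length-pos (OddMap.pairs P) (+-cancelˡ-≤ 3 1 _ (subst (4 ≤_) (≡-sym (OddMap.total P)) n≥4))))))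

add-4 : ∀ {n t κ} → SomeMap n t κ → 4 ≤ n → SomeMap (4 + n) (2 + t) κ
add-4 {n} {t} {κ} P h = subst (λ x → SomeMap (4 + n) x κ) (+-identityʳ (2 + t))
  (join ori-4-2 ((_ , _) ∷ []) refl P h 0 (s≤s z≤n))

-- Leaving out one of the K₂,₂ costs four more edges.
add-4-skip : ∀ {n t κ} → SomeMap n t κ → 4 ≤ n → SomeMap (4 + n) (6 + t) κ
add-4-skip {n} {t} {κ} P h = subst (λ x → SomeMap (4 + n) x κ) (+-comm (2 + t) 4)
  (join ori-4-2 ((_ , _) ∷ []) refl P h 1 (s≤s (s≤s z≤n)))

add-8 : ∀ {n t κ κ′} (Q : EvenMap 8 0 κ) bs → EvenMap.pairs Q ≡ unpair bs → SomeMap n t κ′ → 4 ≤ n →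
  0 < length (EvenMap.pairs Q) → SomeMap (8 + n) t (κ ⊔ κ′)
add-8 {n} {t} {κ} {κ′} Q bs e P h pos =
  subst (λ x → SomeMap (8 + n) x (κ ⊔ κ′)) (+-identityʳ t) (join Q bs e P h 0 pos)

add-8-ori : ∀ {n t κ} → SomeMap n t κ → 4 ≤ n → SomeMap (8 + n) t κ
add-8-ori P h = add-8 ori-8-0 ((_ , _) ∷ (_ , _) ∷ []) refl P h (s≤s z≤n)

add-8-non : ∀ {n t κ} → SomeMap n t κ → 4 ≤ n → SomeMap (8 + n) t non
add-8-non P h = add-8 non-8-0 ((_ , _) ∷ (_ , _) ∷ []) refl P h (s≤s z≤n)

-- Residue classes

Class : (k n t : ℕ) → Set
Class k n t = (+ t) ≡[mod k ] halfNN5 n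

-- The value of `halfNN5` at 5 + m as a natural number: m(m + 5)/2 grows by m + 3 from m to m + 1.
half : ℕ → ℕ
half zero    = 0
half (suc m) = half m + (m + 3)

half-double : ∀ m → (5 + m) * m ≡ half m * 2
half-double zero    = refl
half-double (suc m) = begin
  (6 + m) * suc m            ≡⟨ solve 1 (λ m → (con 6 :+ m) :* (con 1 :+ m) := (con 5 :+ m) :* m :+ (m :+ con 3) :* con 2) refl m ⟩
  (5 + m) * m + (m + 3) * 2  ≡⟨ cong (_+ (m + 3) * 2) (half-double m) ⟩
  half m * 2 + (m + 3) * 2   ≡⟨ solve 2 (λ a b → a :* con 2 :+ b :* con 2 := (a :+ b) :* con 2) refl (half m) (m + 3) ⟩
  (half m + (m + 3)) * 2     ∎
  where
  open ≡-Reasoning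
  open +-*-Solver

halfNN5≡half : ∀ m → halfNN5 (5 + m) ≡ + half m
halfNN5≡half m = begin
  (+ (5 + m) ℤ.* + m) ℤ./ + 2      ≡⟨ cong (ℤ._/ + 2) (≡-sym (ℤ.pos-* (5 + m) m)) ⟩
  + ((5 + m) * m) ℤ./ + 2          ≡⟨ cong (λ x → + x ℤ./ + 2) (half-double m) ⟩
  + (half m * 2) ℤ./ + 2           ≡⟨ ℤ.*-identityˡ _ ⟩
  + (half m * 2) ℤ./ℕ 2            ≡⟨ cong +_ (m*n/n≡m (half m) 2) ⟩
  + half m                         ∎
  where open ≡-Reasoning

half-4 : ∀ m → half (4 + m) ≡ half m + (4 * m + 18)
half-4 m = solve 2 (λ h m → h :+ (m :+ con 3) :+ (con 1 :+ m :+ con 3) :+ (con 2 :+ m :+ con 3) :+ (con 3 :+ m :+ con 3)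
                          := h :+ (con 4 :* m :+ con 18)) refl (half m) m
  where open +-*-Solver

-- The equation says that t′ - half m′ exceeds t - half m by 4x, and 4 is a multiple of k by `ck`.
-- This treats the moduli 4 and 2 at once.
class-shift : ∀ {k c m m′ t t′ x} → c * k ≡ 4 → t + half m′ + 4 * x ≡ t′ + half m →
  Class k (5 + m) t → Class k (5 + m′) t′
class-shift {k} {c} {m} {m′} {t} {t′} {x} ck e h
  with Signed.divides q eq ← Signed.∣ᵤ⇒∣ {+ k} {+ t ℤ.- halfNN5 (5 + m)} h =
  Signed.∣⇒∣ᵤ {+ k} {+ t′ ℤ.- halfNN5 (5 + m′)} (Signed.divides (q ℤ.+ + x ℤ.* + c) (begin
    + t′ ℤ.- halfNN5 (5 + m′)
      ≡⟨ cong (λ y → + t′ ℤ.- y) (halfNN5≡half m′) ⟩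
    + t′ ℤ.- + half m′
      ≡⟨ solve 3 (λ a b d → a :- b := a :+ d :- (b :+ d)) refl (+ t′) (+ half m′) (+ half m) ⟩
    + t′ ℤ.+ + half m ℤ.- (+ half m′ ℤ.+ + half m)
      ≡⟨ cong (ℤ._- (+ half m′ ℤ.+ + half m)) (≡-sym (cong +_ e)) ⟩
    + (t + half m′ + 4 * x) ℤ.- (+ half m′ ℤ.+ + half m)
      ≡⟨ cong (λ y → + t ℤ.+ + half m′ ℤ.+ y ℤ.- (+ half m′ ℤ.+ + half m)) (trans (cong (λ z → + (z * x)) (≡-sym ck))
           (trans (ℤ.pos-* (c * k) x) (cong (ℤ._* + x) (ℤ.pos-* c k)))) ⟩
    + t ℤ.+ + half m′ ℤ.+ + c ℤ.* + k ℤ.* + x ℤ.- (+ half m′ ℤ.+ + half m)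
      ≡⟨ solve 6 (λ a b d c k x → a :+ b :+ c :* k :* x :- (b :+ d) := (a :- d) :+ x :* c :* k) refl
           (+ t) (+ half m′) (+ half m) (+ c) (+ k) (+ x) ⟩
    (+ t ℤ.- + half m) ℤ.+ + x ℤ.* + c ℤ.* + k
      ≡⟨ cong (ℤ._+ + x ℤ.* + c ℤ.* + k) (trans (cong (λ y → + t ℤ.- y) (≡-sym (halfNN5≡half m))) eq) ⟩
    q ℤ.* + k ℤ.+ + x ℤ.* + c ℤ.* + k
      ≡⟨ ℤ.*-distribʳ-+ (+ k) q (+ x ℤ.* + c) ⟨
    (q ℤ.+ + x ℤ.* + c) ℤ.* + k ∎))
  where
  open ≡-Reasoning
  open ℤSolver.+-*-Solver

module _ {k : ℕ} (c : ℕ) (ck : c * k ≡ 4) where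
  open +-*-Solver

  -- The values of x here and in the next two lemmas come from half (4 + m) - half m = 4m + 18 = 2 +
  -- 4(m + 4) = 6 + 4(m + 3) and half (8 + m) - half m = 8m + 52 = 4(2m + 13).
  class-4 : ∀ m t → Class k (9 + m) (2 + t) → Class k (5 + m) t
  class-4 m t = class-shift {c = c} {m = 4 + m} {m′ = m} {x = m + 4} ck (trans
    (solve 3 (λ t h m → con 2 :+ t :+ h :+ con 4 :* (m :+ con 4) := t :+ (h :+ (con 4 :* m :+ con 18))) refl t (half m) m)
    (cong (λ y → t + y) (≡-sym (half-4 m))))

  class-4-skip : ∀ m t → Class k (9 + m) (6 + t) → Class k (5 + m) t
  class-4-skip m t = class-shift {c = c} {m = 4 + m} {m′ = m} {x = m + 3} ck (trans
    (solve 3 (λ t h m → con 6 :+ t :+ h :+ con 4 :* (m :+ con 3) := t :+ (h :+ (con 4 :* m :+ con 18))) refl t (half m) m)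
    (cong (λ y → t + y) (≡-sym (half-4 m))))

  class-8 : ∀ m t → Class k (13 + m) t → Class k (5 + m) t
  class-8 m t = class-shift {c = c} {m = 8 + m} {m′ = m} {x = 2 * m + 13} ck (trans
    (solve 3 (λ t h m → t :+ h :+ con 4 :* (con 2 :* m :+ con 13)
                := t :+ (h :+ (con 4 :* m :+ con 18) :+ (con 4 :* (con 4 :+ m) :+ con 18))) refl t (half m) m)
    (cong (λ y → t + y) (≡-sym (trans (half-4 (4 + m)) (cong (_+ (4 * (4 + m) + 18)) (half-4 m))))))

-- For literal n and t the congruence is a divisibility between literal natural numbers, which
-- evaluation decides.
refute : {A : Set} {k m : ℕ} → k ∣ m → {False (k ∣? m)} → A
refute h {f} = ⊥-elim (toWitnessFalse f h)

-- The recursions on n and t.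

pattern ≥2 u = suc (suc u)
pattern ≥6 u = ≥2 (≥2 (≥2 u))

-- The case t ≤ 3 goes beyond the range of the theorem; it contains the quadrangulations
-- with (n , t) = (4 , 2), (6 , 3) and (5 , 2), which are needed to start the recursions.
InRange : (m t : ℕ) → Set
InRange m t = t ≤ 3 ⊎ t ≤ m

range-skip : ∀ m {u} → InRange (4 + m) (6 + u) → InRange m u
range-skip m (inj₁ (s≤s (s≤s (s≤s ()))))
range-skip m (inj₂ h) = inj₂ (≤-trans (m≤n+m _ 2) (+-cancelˡ-≤ 4 _ _ h))

4≤5+ : ∀ m → 4 ≤ 5 + m
4≤5+ m = s≤s (s≤s (s≤s (s≤s z≤n)))

-- Parts of size 4 and 8 are removed and n = 5 is the least value, so n = 5 to 8 are settled for
-- every t, but n = 9 to 12 only for t ≤ 1; from there on t ≥ 2 is reduced to n - 4.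
orientable-map : ∀ m t → InRange (1 + m) t → Class 4 (5 + m) t → SomeMap (5 + m) t ori
orientable-map 0 0 _ _ = odd ori-5-0
orientable-map 0 1 _ c = refute c
orientable-map 0 2 _ c = refute c
orientable-map 0 3 _ c = refute c
orientable-map 0 (suc (suc (suc (suc _)))) (inj₁ (s≤s (s≤s (s≤s ())))) _
orientable-map 0 (suc (suc (suc (suc _)))) (inj₂ (s≤s ())) _
orientable-map 1 0 _ c = refute c
orientable-map 1 1 _ c = refute c
orientable-map 1 2 _ c = refute c
orientable-map 1 3 _ _ = even ori-6-3
orientable-map 1 (suc (suc (suc (suc _)))) (inj₁ (s≤s (s≤s (s≤s ())))) _
orientable-map 1 (suc (suc (suc (suc _)))) (inj₂ (s≤s (s≤s ()))) _
orientable-map 2 0 _ c = refute c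
orientable-map 2 1 _ c = refute c
orientable-map 2 2 _ c = refute c
orientable-map 2 3 _ _ = odd ori-7-3
orientable-map 2 (suc (suc (suc (suc _)))) (inj₁ (s≤s (s≤s (s≤s ())))) _
orientable-map 2 (suc (suc (suc (suc _)))) (inj₂ (s≤s (s≤s (s≤s ())))) _
orientable-map 3 0 _ _ = even ori-8-0
orientable-map 3 1 _ c = refute c
orientable-map 3 2 _ c = refute c
orientable-map 3 3 _ c = refute c
-- The general step would lead to n = 4, below the start of the recursion; here the second part is
-- another 4-cycle.
orientable-map 3 4 _ _ = add-4 (even ori-4-2) (s≤s (s≤s (s≤s (s≤s z≤n))))
orientable-map 3 (suc (suc (suc (suc (suc _))))) (inj₁ (s≤s (s≤s (s≤s ())))) _
orientable-map 3 (suc (suc (suc (suc (suc _))))) (inj₂ (s≤s (s≤s (s≤s (s≤s ()))))) _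
orientable-map 4 0 _ c = refute c
orientable-map 4 1 _ c = refute c
orientable-map 5 0 _ c = refute c
orientable-map 5 1 _ _ = even ori-10-1
orientable-map 6 0 _ c = refute c
orientable-map 6 1 _ _ = odd ori-11-1
orientable-map 7 0 _ c = refute c
orientable-map 7 1 _ c = refute c
orientable-map (suc (suc (suc (suc (suc (suc (suc (suc m)))))))) t@0 r c =
  add-8-ori (orientable-map m t (inj₁ z≤n) (class-8 1 refl m t c)) (4≤5+ m)
orientable-map (suc (suc (suc (suc (suc (suc (suc (suc m)))))))) t@1 r c =
  add-8-ori (orientable-map m t (inj₁ (s≤s z≤n)) (class-8 1 refl m t c)) (4≤5+ m)
orientable-map (suc (suc (suc (suc m)))) (≥6 u) r c =
  add-4-skip (orientable-map m u (range-skip (1 + m) r) (class-4-skip 1 refl m u c)) (4≤5+ m)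
orientable-map (suc (suc (suc (suc m)))) 2 r c =
  add-4 (orientable-map m 0 (inj₁ z≤n) (class-4 1 refl m 0 c)) (4≤5+ m)
orientable-map (suc (suc (suc (suc m)))) 3 r c =
  add-4 (orientable-map m 1 (inj₁ (s≤s z≤n)) (class-4 1 refl m 1 c)) (4≤5+ m)
orientable-map (suc (suc (suc (suc m)))) 4 r c =
  add-4 (orientable-map m 2 (inj₁ (s≤s (s≤s z≤n))) (class-4 1 refl m 2 c)) (4≤5+ m)
orientable-map (suc (suc (suc (suc m)))) 5 r c =
  add-4 (orientable-map m 3 (inj₁ (s≤s (s≤s (s≤s z≤n)))) (class-4 1 refl m 3 c)) (4≤5+ m)

nonorientable-map : ∀ m t → InRange (2 + m) t → Class 2 (6 + m) t → SomeMap (6 + m) t non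
nonorientable-map 0 0 _ c = refute c
nonorientable-map 0 1 _ _ = even non-6-1
nonorientable-map 0 2 _ c = refute c
nonorientable-map 0 3 _ _ = even non-6-3
nonorientable-map 0 (suc (suc (suc (suc _)))) (inj₁ (s≤s (s≤s (s≤s ())))) _
nonorientable-map 0 (suc (suc (suc (suc _)))) (inj₂ (s≤s (s≤s ()))) _
nonorientable-map 1 0 _ c = refute c
nonorientable-map 1 1 _ _ = odd non-7-1
nonorientable-map 1 2 _ c = refute c
nonorientable-map 1 3 _ _ = odd non-7-3
nonorientable-map 1 (suc (suc (suc (suc _)))) (inj₁ (s≤s (s≤s (s≤s ())))) _
nonorientable-map 1 (suc (suc (suc (suc _)))) (inj₂ (s≤s (s≤s (s≤s ())))) _
nonorientable-map 2 0 _ _ = even non-8-0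
nonorientable-map 2 1 _ c = refute c
nonorientable-map 2 2 _ _ = even non-8-2
nonorientable-map 2 3 _ c = refute c
nonorientable-map 2 4 _ _ = even non-8-4
nonorientable-map 2 (suc (suc (suc (suc (suc _))))) (inj₁ (s≤s (s≤s (s≤s ())))) _
nonorientable-map 2 (suc (suc (suc (suc (suc _))))) (inj₂ (s≤s (s≤s (s≤s (s≤s ()))))) _
nonorientable-map 3 0 _ _ = odd non-9-0
nonorientable-map 3 1 _ c = refute c
nonorientable-map 3 2 _ _ = odd non-9-2
nonorientable-map 3 3 _ c = refute c
-- The second part has n = 5, below this recursion, which starts at n = 6 because of the exception
-- (5 , 0).
nonorientable-map 3 4 _ _ = add-4 (odd non-5-2) (4≤5+ 0)
nonorientable-map 3 5 _ c = refute c
nonorientable-map 3 (≥6 _) (inj₁ (s≤s (s≤s (s≤s ())))) _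
nonorientable-map 3 (≥6 _) (inj₂ (s≤s (s≤s (s≤s (s≤s (s≤s ())))))) _
nonorientable-map 4 0 _ c = refute c
nonorientable-map 4 1 _ _ = even non-10-1
nonorientable-map 5 0 _ c = refute c
nonorientable-map 5 1 _ _ = odd non-11-1
-- Removing K₈ would leave K₄, whose projective embedding cannot be decorated, so K₁₂ is given
-- explicitly.
nonorientable-map 6 0 _ _ = even non-12-0
nonorientable-map 6 1 _ c = refute c
-- K₅ has no nonorientable quadrangular embedding, so the nonorientable part of K₁₃ is K₈, and K₅ is
-- taken on the torus.
nonorientable-map 7 0 _ _ = add-8-non (odd ori-5-0) (4≤5+ 0)
nonorientable-map 7 1 _ c = refute c
nonorientable-map (suc (suc (suc (suc (suc (suc (suc (suc m)))))))) t@0 r c =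
  add-8-ori (nonorientable-map m t (inj₁ z≤n) (class-8 2 refl (1 + m) t c)) (4≤5+ (1 + m))
nonorientable-map (suc (suc (suc (suc (suc (suc (suc (suc m)))))))) t@1 r c =
  add-8-ori (nonorientable-map m t (inj₁ (s≤s z≤n)) (class-8 2 refl (1 + m) t c)) (4≤5+ (1 + m))
nonorientable-map (suc (suc (suc (suc m)))) (≥6 u) r c =
  add-4-skip (nonorientable-map m u (range-skip (2 + m) r) (class-4-skip 2 refl (1 + m) u c)) (4≤5+ (1 + m))
nonorientable-map (suc (suc (suc (suc m)))) 2 r c =
  add-4 (nonorientable-map m 0 (inj₁ z≤n) (class-4 2 refl (1 + m) 0 c)) (4≤5+ (1 + m))
nonorientable-map (suc (suc (suc (suc m)))) 3 r c =
  add-4 (nonorientable-map m 1 (inj₁ (s≤s z≤n)) (class-4 2 refl (1 + m) 1 c)) (4≤5+ (1 + m))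
nonorientable-map (suc (suc (suc (suc m)))) 4 r c =
  add-4 (nonorientable-map m 2 (inj₁ (s≤s (s≤s z≤n))) (class-4 2 refl (1 + m) 2 c)) (4≤5+ (1 + m))
nonorientable-map (suc (suc (suc (suc m)))) 5 r c =
  add-4 (nonorientable-map m 3 (inj₁ (s≤s (s≤s (s≤s z≤n)))) (class-4 2 refl (1 + m) 3 c)) (4≤5+ (1 + m))

-- K₄ in the projective plane has no two distinct faces with complementary
-- diagonals, so it cannot be decorated.
projective-K₄ : NonorientableQuad 4 6
projective-K₄ = T.graph , T.connected , refl , T.embedding , T.quadrangular refl ,
    T.nonorientable 0F (1F ∷ 3F ∷ 0F ∷ []) refl
  where
  module T = Table.Checked
    ((0F ∷ 3F ∷ 1F ∷ 2F ∷ []) ∷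
     (2F ∷ 1F ∷ 3F ∷ 0F ∷ []) ∷
     (3F ∷ 0F ∷ 2F ∷ 1F ∷ []) ∷
     (2F ∷ 0F ∷ 1F ∷ 3F ∷ []) ∷ [])
    (twistedAt ((0F , 1F) ∷ (1F , 2F) ∷ (0F , 2F) ∷ [])) refl

-- The cases of the theorem.

orientable-case : (n t : ℕ) → 4 ≤ n → t ≤ n ∸ 4 → (+ t) ≡[mod 4 ] halfNN5 n → OrientableQuad n (n C 2 ∸ t)
-- Here `halfNN5 4` is -2, which is even but not divisible by 4; so (4 , 0) occurs in the
-- nonorientable case only.
orientable-case 4 0 _ _ c = refute c
orientable-case (suc (suc (suc (suc (suc m))))) t _ h c = orientable-quad (orientable-map m t (inj₂ h) c)
orientable-case 0 _ ()
orientable-case 1 _ (s≤s ())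
orientable-case 2 _ (s≤s (s≤s ()))
orientable-case 3 _ (s≤s (s≤s (s≤s ())))

nonorientable-case : (n t : ℕ) → 4 ≤ n → t ≤ n ∸ 4 → (+ t) ≡[mod 2 ] halfNN5 n →
  (n , t) ≢ (5 , 0) → NonorientableQuad n (n C 2 ∸ t)
nonorientable-case 4 0 _ _ _ _ = projective-K₄
nonorientable-case 5 0 _ _ _ ne = ⊥-elim (ne refl)
nonorientable-case 5 1 _ _ c _ = refute c
nonorientable-case 5 (suc (suc _)) _ (s≤s ())
nonorientable-case (suc (suc (suc (suc (suc (suc m)))))) t _ h c _ = nonorientable-quad (nonorientable-map m t (inj₂ h) c)
nonorientable-case 0 _ ()
nonorientable-case 1 _ (s≤s ())
nonorientable-case 2 _ (s≤s (s≤s ()))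
nonorientable-case 3 _ (s≤s (s≤s (s≤s ())))

theorem1p2 : ((n t : ℕ) → 4 ≤ n → t ≤ n ∸ 4 → (+ t) ≡[mod 4 ] halfNN5 n →
    OrientableQuad n (n C 2 ∸ t))
    × OrientableQuad 4 (4 C 2 ∸ 2)
    × ((n t : ℕ) → 4 ≤ n → t ≤ n ∸ 4 → (+ t) ≡[mod 2 ] halfNN5 n →
    (n , t) ≢ (5 , 0) → NonorientableQuad n (n C 2 ∸ t))
    × ¬ NonorientableQuad 5 (5 C 2 ∸ 0)
    × NonorientableQuad 6 (6 C 2 ∸ 3)
theorem1p2 = orientable-case , orientable-quad (even ori-4-2) , nonorientable-case ,
  no-nonorientable-K₅ , nonorientable-quad (even non-6-3)
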